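{- Let $m\ge2$ and $1\le k\le 8$, and let $p_{3k}(n)$, $\nu=\nu_m(k)$ and $c_2$ be as defined in the context. The following hold: (i) If $c_2^\beta\not\equiv0\pmod m$ for every $\beta\ge1$, then for all $\beta\ge 1$, $n\ge0$ and $i\in\{1,2\}$, $$p_{3k}\left(3^{2\nu\beta}n+\frac{(3k+8i)\cdot3^{2\nu\beta-1}-k}{8}\right)\equiv0\pmod m.$$ (ii) If $\beta$ is a positive integer such that $c_2^\beta\equiv0\pmod m$, then for all $n\ge0$, $$p_{3k}\left(3^{2\nu\beta-1}n+\frac{k(3^{2\nu\beta}-1)}{8}\right)\equiv0\pmod m.$$
   Context: The integers $p_j(n)$ are defined by $\prod_{n\ge1}(1-q^n)^j=\sum_{n\ge0}p_j(n)q^n$. The integer sequences $C_k(\beta)$, $D_{k,i}(\beta)$ ($1\le k\le8$, $1\le i\le\lfloor k/3\rfloor$, $\beta\ge0$) are defined as follows: for each $k$ all of them satisfy $s(\beta+4)=h(k)s(\beta+2)+r(k)s(\beta)$ for $\beta\ge0$, with the following coefficients and initial values $(s(0),s(1),s(2),s(3))$: $k=1$: $h=-3$, $r=0$; $C_1:(1,-3,-3,9)$. $k=2$: $h=9$, $r=0$; $C_2:(1,9,9,81)$. $k=3$: $h=-12$, $r=-3^7$; $C_3:(1,0,-12,-2187)$; $D_{3,1}:(0,1,-243,-12)$. $k=4$: $h=-2\cdot3^2\cdot19$, $r=-3^{10}$; $C_4:(1,-243,-99,24057)$; $D_{4,1}:(0,-12,2916,4104)$. $k=5$: $h=2^2\cdot3^3\cdot17$,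 $r=-3^{13}$; $C_5:(1,2187,1107,2421009)$; $D_{5,1}:(0,90,-21870,165240)$. $k=6$: $h=-2\cdot3^2\cdot17\cdot23$, $r=-3^{16}$; $C_6:(1,-13122,-7038,49305915)$; $D_{6,1}:(0,-486,118098,3420468)$; $D_{6,2}:(0,1,-177147,-7038)$. $k=7$: $h=2^2\cdot3^3\cdot491$, $r=-3^{19}$; $C_7:(1,59049,33345,1968988905)$; $D_{7,1}:(0,1701,-413343,90200628)$; $D_{7,2}:(0,-21,3720087,-1113588)$. $k=8$: $h=-2\cdot3^4\cdot5\cdot359$, $r=-3^{22}$; $C_8:(1,-177147,-113643,20131516521)$; $D_{8,1}:(0,0,0,0)$; $D_{8,2}:(0,252,-44641044,-73279080)$. For $m\ge2$, $\nu_m(k)=\min\{\beta\ge1 : D_{k,i}(2\beta-1)\equiv0\pmod m\text{ for all }1\le i\le\lfloor k/3\rfloor\}$ (this minimum is known to exist for every $m\ge2$; for $k=1,2$ the condition is empty, so $\nu_m(k)=1$), and $c_2$ is the integer with $0\le c_2\le m-1$ and $c_2\equiv C_k(2\nu_m(k)-1)\pmod m$. -}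

module Defs where

open import Data.Bool using (if_then_else_)
open import Data.Fin using (toℕ)
open import Data.Integer using (ℤ; +_; -_; _+_; _-_; _*_; 0ℤ; 1ℤ)
open import Data.Integer.Divisibility using (_∣_)
open import Data.Integer.Properties using (+-0-monoid)
open import Data.Nat as ℕ using (ℕ; zero; suc; _∸_; _^_; _≤_; _<_; _/_; _≡ᵇ_)

open import Algebra.Properties.Monoid.Sum +-0-monoid using (sum⁺-syntax)

------------------------------------------------------------------------
-- Formal power series over ℤ: f n is the coefficient of q^n

Series : Set
Series = ℕ → ℤ

q^_ : ℕ → Series
(q^ i) n = if n ≡ᵇ i then 1ℤ else 0ℤ

1ₛ : Series
1ₛ = q^ 0

infixl 6 _-ₛ_
infixl 7 _*ₛ_
infixr 8 _^ₛ_

_-ₛ_ : Series → Series → Series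
(f -ₛ g) n = f n - g n

_*ₛ_ : Series → Series → Series
(f *ₛ g) n = ∑[ a ≤ n ] (f (toℕ a) * g (n ∸ toℕ a))

_^ₛ_ : Series → ℕ → Series
f ^ₛ zero  = 1ₛ
f ^ₛ suc j = f *ₛ f ^ₛ j

-- The product F 1 · F 2 · … · F N.
∏ₛ : ℕ → (ℕ → Series) → Series
∏ₛ zero    F = 1ₛ
∏ₛ (suc N) F = ∏ₛ N F *ₛ F (suc N)

-- The coefficient of q^n in the infinite product ∏_{i ≥ 1} (1 - q^i)^j,
-- for j ≥ 0.  Every factor with i > n is 1 + O(q^{n+1}), so the partial
-- product over 1 ≤ i ≤ n already has the right coefficient at q^n.
p : ℕ → ℕ → ℤ
p j n = ∏ₛ n (λ i → (1ₛ -ₛ (q^ i)) ^ₛ j) n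

------------------------------------------------------------------------
-- The sequences C_k and D_{k,i}.  Only 1 ≤ k ≤ 8 and 1 ≤ i ≤ ⌊k/3⌋ are
-- meaningful; outside this range all values are 0.

h : ℕ → ℤ
h 1 = - + 3
h 2 = + 9
h 3 = - + 12
h 4 = - + (2 ℕ.* 3 ^ 2 ℕ.* 19)
h 5 = + (2 ^ 2 ℕ.* 3 ^ 3 ℕ.* 17)
h 6 = - + (2 ℕ.* 3 ^ 2 ℕ.* 17 ℕ.* 23)
h 7 = + (2 ^ 2 ℕ.* 3 ^ 3 ℕ.* 491)
h 8 = - + (2 ℕ.* 3 ^ 4 ℕ.* 5 ℕ.* 359)
h _ = 0ℤ

r : ℕ → ℤ
r 3 = - + (3 ^ 7)
r 4 = - + (3 ^ 10)
r 5 = - + (3 ^ 13)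
r 6 = - + (3 ^ 16)
r 7 = - + (3 ^ 19)
r 8 = - + (3 ^ 22)
r _ = 0ℤ

recSeq : ℕ → (s₀ s₁ s₂ s₃ : ℤ) → ℕ → ℤ
recSeq k s₀ s₁ s₂ s₃ = s
  where
  s : ℕ → ℤ
  s 0 = s₀
  s 1 = s₁
  s 2 = s₂
  s 3 = s₃
  s (suc (suc (suc (suc β)))) = h k * s (suc (suc β)) + r k * s β

C : ℕ → ℕ → ℤ
C 1 = recSeq 1 (+ 1) (- + 3)      (- + 3)      (+ 9)
C 2 = recSeq 2 (+ 1) (+ 9)        (+ 9)        (+ 81)
C 3 = recSeq 3 (+ 1) (+ 0)        (- + 12)     (- + 2187)
C 4 = recSeq 4 (+ 1) (- + 243)    (- + 99)     (+ 24057)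
C 5 = recSeq 5 (+ 1) (+ 2187)     (+ 1107)     (+ 2421009)
C 6 = recSeq 6 (+ 1) (- + 13122)  (- + 7038)   (+ 49305915)
C 7 = recSeq 7 (+ 1) (+ 59049)    (+ 33345)    (+ 1968988905)
C 8 = recSeq 8 (+ 1) (- + 177147) (- + 113643) (+ 20131516521)
C _ = λ _ → 0ℤ

D : ℕ → ℕ → ℕ → ℤ
D 3 1 = recSeq 3 (+ 0) (+ 1)     (- + 243)      (- + 12)
D 4 1 = recSeq 4 (+ 0) (- + 12)  (+ 2916)       (+ 4104)
D 5 1 = recSeq 5 (+ 0) (+ 90)    (- + 21870)    (+ 165240)
D 6 1 = recSeq 6 (+ 0) (- + 486) (+ 118098)     (+ 3420468)
D 6 2 = recSeq 6 (+ 0) (+ 1)     (- + 177147)   (- + 7038)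
D 7 1 = recSeq 7 (+ 0) (+ 1701)  (- + 413343)   (+ 90200628)
D 7 2 = recSeq 7 (+ 0) (- + 21)  (+ 3720087)    (- + 1113588)
D 8 1 = recSeq 8 (+ 0) (+ 0)     (+ 0)          (+ 0)
D 8 2 = recSeq 8 (+ 0) (+ 252)   (- + 44641044) (- + 73279080)
D _ _ = λ _ → 0ℤ

------------------------------------------------------------------------
-- Congruences, ν_m(k) and c₂

infix 4 _≡_[mod_]

_≡_[mod_] : ℤ → ℤ → ℕ → Set
x ≡ y [mod m ] = + m ∣ (x - y)

DVanish : (m k β : ℕ) → Set
DVanish m k β = ∀ i → 1 ≤ i → i ≤ k / 3 → D k i (2 ℕ.* β ∸ 1) ≡ 0ℤ [mod m ]

-- IsNu m k ν says that ν is the minimum defining ν_m(k), which is thereby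
-- unique.
record IsNu (m k ν : ℕ) : Set where
  field
    positive : 1 ≤ ν
    vanishes : DVanish m k ν
    minimal  : ∀ β → 1 ≤ β → DVanish m k β → ν ≤ β

-- IsC₂ m k ν c says that c is the residue of C_k(2ν - 1) in {0, …, m - 1}.
record IsC₂ (m k ν c : ℕ) : Set where
  field
    bounded   : c < m
    congruent : + c ≡ C k (2 ℕ.* ν ∸ 1) [mod m ]

------------------------------------------------------------------------
-- The arguments of p_{3k}.  For ν, β ≥ 1 the subtractions below do not
-- truncate and the divisions by 8 are exact: 8 divides
-- 3k·3^{2νβ-1} - k = k(9^{νβ} - 1).

index₁ : (k ν β i n : ℕ) → ℕ
index₁ k ν β i n =
  3 ^ (2 ℕ.* ν ℕ.* β) ℕ.* n
    ℕ.+ ((3 ℕ.* k ℕ.+ 8 ℕ.* i) ℕ.* 3 ^ (2 ℕ.* ν ℕ.* β ∸ 1) ∸ k) / 8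

index₂ : (k ν β n : ℕ) → ℕ
index₂ k ν β n =
  3 ^ (2 ℕ.* ν ℕ.* β ∸ 1) ℕ.* n
    ℕ.+ (k ℕ.* (3 ^ (2 ℕ.* ν ℕ.* β) ∸ 1)) / 8

{-# OPTIONS --safe #-}
module Submission where

-- Let x = q ∏ (1 - q^(8n))³, so that p_{3k}(n) is the coefficient of x^k at
-- q^(8n+k), let y = x(q³), z = x(q⁹), and let U be Σ a(n) qⁿ ↦ Σ a(3n) qⁿ.
-- Jacobi's identity ∏ (1 - qⁿ)³ = Σ (-1)^j (2j+1) q^(j(j+1)/2) gives
-- x = π - 3z with all exponents of π congruent to 1 mod 3, and the product
-- of x over the substitutions q ↦ ωq, ω³ = 1, gives π³ = ρ(q³) with
-- ρy = x⁴ + 27y⁴.  Expanding (π - 3z)^k, one finds an integral series G with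
-- U(x^k) = C_k(1) y^k + D_k(1) G and U³(x^k) = h U(x^k) + r y^k, where D_k is
-- D_{k,⌊k/3⌋}.  As U²(y^k) = U(x^k), induction yields
-- U^(2ν-1)(x^k) = C_k(2ν-1) y^k + D_k(2ν-1) G.  Modulo m the last term
-- vanishes, so the coefficients a of x^k satisfy
-- a(3^(2ν-1) n) ≡ c₂ a(n/3), where a(n/3) = 0 unless 3 ∣ n; this is iterated.

open import Algebra.Bundles using (CommutativeRing)
open import Algebra.Solver.Ring.AlmostCommutativeRing using (fromCommutativeRing; _-Raw-AlmostCommutative⟶_)
open import Data.Fin using (zero; suc)
open import Data.Integer as ℤ using (ℤ; +_; 0ℤ; 1ℤ)
open import Data.Maybe using (Maybe; just; nothing)
open import Data.Nat as ℕ using (ℕ; zero; suc; _∸_; _≤_; _<_; z≤n; s≤s)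
open import Data.Product using (∃; _×_; _,_; proj₁; proj₂)
open import Data.Sum using (_⊎_; inj₁; inj₂)
open import Data.Vec using ([]; _∷_)
open import Level using (0ℓ; _⊔_)
open import Relation.Binary.Bundles using (Setoid)
open import Relation.Binary.PropositionalEquality as ≡ using (_≡_)
open import Relation.Nullary using (¬_; yes; no)
import Algebra.Properties.AbelianGroup
import Algebra.Properties.CommutativeSemiring.Exp
import Algebra.Properties.Semiring.Exp
import Algebra.Solver.Ring
import Data.Integer.Divisibility.Signed as ℤ∣
import Data.Integer.Properties as ℤₚ
import Data.Integer.Tactic.RingSolver as ℤ-Tactic
import Data.Nat.Properties as ℕₚ
import Data.Nat.Tactic.RingSolver as ℕ-Tactic
import Relation.Binary.Reasoning.Setoid as SetoidReasoning

-- The exponents of x are the odd squares (2j+1)². A square prime to 3 is 1 mod 3; the others come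
-- from j = 3l+1, with exponent 9(2l+1)² and coefficient -3 (-1)^l (2l+1), hence π and -3z. The
-- equation for ρ compares two values of the product of the conjugates of x under q ↦ ωq: it is π³ -
-- 27z³ and, factor by factor, y⁴/z. The obstacle is division. U(x³) is the quotient x⁴/y, and
-- U²(x^k) is obtained as a quotient by x, x², x for k = 3, 6, 7. These are integral series, but the
-- identities are polynomial only after multiplication. So equations are stated with denominators
-- cleared and then cancelled, and a denominator x is removed through its two other conjugates,
-- whose product κ involves no ω. G has to be integral too, since its factor D_k(2ν-1) is known to
-- vanish only modulo m. Infinite products enter through partial products: Jacobi's identity starts
-- from a finite version with Gaussian binomials, the norm from the factors with n ≤ 3m, and both
-- reach the limit by congruences modulo powers of q.

module ℤ-Solver {c ℓ} (R : CommutativeRing c ℓ)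
  (ι : ℤ.+-*-rawRing -Raw-AlmostCommutative⟶ fromCommutativeRing R) where

  open CommutativeRing R hiding (zero)
  open _-Raw-AlmostCommutative⟶_ ι public using () renaming (⟦_⟧ to #)

  #-cong? : ∀ a b → Maybe (# a ≈ # b)
  #-cong? a b with a ℤₚ.≟ b
  ... | yes a≡b = just (reflexive (≡.cong # a≡b))
  ... | no _    = nothing

  open Algebra.Solver.Ring ℤ.+-*-rawRing (fromCommutativeRing R) ι #-cong? public
    using (Polynomial; var; con; solve; prove; _:=_; _:+_; _:*_; _:-_; :-_; _:^_)
    renaming (⟦_⟧ to eval)
  open Algebra.Properties.Semiring.Exp semiring public

-- The instances are q ↦ q³ and q ↦ q⁸. Fixing the integer constants makes such a map ℤ-linear,
-- which yields 0, 1 and negation.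
record Endomorphism {c ℓ} (R : CommutativeRing c ℓ)
  (ι : ℤ.+-*-rawRing -Raw-AlmostCommutative⟶ fromCommutativeRing R) : Set (c ⊔ ℓ) where

  open CommutativeRing R hiding (zero)
  open ℤ-Solver R ι
  open _-Raw-AlmostCommutative⟶_ ι using (0-homo; 1-homo)

  field
    φ       : Carrier → Carrier
    φ-cong  : ∀ {a b} → a ≈ b → φ a ≈ φ b
    φ-+     : ∀ a b → φ (a + b) ≈ φ a + φ b
    φ-*     : ∀ a b → φ (a * b) ≈ φ a * φ b
    φ-#     : ∀ n → φ (# n) ≈ # n

  φ-0 : φ 0# ≈ 0#
  φ-0 = trans (φ-cong (sym 0-homo)) (trans (φ-# (+ 0)) 0-homo)

  φ-1 : φ 1# ≈ 1#
  φ-1 = trans (φ-cong (sym 1-homo)) (trans (φ-# (+ 1)) 1-homo)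

  φ-^ : ∀ a n → φ (a ^ n) ≈ φ a ^ n
  φ-^ a zero    = φ-1
  φ-^ a (suc n) = trans (φ-* a (a ^ n)) (*-congˡ (φ-^ a n))

  φ-#* : ∀ n a → φ (# n * a) ≈ # n * φ a
  φ-#* n a = trans (φ-* (# n) a) (*-congʳ (φ-# n))

  φ-neg : ∀ a → φ (- a) ≈ - φ a
  φ-neg a = trans (φ-cong -a≈) (trans (φ-#* (ℤ.- + 1) a) (sym -a≈))
    where
    -a≈ : ∀ {a} → - a ≈ # (ℤ.- + 1) * a
    -a≈ {a} = solve 1 (λ a → :- a := con (ℤ.- + 1) :* a) refl a

-- The operator U on the powers of x

module Trisection {c ℓ} (R : CommutativeRing c ℓ)
  (ι : ℤ.+-*-rawRing -Raw-AlmostCommutative⟶ fromCommutativeRing R) where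

  open CommutativeRing R hiding (zero)
  open ℤ-Solver R ι
  open SetoidReasoning setoid

  open _-Raw-AlmostCommutative⟶_ ι using (1-homo; +-homo; *-homo)

  -- φ is the substitution q ↦ q³.
  record Setting : Set (c ⊔ ℓ) where
    field
      endo    : Endomorphism R ι
    open Endomorphism endo public
    field
      U       : Carrier → Carrier
      U-cong  : ∀ {a b} → a ≈ b → U a ≈ U b
      U-+     : ∀ a b → U (a + b) ≈ U a + U b
      U-φ*    : ∀ a b → U (φ a * b) ≈ a * U b
      U-1     : U 1# ≈ 1#
      x π ρ   : Carrier
    y = φ x
    z = φ y
    field
      x-split    : x ≈ π + # (ℤ.- + 3) * z
      π³         : π ^ 3 ≈ φ ρ
      U-π        : U π ≈ 0#
      U-π²       : U (π ^ 2) ≈ 0#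
      ρy         : ρ * y ≈ x ^ 4 + # (+ 27) * y ^ 4
      x-cancelˡ  : ∀ {a b} → x * a ≈ x * b → a ≈ b

  module HeckeOperator (S : Setting) where
    open Setting S

    U-φ : ∀ a → U (φ a) ≈ a
    U-φ a = begin
      U (φ a)      ≈⟨ U-cong (*-identityʳ (φ a)) ⟨
      U (φ a * 1#) ≈⟨ U-φ* a 1# ⟩
      a * U 1#     ≈⟨ *-congˡ U-1 ⟩
      a * 1#       ≈⟨ *-identityʳ a ⟩
      a            ∎

    U-#* : ∀ n a → U (# n * a) ≈ # n * U a
    U-#* n a = trans (U-cong (*-congʳ (sym (φ-# n)))) (U-φ* (# n) a)

    -- Dissection by exponents mod 3, with π and π² in place of q and q². As π³ lies in the image of
    -- φ, multiplication by x = π - 3z acts linearly on (A, B, C), and U reads off A.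
    Tri : (F A B C : Carrier) → Set ℓ
    Tri F A B C = F ≈ φ A + π * φ B + π ^ 2 * φ C

    Tri⇒U : ∀ {F A B C} → Tri F A B C → U F ≈ A
    Tri⇒U {F} {A} {B} {C} F≈ = begin
      U F                                       ≈⟨ U-cong F≈ ⟩
      U (φ A + π * φ B + π ^ 2 * φ C)           ≈⟨ U-+ _ _ ⟩
      U (φ A + π * φ B) + U (π ^ 2 * φ C)       ≈⟨ +-congʳ (U-+ _ _) ⟩
      U (φ A) + U (π * φ B) + U (π ^ 2 * φ C)   ≈⟨ +-cong (+-cong (U-φ A) (vanish U-π)) (vanish U-π²) ⟩
      A + 0# + 0#                               ≈⟨ trans (+-identityʳ _) (+-identityʳ _) ⟩
      A                                         ∎
      where
      vanish : ∀ {a b} → U a ≈ 0# → U (a * φ b) ≈ 0#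
      vanish {a} {b} Ua≈0 = trans (U-cong (*-comm a (φ b))) (trans (U-φ* b a) (trans (*-congˡ Ua≈0) (zeroʳ b)))

    Tri-x* : ∀ {F A B C} → Tri F A B C →
      Tri (x * F) (ρ * C + # (ℤ.- + 3) * (y * A)) (A + # (ℤ.- + 3) * (y * B)) (B + # (ℤ.- + 3) * (y * C))
    Tri-x* {F} {A} {B} {C} F≈ = begin
      x * F
        ≈⟨ *-cong x-split F≈ ⟩
      (π + # (ℤ.- + 3) * z) * (φ A + π * φ B + π ^ 2 * φ C)
        ≈⟨ solve 5 (λ π z a b c → (π :+ con (ℤ.- + 3) :* z) :* (a :+ π :* b :+ π :^ 2 :* c) :=
             π :^ 3 :* c :+ con (ℤ.- + 3) :* (z :* a) :+ π :* (a :+ con (ℤ.- + 3) :* (z :* b))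
             :+ π :^ 2 :* (b :+ con (ℤ.- + 3) :* (z :* c))) refl π z (φ A) (φ B) (φ C) ⟩
      π ^ 3 * φ C + # (ℤ.- + 3) * (z * φ A) + π * (φ A + # (ℤ.- + 3) * (z * φ B))
        + π ^ 2 * (φ B + # (ℤ.- + 3) * (z * φ C))
        ≈⟨ +-cong (+-cong (trans (+-congʳ (trans (*-congʳ π³) (sym (φ-* ρ C)))) (collect (ρ * C) A))
             (*-congˡ (collect A B))) (*-congˡ (collect B C)) ⟩
      φ (ρ * C + # (ℤ.- + 3) * (y * A)) + π * φ (A + # (ℤ.- + 3) * (y * B))
        + π ^ 2 * φ (B + # (ℤ.- + 3) * (y * C)) ∎
      where
      collect : ∀ a b → φ a + # (ℤ.- + 3) * (z * φ b) ≈ φ (a + # (ℤ.- + 3) * (y * b))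
      collect a b = sym (trans (φ-+ _ _) (+-congˡ (trans (φ-#* _ _) (*-congˡ (φ-* y b)))))

    private
      ρ′ y′ : Polynomial 2
      ρ′ = var zero
      y′ = var (suc zero)

    -- The coordinates (A, B, C) of x ^ k = (π − 3z) ^ k, as polynomials in ρ and y.
    coords : ℕ → Polynomial 2 × Polynomial 2 × Polynomial 2
    coords zero = con (+ 1) , con (+ 0) , con (+ 0)
    coords (suc k) with coords k
    ... | A , B , C = ρ′ :* C :+ con (ℤ.- + 3) :* (y′ :* A)
                    , A :+ con (ℤ.- + 3) :* (y′ :* B) , B :+ con (ℤ.- + 3) :* (y′ :* C)

    coord₀ : ℕ → Polynomial 2
    coord₀ k = proj₁ (coords k)

    private
      ⟪_⟫ : Polynomial 2 → Carrier
      ⟪ P ⟫ = eval P (ρ ∷ y ∷ [])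

    Tri-x^ : ∀ k → let (A , B , C) = coords k in Tri (x ^ k) ⟪ A ⟫ ⟪ B ⟫ ⟪ C ⟫
    Tri-x^ zero = begin
      1#       ≈⟨ 1-homo ⟨
      # (+ 1)  ≈⟨ solve 1 (λ π → con (+ 1) := con (+ 1) :+ π :* con (+ 0) :+ π :^ 2 :* con (+ 0)) refl π ⟩
      # (+ 1) + π * # (+ 0) + π ^ 2 * # (+ 0)
        ≈⟨ +-cong (+-cong (φ-# _) (*-congˡ (φ-# _))) (*-congˡ (φ-# _)) ⟨
      φ (# (+ 1)) + π * φ (# (+ 0)) + π ^ 2 * φ (# (+ 0)) ∎
    Tri-x^ (suc k) = Tri-x* (Tri-x^ k)

    U-x^ : ∀ k → U (x ^ k) ≈ ⟪ coord₀ k ⟫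
    U-x^ k = Tri⇒U (Tri-x^ k)

    U-y^* : ∀ n a → U (y ^ n * a) ≈ x ^ n * U a
    U-y^* n a = trans (U-cong (*-congʳ (sym (φ-^ x n)))) (U-φ* (x ^ n) a)

    U-y^ : ∀ n → U (y ^ n) ≈ x ^ n
    U-y^ n = trans (U-cong (sym (φ-^ x n))) (U-φ (x ^ n))

    U-lin : ∀ m n a b → U (# m * a + # n * b) ≈ # m * U a + # n * U b
    U-lin m n a b = trans (U-+ _ _) (+-cong (U-#* m a) (U-#* n b))

    U-lin₃ : ∀ l m n a b c → U (# l * a + # m * b + # n * c) ≈ # l * U a + # m * U b + # n * U c
    U-lin₃ l m n a b c = trans (U-+ _ _) (+-cong (U-lin l m a b) (U-#* n c))

    x^-cancelˡ : ∀ n {a b} → x ^ n * a ≈ x ^ n * b → a ≈ b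
    x^-cancelˡ zero {a} {b} eq = trans (sym (*-identityˡ a)) (trans eq (*-identityˡ b))
    x^-cancelˡ (suc n) {a} {b} eq = x^-cancelˡ n
      (x-cancelˡ (trans (sym (*-assoc x (x ^ n) a)) (trans eq (*-assoc x (x ^ n) b))))

    -- This is x⁴/y as an integral series. Its image φ σ = π³ - 27z³ is the product of the three
    -- conjugates of x.
    σ : Carrier
    σ = ρ + # (ℤ.- + 27) * y ^ 3

    σy : σ * y ≈ x ^ 4
    σy = begin
      σ * y
        ≈⟨ solve 2 (λ ρ y → (ρ :+ con (ℤ.- + 27) :* y :^ 3) :* y := ρ :* y :- con (+ 27) :* y :^ 4) refl ρ y ⟩
      ρ * y - # (+ 27) * y ^ 4                        ≈⟨ +-congʳ ρy ⟩
      x ^ 4 + # (+ 27) * y ^ 4 - # (+ 27) * y ^ 4     ≈⟨ solve 2 (λ x y → x :+ y :- y := x) refl (x ^ 4) _ ⟩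
      x ^ 4                                           ∎

    -- By `σy`, y divides x⁴, which can be cancelled.
    y-cancelˡ : ∀ {a b} → y * a ≈ y * b → a ≈ b
    y-cancelˡ {a} {b} eq = x^-cancelˡ 4 (begin
      x ^ 4 * a     ≈⟨ *-congʳ σy ⟨
      σ * y * a     ≈⟨ *-assoc σ y a ⟩
      σ * (y * a)   ≈⟨ *-congˡ eq ⟩
      σ * (y * b)   ≈⟨ *-assoc σ y b ⟨
      σ * y * b     ≈⟨ *-congʳ σy ⟩
      x ^ 4 * b     ∎)

    -- The product (ωπ - 3z)(ω²π - 3z) of the two other conjugates of x.
    κ : Carrier
    κ = # (+ 9) * z ^ 2 + π * (# (+ 3) * z) + π ^ 2

    xκ : x * κ ≈ φ σ
    xκ = begin
      x * κ ≈⟨ *-congʳ x-split ⟩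
      (π + # (ℤ.- + 3) * z) * κ
        ≈⟨ solve 2 (λ π z → (π :+ con (ℤ.- + 3) :* z) :* (con (+ 9) :* z :^ 2 :+ π :* (con (+ 3) :* z) :+ π :^ 2)
             := π :^ 3 :+ con (ℤ.- + 27) :* z :^ 3) refl π z ⟩
      π ^ 3 + # (ℤ.- + 27) * z ^ 3 ≈⟨ +-cong (sym π³) (trans (φ-#* _ _) (*-congˡ (φ-^ y 3))) ⟨
      φ ρ + φ (# (ℤ.- + 27) * y ^ 3) ≈⟨ φ-+ _ _ ⟨
      φ σ ∎

    Uκ : U κ ≈ # (+ 9) * y ^ 2
    Uκ = Tri⇒U (begin
      κ ≈⟨ solve 2 (λ π z → con (+ 9) :* z :^ 2 :+ π :* (con (+ 3) :* z) :+ π :^ 2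
             := con (+ 9) :* z :^ 2 :+ π :* (con (+ 3) :* z) :+ π :^ 2 :* con (+ 1)) refl π z ⟩
      # (+ 9) * z ^ 2 + π * (# (+ 3) * z) + π ^ 2 * # (+ 1)
        ≈⟨ +-cong (+-cong (trans (φ-#* _ _) (*-congˡ (φ-^ y 2))) (*-congˡ (φ-#* _ _))) (*-congˡ (φ-# _)) ⟨
      φ (# (+ 9) * y ^ 2) + π * φ (# (+ 3) * y) + π ^ 2 * φ (# (+ 1)) ∎)

    -- In κ² the part with exponents divisible by 3 is 81z⁴, from (9z²)², plus 6π³z, from twice 3πz
    -- times π².
    Uκ² : U (κ ^ 2) * y ^ 2 ≈ # (+ 6) * (x ^ 4 * y ^ 2) + # (+ 243) * y ^ 6
    Uκ² = begin
      U (κ ^ 2) * y ^ 2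
        ≈⟨ *-congʳ (Tri⇒U (begin
          κ ^ 2
            ≈⟨ solve 2 (λ π z → (con (+ 9) :* z :^ 2 :+ π :* (con (+ 3) :* z) :+ π :^ 2) :^ 2
                 := con (+ 6) :* (π :^ 3 :* z) :+ con (+ 81) :* z :^ 4
                 :+ π :* (π :^ 3 :+ con (+ 54) :* z :^ 3) :+ π :^ 2 :* (con (+ 27) :* z :^ 2)) refl π z ⟩
          # (+ 6) * (π ^ 3 * z) + # (+ 81) * z ^ 4 + π * (π ^ 3 + # (+ 54) * z ^ 3) + π ^ 2 * (# (+ 27) * z ^ 2)
            ≈⟨ +-cong (+-cong (+-cong (*-congˡ (*-congʳ π³)) refl) (*-congˡ (+-congʳ π³))) refl ⟩
          # (+ 6) * (φ ρ * z) + # (+ 81) * z ^ 4 + π * (φ ρ + # (+ 54) * z ^ 3) + π ^ 2 * (# (+ 27) * z ^ 2)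
            ≈⟨ +-cong (+-cong
                 (trans (φ-+ _ _) (+-cong (trans (φ-#* _ _) (*-congˡ (φ-* ρ y))) (φ-#*^ _ 4)))
                 (*-congˡ (trans (φ-+ _ _) (+-congˡ (φ-#*^ _ 3)))))
                 (*-congˡ (φ-#*^ _ 2)) ⟨
          φ (# (+ 6) * (ρ * y) + # (+ 81) * y ^ 4) + π * φ (ρ + # (+ 54) * y ^ 3) + π ^ 2 * φ (# (+ 27) * y ^ 2) ∎)) ⟩
      (# (+ 6) * (ρ * y) + # (+ 81) * y ^ 4) * y ^ 2
        ≈⟨ *-congʳ (+-congʳ (*-congˡ ρy)) ⟩
      (# (+ 6) * (x ^ 4 + # (+ 27) * y ^ 4) + # (+ 81) * y ^ 4) * y ^ 2
        ≈⟨ solve 2 (λ x y → (con (+ 6) :* (x :^ 4 :+ con (+ 27) :* y :^ 4) :+ con (+ 81) :* y :^ 4) :* y :^ 2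
             := con (+ 6) :* (x :^ 4 :* y :^ 2) :+ con (+ 243) :* y :^ 6) refl x y ⟩
      # (+ 6) * (x ^ 4 * y ^ 2) + # (+ 243) * y ^ 6 ∎
      where
      φ-#*^ : ∀ n k → φ (# n * y ^ k) ≈ # n * z ^ k
      φ-#*^ n k = trans (φ-#* n _) (*-congˡ (φ-^ y k))

    -- Division by x = π − 3z is done by κ = π² + 3πz + 9z², since x κ = φ σ.
    U-quotient : ∀ {w Z} → x * Z ≈ φ w → x ^ 4 * U Z ≈ w * (# (+ 9) * y ^ 3)
    U-quotient {w} {Z} xZ = begin
      x ^ 4 * U Z                ≈⟨ *-congʳ σy ⟨
      σ * y * U Z                ≈⟨ solve 3 (λ s y u → s :* y :* u := y :* (s :* u)) refl σ y (U Z) ⟩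
      y * (σ * U Z)              ≈⟨ *-congˡ (U-φ* σ Z) ⟨
      y * U (φ σ * Z)            ≈⟨ *-congˡ (U-cong (begin
        φ σ * Z     ≈⟨ *-congʳ xκ ⟨
        x * κ * Z   ≈⟨ solve 3 (λ x k z → x :* k :* z := x :* z :* k) refl x κ Z ⟩
        x * Z * κ   ≈⟨ *-congʳ xZ ⟩
        φ w * κ     ∎)) ⟩
      y * U (φ w * κ)            ≈⟨ *-congˡ (U-φ* w κ) ⟩
      y * (w * U κ)              ≈⟨ *-congˡ (*-congˡ Uκ) ⟩
      y * (w * (# (+ 9) * y ^ 2)) ≈⟨ solve 2 (λ y w → y :* (w :* (con (+ 9) :* y :^ 2)) := w :* (con (+ 9) :* y :^ 3)) refl y w ⟩
      w * (# (+ 9) * y ^ 3)      ∎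

    -- Dividing twice by x costs κ² over φ (σ ^ 2); the factor x⁸ = (σy)² clears σ².
    U-quotient² : ∀ {w Z} → x ^ 2 * Z ≈ φ w →
      x ^ 8 * U Z ≈ w * (# (+ 6) * (x ^ 4 * y ^ 2) + # (+ 243) * y ^ 6)
    U-quotient² {w} {Z} x²Z = begin
      x ^ 8 * U Z                     ≈⟨ solve 2 (λ x u → x :^ 8 :* u := (x :^ 4) :^ 2 :* u) refl x (U Z) ⟩
      (x ^ 4) ^ 2 * U Z               ≈⟨ *-congʳ (^-congˡ 2 σy) ⟨
      (σ * y) ^ 2 * U Z               ≈⟨ solve 3 (λ s y u → (s :* y) :^ 2 :* u := s :^ 2 :* u :* y :^ 2) refl σ y (U Z) ⟩
      σ ^ 2 * U Z * y ^ 2             ≈⟨ *-congʳ (U-φ* (σ ^ 2) Z) ⟨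
      U (φ (σ ^ 2) * Z) * y ^ 2       ≈⟨ *-congʳ (U-cong (begin
        φ (σ ^ 2) * Z     ≈⟨ *-congʳ (φ-^ σ 2) ⟩
        φ σ ^ 2 * Z       ≈⟨ *-congʳ (^-congˡ 2 xκ) ⟨
        (x * κ) ^ 2 * Z   ≈⟨ solve 3 (λ x k z → (x :* k) :^ 2 :* z := x :^ 2 :* z :* k :^ 2) refl x κ Z ⟩
        x ^ 2 * Z * κ ^ 2 ≈⟨ *-congʳ x²Z ⟩
        φ w * κ ^ 2       ∎)) ⟩
      U (φ w * κ ^ 2) * y ^ 2         ≈⟨ *-congʳ (U-φ* w (κ ^ 2)) ⟩
      w * U (κ ^ 2) * y ^ 2           ≈⟨ *-assoc _ _ _ ⟩
      w * (U (κ ^ 2) * y ^ 2)         ≈⟨ *-congˡ Uκ² ⟩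
      w * (# (+ 6) * (x ^ 4 * y ^ 2) + # (+ 243) * y ^ 6) ∎

    -- The series U(x^k) and their recurrences for k = 1, ..., 8

    u : ℕ → Carrier
    u k = U (x ^ k)

    -- `initial` asks that u k - C₁ y^k be divisible by D₁ inside the ring, so that a later
    -- coefficient of G that vanishes mod m kills the whole term.
    record Recurrence (k : ℕ) (h r C₁ D₁ : ℤ) : Set (c ⊔ ℓ) where
      field
        G       : Carrier
        initial : u k ≈ # C₁ * y ^ k + # D₁ * G
        step    : U (U (u k)) ≈ # h * u k + # r * y ^ k

    u₁ : u 1 ≈ # (ℤ.- + 3) * y
    u₁ = trans (U-x^ 1) (prove (ρ ∷ y ∷ []) (coord₀ 1) (con (ℤ.- + 3) :* y′) refl)

    u₂ : u 2 ≈ # (+ 9) * y ^ 2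
    u₂ = trans (U-x^ 2) (prove (ρ ∷ y ∷ []) (coord₀ 2) (con (+ 9) :* y′ :^ 2) refl)

    u₃ : u 3 ≈ σ
    u₃ = trans (U-x^ 3) (prove (ρ ∷ y ∷ []) (coord₀ 3) (ρ′ :+ con (ℤ.- + 27) :* y′ :^ 3) refl)

    u₄ : u 4 ≈ # (ℤ.- + 243) * y ^ 4 + # (ℤ.- + 12) * x ^ 4
    u₄ = begin
      u 4 ≈⟨ U-x^ 4 ⟩
      ⟪ coord₀ 4 ⟫ ≈⟨ prove (ρ ∷ y ∷ []) (coord₀ 4) (con (ℤ.- + 12) :* (ρ′ :* y′) :+ con (+ 81) :* y′ :^ 4) refl ⟩
      # (ℤ.- + 12) * (ρ * y) + # (+ 81) * y ^ 4 ≈⟨ +-congʳ (*-congˡ ρy) ⟩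
      # (ℤ.- + 12) * (x ^ 4 + # (+ 27) * y ^ 4) + # (+ 81) * y ^ 4
        ≈⟨ solve 2 (λ x y → con (ℤ.- + 12) :* (x :^ 4 :+ con (+ 27) :* y :^ 4) :+ con (+ 81) :* y :^ 4
             := con (ℤ.- + 243) :* y :^ 4 :+ con (ℤ.- + 12) :* x :^ 4) refl x y ⟩
      # (ℤ.- + 243) * y ^ 4 + # (ℤ.- + 12) * x ^ 4 ∎

    u₅ : u 5 ≈ # (+ 2187) * y ^ 5 + # (+ 90) * (x ^ 4 * y)
    u₅ = begin
      u 5 ≈⟨ U-x^ 5 ⟩
      ⟪ coord₀ 5 ⟫ ≈⟨ prove (ρ ∷ y ∷ []) (coord₀ 5) (con (+ 90) :* (ρ′ :* y′) :* y′ :+ con (ℤ.- + 243) :* y′ :^ 5) refl ⟩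
      # (+ 90) * (ρ * y) * y + # (ℤ.- + 243) * y ^ 5 ≈⟨ +-congʳ (*-congʳ (*-congˡ ρy)) ⟩
      # (+ 90) * (x ^ 4 + # (+ 27) * y ^ 4) * y + # (ℤ.- + 243) * y ^ 5
        ≈⟨ solve 2 (λ x y → con (+ 90) :* (x :^ 4 :+ con (+ 27) :* y :^ 4) :* y :+ con (ℤ.- + 243) :* y :^ 5
             := con (+ 2187) :* y :^ 5 :+ con (+ 90) :* (x :^ 4 :* y)) refl x y ⟩
      # (+ 2187) * y ^ 5 + # (+ 90) * (x ^ 4 * y) ∎

    -- `ρy` eliminates ρ only together with a factor y. `coord₀ 6` contains ρ², so two such factors
    -- are supplied; in `coord₀ 7` the term ρ²y lacks just one.
    y²u₆ : y ^ 2 * u 6 ≈ # (ℤ.- + 13122) * y ^ 8 + # (ℤ.- + 486) * (y ^ 4 * x ^ 4) + # (+ 1) * x ^ 8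
    y²u₆ = begin
      y ^ 2 * u 6 ≈⟨ *-congˡ (U-x^ 6) ⟩
      y ^ 2 * ⟪ coord₀ 6 ⟫
        ≈⟨ prove (ρ ∷ y ∷ []) (y′ :^ 2 :* coord₀ 6)
             (con (+ 729) :* y′ :^ 8 :+ con (ℤ.- + 540) :* (ρ′ :* y′) :* y′ :^ 4 :+ (ρ′ :* y′) :^ 2) refl ⟩
      # (+ 729) * y ^ 8 + # (ℤ.- + 540) * (ρ * y) * y ^ 4 + (ρ * y) ^ 2
        ≈⟨ +-cong (+-congˡ (*-congʳ (*-congˡ ρy))) (^-congˡ 2 ρy) ⟩
      # (+ 729) * y ^ 8 + # (ℤ.- + 540) * (x ^ 4 + # (+ 27) * y ^ 4) * y ^ 4 + (x ^ 4 + # (+ 27) * y ^ 4) ^ 2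
        ≈⟨ solve 2 (λ x y → con (+ 729) :* y :^ 8 :+ con (ℤ.- + 540) :* (x :^ 4 :+ con (+ 27) :* y :^ 4) :* y :^ 4
                :+ (x :^ 4 :+ con (+ 27) :* y :^ 4) :^ 2
             := con (ℤ.- + 13122) :* y :^ 8 :+ con (ℤ.- + 486) :* (y :^ 4 :* x :^ 4) :+ con (+ 1) :* x :^ 8) refl x y ⟩
      # (ℤ.- + 13122) * y ^ 8 + # (ℤ.- + 486) * (y ^ 4 * x ^ 4) + # (+ 1) * x ^ 8 ∎

    yu₇ : y * u 7 ≈ # (+ 59049) * y ^ 8 + # (+ 1701) * (y ^ 4 * x ^ 4) + # (ℤ.- + 21) * x ^ 8
    yu₇ = begin
      y * u 7 ≈⟨ *-congˡ (U-x^ 7) ⟩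
      y * ⟪ coord₀ 7 ⟫
        ≈⟨ prove (ρ ∷ y ∷ []) (y′ :* coord₀ 7)
             (con (ℤ.- + 2187) :* y′ :^ 8 :+ con (+ 2835) :* (ρ′ :* y′) :* y′ :^ 4 :+ con (ℤ.- + 21) :* (ρ′ :* y′) :^ 2) refl ⟩
      # (ℤ.- + 2187) * y ^ 8 + # (+ 2835) * (ρ * y) * y ^ 4 + # (ℤ.- + 21) * (ρ * y) ^ 2
        ≈⟨ +-cong (+-congˡ (*-congʳ (*-congˡ ρy))) (*-congˡ (^-congˡ 2 ρy)) ⟩
      # (ℤ.- + 2187) * y ^ 8 + # (+ 2835) * (x ^ 4 + # (+ 27) * y ^ 4) * y ^ 4
        + # (ℤ.- + 21) * (x ^ 4 + # (+ 27) * y ^ 4) ^ 2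
        ≈⟨ solve 2 (λ x y → con (ℤ.- + 2187) :* y :^ 8 :+ con (+ 2835) :* (x :^ 4 :+ con (+ 27) :* y :^ 4) :* y :^ 4
                :+ con (ℤ.- + 21) :* (x :^ 4 :+ con (+ 27) :* y :^ 4) :^ 2
             := con (+ 59049) :* y :^ 8 :+ con (+ 1701) :* (y :^ 4 :* x :^ 4) :+ con (ℤ.- + 21) :* x :^ 8) refl x y ⟩
      # (+ 59049) * y ^ 8 + # (+ 1701) * (y ^ 4 * x ^ 4) + # (ℤ.- + 21) * x ^ 8 ∎

    u₈ : u 8 ≈ # (ℤ.- + 177147) * y ^ 8 + # (+ 252) * x ^ 8
    u₈ = begin
      u 8 ≈⟨ U-x^ 8 ⟩
      ⟪ coord₀ 8 ⟫
        ≈⟨ prove (ρ ∷ y ∷ []) (coord₀ 8)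
             (con (+ 6561) :* y′ :^ 8 :+ con (ℤ.- + 13608) :* (ρ′ :* y′) :* y′ :^ 4 :+ con (+ 252) :* (ρ′ :* y′) :^ 2) refl ⟩
      # (+ 6561) * y ^ 8 + # (ℤ.- + 13608) * (ρ * y) * y ^ 4 + # (+ 252) * (ρ * y) ^ 2
        ≈⟨ +-cong (+-congˡ (*-congʳ (*-congˡ ρy))) (*-congˡ (^-congˡ 2 ρy)) ⟩
      # (+ 6561) * y ^ 8 + # (ℤ.- + 13608) * (x ^ 4 + # (+ 27) * y ^ 4) * y ^ 4
        + # (+ 252) * (x ^ 4 + # (+ 27) * y ^ 4) ^ 2
        ≈⟨ solve 2 (λ x y → con (+ 6561) :* y :^ 8 :+ con (ℤ.- + 13608) :* (x :^ 4 :+ con (+ 27) :* y :^ 4) :* y :^ 4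
                :+ con (+ 252) :* (x :^ 4 :+ con (+ 27) :* y :^ 4) :^ 2
             := con (ℤ.- + 177147) :* y :^ 8 :+ con (+ 252) :* x :^ 8) refl x y ⟩
      # (ℤ.- + 177147) * y ^ 8 + # (+ 252) * x ^ 8 ∎

    -- For k = 1, 2 already U²(y^k) = U(x^k) = c y^k. The coefficient of G is 0, so any G serves.
    monomial : ∀ k c → u k ≈ # c * y ^ k → Recurrence k c (+ 0) c (+ 0)
    monomial k c uₖ = record
      { G = 1#
      ; initial = trans uₖ (solve 2 (λ a b → a := a :+ con (+ 0) :* b) refl (# c * y ^ k) 1#)
      ; step = begin
          U (U (u k))                    ≈⟨ U-cong (U-cong uₖ) ⟩
          U (U (# c * y ^ k))            ≈⟨ U-cong (trans (U-#* c _) (*-congˡ (U-y^ k))) ⟩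
          U (# c * x ^ k)                ≈⟨ U-#* c _ ⟩
          # c * u k                      ≈⟨ solve 2 (λ a b → a := a :+ con (+ 0) :* b) refl (# c * u k) (y ^ k) ⟩
          # c * u k + # (+ 0) * y ^ k    ∎ }

    -- For k = 4 and 8 the span of x^k and y^k is stable under U, and there U² = dU + c, hence U⁴ =
    -- (d² + 2c) U² - c². Applied to y^k, this is the source of h = d² + 2c and r = -c² in the two
    -- recurrences.
    UU-invariant : ∀ k c d → u k ≈ # c * y ^ k + # d * x ^ k →
      U (U (u k)) ≈ # c * (# c * y ^ k + # d * x ^ k)
                    + # d * (# c * x ^ k + # d * (# c * y ^ k + # d * x ^ k))
    UU-invariant k c d uₖ = begin
      U (U (u k))                              ≈⟨ U-cong Uu ⟩
      U (# c * x ^ k + # d * u k)              ≈⟨ U-lin c d (x ^ k) (u k) ⟩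
      # c * u k + # d * U (u k)                ≈⟨ +-cong (*-congˡ uₖ) (*-congˡ (trans Uu (+-congˡ (*-congˡ uₖ)))) ⟩
      _                                        ∎
      where
      Uu : U (u k) ≈ # c * x ^ k + # d * u k
      Uu = trans (U-cong uₖ) (trans (U-lin c d (y ^ k) (x ^ k)) (+-congʳ (*-congˡ (U-y^ k))))

    recurrence₁ : Recurrence 1 (ℤ.- + 3) (+ 0) (ℤ.- + 3) (+ 0)
    recurrence₁ = monomial 1 (ℤ.- + 3) (trans u₁ (*-congˡ (sym (*-identityʳ y))))

    recurrence₂ : Recurrence 2 (+ 9) (+ 0) (+ 9) (+ 0)
    recurrence₂ = monomial 2 (+ 9) u₂

    -- As u 3 = x⁴/y, its image under U is accessible through x U(u 3) = U(y u 3) = U(x⁴), at the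
    -- price of a division by x.
    recurrence₃ : Recurrence 3 (ℤ.- + 12) (ℤ.- + 2187) (+ 0) (+ 1)
    recurrence₃ = record
      { G = σ
      ; initial = trans u₃ (solve 2 (λ s y → s := con (+ 0) :* y :+ con (+ 1) :* s) refl σ (y ^ 3))
      ; step = begin
          U Z                                           ≈⟨ solve 2 (λ z u → z := con (ℤ.- + 12) :* u :+ (z :+ con (+ 12) :* u)) refl (U Z) (u 3) ⟩
          # (ℤ.- + 12) * u 3 + (U Z + # (+ 12) * u 3)   ≈⟨ +-congˡ (trans (U-+ _ _) (+-congˡ (U-#* _ _))) ⟨
          # (ℤ.- + 12) * u 3 + U Z′                     ≈⟨ +-congˡ (x^-cancelˡ 4 (trans (U-quotient xZ′)
            (solve 2 (λ x y → con (ℤ.- + 243) :* x :^ 4 :* (con (+ 9) :* y :^ 3)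
              := x :^ 4 :* (con (ℤ.- + 2187) :* y :^ 3)) refl x y))) ⟩
          # (ℤ.- + 12) * u 3 + # (ℤ.- + 2187) * y ^ 3   ∎ }
      where
      Z = U (u 3)
      -- By `u₄`, x Z = -12x⁴ - 243y⁴ (the constants are C 3 2 and D 3 1 2). Adding 12x³ to Z leaves
      -- only the term in y⁴ = φ (x⁴), to which `U-quotient` applies.
      Z′ = Z + # (+ 12) * x ^ 3
      xZ′ : x * Z′ ≈ φ (# (ℤ.- + 243) * x ^ 4)
      xZ′ = begin
        x * Z′                                  ≈⟨ solve 2 (λ x z → x :* (z :+ con (+ 12) :* x :^ 3) := x :* z :+ con (+ 12) :* x :^ 4) refl x Z ⟩
        x * Z + # (+ 12) * x ^ 4                ≈⟨ +-congʳ (U-φ* x (u 3)) ⟨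
        U (y * u 3) + # (+ 12) * x ^ 4          ≈⟨ +-congʳ (U-cong (trans (*-congˡ u₃) (trans (*-comm y σ) σy))) ⟩
        u 4 + # (+ 12) * x ^ 4                  ≈⟨ +-congʳ u₄ ⟩
        # (ℤ.- + 243) * y ^ 4 + # (ℤ.- + 12) * x ^ 4 + # (+ 12) * x ^ 4
          ≈⟨ solve 2 (λ x y → con (ℤ.- + 243) :* y :^ 4 :+ con (ℤ.- + 12) :* x :^ 4 :+ con (+ 12) :* x :^ 4
               := con (ℤ.- + 243) :* y :^ 4) refl x y ⟩
        # (ℤ.- + 243) * y ^ 4                   ≈⟨ trans (φ-#* _ _) (*-congˡ (φ-^ x 4)) ⟨
        φ (# (ℤ.- + 243) * x ^ 4)               ∎

    recurrence₄ : Recurrence 4 (ℤ.- + 342) (ℤ.- + 59049) (ℤ.- + 243) (ℤ.- + 12)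
    recurrence₄ = record
      { G = x ^ 4
      ; initial = u₄
      ; step = trans (UU-invariant 4 (ℤ.- + 243) (ℤ.- + 12) u₄) (trans
          (solve 2 (λ X Y → let u = con (ℤ.- + 243) :* Y :+ con (ℤ.- + 12) :* X in
             con (ℤ.- + 243) :* u :+ con (ℤ.- + 12) :* (con (ℤ.- + 243) :* X :+ con (ℤ.- + 12) :* u)
             := con (ℤ.- + 342) :* u :+ con (ℤ.- + 59049) :* Y) refl (x ^ 4) (y ^ 4))
          (+-congʳ (*-congˡ (sym u₄)))) }

    -- U maps the span of y⁵ and x⁴y into that of x⁵ and xy⁴, and the latter back into the former,
    -- so polynomials in x and y suffice.
    recurrence₅ : Recurrence 5 (+ 1836) (ℤ.- + 1594323) (+ 2187) (+ 90)
    recurrence₅ = record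
      { G = x ^ 4 * y
      ; initial = u₅
      ; step = begin
          U (U (u 5))                                                       ≈⟨ U-cong Uu₅ ⟩
          U (# (+ 1107) * x ^ 5 + # (ℤ.- + 21870) * (y ^ 4 * x ^ 1))        ≈⟨ U-lin _ _ _ _ ⟩
          # (+ 1107) * u 5 + # (ℤ.- + 21870) * U (y ^ 4 * x ^ 1)            ≈⟨ +-congˡ (*-congˡ (trans (U-y^* 4 _) (*-congˡ u₁))) ⟩
          # (+ 1107) * u 5 + # (ℤ.- + 21870) * (x ^ 4 * (# (ℤ.- + 3) * y))  ≈⟨ +-congʳ (*-congˡ u₅) ⟩
          # (+ 1107) * (# (+ 2187) * y ^ 5 + # (+ 90) * (x ^ 4 * y)) + # (ℤ.- + 21870) * (x ^ 4 * (# (ℤ.- + 3) * y))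
            -- Since 3 · 21870 = 729 · 90, the last term is 729 (u 5 - 2187 y⁵). Thus h = 1107 + 729
            -- and r = -729 · 2187.
            ≈⟨ solve 2 (λ x y → let u = con (+ 2187) :* y :^ 5 :+ con (+ 90) :* (x :^ 4 :* y) in
                 con (+ 1107) :* u :+ con (ℤ.- + 21870) :* (x :^ 4 :* (con (ℤ.- + 3) :* y))
                 := con (+ 1836) :* u :+ con (ℤ.- + 1594323) :* y :^ 5) refl x y ⟩
          # (+ 1836) * (# (+ 2187) * y ^ 5 + # (+ 90) * (x ^ 4 * y)) + # (ℤ.- + 1594323) * y ^ 5
            ≈⟨ +-congʳ (*-congˡ u₅) ⟨
          # (+ 1836) * u 5 + # (ℤ.- + 1594323) * y ^ 5                      ∎ }
      where
      Uu₅ : U (u 5) ≈ # (+ 1107) * x ^ 5 + # (ℤ.- + 21870) * (y ^ 4 * x ^ 1)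
      Uu₅ = begin
        U (u 5)                                                     ≈⟨ U-cong (trans u₅ (+-congˡ (*-congˡ (*-comm _ _)))) ⟩
        U (# (+ 2187) * y ^ 5 + # (+ 90) * (y * x ^ 4))             ≈⟨ U-lin _ _ _ _ ⟩
        # (+ 2187) * U (y ^ 5) + # (+ 90) * U (y * x ^ 4)           ≈⟨ +-cong (*-congˡ (U-y^ 5)) (*-congˡ (trans (U-φ* x _) (*-congˡ u₄))) ⟩
        # (+ 2187) * x ^ 5 + # (+ 90) * (x * (# (ℤ.- + 243) * y ^ 4 + # (ℤ.- + 12) * x ^ 4))
          ≈⟨ solve 2 (λ x y → con (+ 2187) :* x :^ 5 :+ con (+ 90) :* (x :* (con (ℤ.- + 243) :* y :^ 4 :+ con (ℤ.- + 12) :* x :^ 4))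
               := con (+ 1107) :* x :^ 5 :+ con (ℤ.- + 21870) :* (y :^ 4 :* x :^ 1)) refl x y ⟩
        # (+ 1107) * x ^ 5 + # (ℤ.- + 21870) * (y ^ 4 * x ^ 1)      ∎

    -- Serves k = 6 and k = 7 alike: y² u 6 and y u 7 are both quadratic forms in x⁴ and y⁴.
    U-octic : ∀ l m n → U (# l * y ^ 8 + # m * (y ^ 4 * x ^ 4) + # n * x ^ 8) ≈
      # l * x ^ 8 + # m * (x ^ 4 * (# (ℤ.- + 243) * y ^ 4 + # (ℤ.- + 12) * x ^ 4))
        + # n * (# (ℤ.- + 177147) * y ^ 8 + # (+ 252) * x ^ 8)
    U-octic l m n = trans (U-lin₃ l m n _ _ _)
      (+-cong (+-cong (*-congˡ (U-y^ 8)) (*-congˡ (trans (U-y^* 4 _) (*-congˡ u₄)))) (*-congˡ u₈))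

    recurrence₆ : Recurrence 6 (ℤ.- + 7038) (ℤ.- + 43046721) (ℤ.- + 13122) (+ 1)
    recurrence₆ = record
      -- This is u 6 + 13122 y⁶ in terms of ρ and y, or σ² - 486σy³: the coefficient D 6 1 1 = -486
      -- is absorbed into G.
      { G = ρ ^ 2 + # (ℤ.- + 540) * (ρ * y ^ 3) + # (+ 13851) * y ^ 6
      ; initial = trans (U-x^ 6) (prove (ρ ∷ y ∷ []) (coord₀ 6)
          (con (ℤ.- + 13122) :* y′ :^ 6 :+ con (+ 1) :* (ρ′ :^ 2 :+ con (ℤ.- + 540) :* (ρ′ :* y′ :^ 3) :+ con (+ 13851) :* y′ :^ 6)) refl)
      ; step = y-cancelˡ (y-cancelˡ (begin
          y * (y * U Z)
            ≈⟨ solve 5 (λ x y z u v → y :* (y :* z) :=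
                 con (ℤ.- + 7038) :* (y :^ 2 :* u) :+ con (+ 118098) :* (x :^ 4 :* v :* y :^ 2)
                 :+ (z :+ con (+ 7038) :* u :+ con (ℤ.- + 118098) :* (x :^ 4 :* v)) :* y :^ 2) refl x y (U Z) (u 6) (u 2) ⟩
          # (ℤ.- + 7038) * (y ^ 2 * u 6) + # (+ 118098) * (x ^ 4 * u 2 * y ^ 2)
            + (U Z + # (+ 7038) * u 6 + # (ℤ.- + 118098) * (x ^ 4 * u 2)) * y ^ 2
            ≈⟨ +-cong (+-cong (*-congˡ y²u₆) (*-congˡ (*-congʳ (*-congˡ u₂)))) (*-congʳ (trans (sym UZ′) UZ′≈)) ⟩
          # (ℤ.- + 7038) * (# (ℤ.- + 13122) * y ^ 8 + # (ℤ.- + 486) * (y ^ 4 * x ^ 4) + # (+ 1) * x ^ 8)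
            + # (+ 118098) * (x ^ 4 * (# (+ 9) * y ^ 2) * y ^ 2)
            + # (ℤ.- + 177147) * (# (+ 6) * (x ^ 4 * y ^ 2) + # (+ 243) * y ^ 6) * y ^ 2
            -- The terms in x⁴y⁴ outside v cancel because 118098 · 9 = 177147 · 6, and r = -177147 ·
            -- 243 remains.
            ≈⟨ solve 2 (λ x y → let v = con (ℤ.- + 13122) :* y :^ 8 :+ con (ℤ.- + 486) :* (y :^ 4 :* x :^ 4) :+ con (+ 1) :* x :^ 8 in
                 con (ℤ.- + 7038) :* v :+ con (+ 118098) :* (x :^ 4 :* (con (+ 9) :* y :^ 2) :* y :^ 2)
                 :+ con (ℤ.- + 177147) :* (con (+ 6) :* (x :^ 4 :* y :^ 2) :+ con (+ 243) :* y :^ 6) :* y :^ 2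
                 := con (ℤ.- + 7038) :* v :+ con (ℤ.- + 43046721) :* y :^ 8) refl x y ⟩
          # (ℤ.- + 7038) * (# (ℤ.- + 13122) * y ^ 8 + # (ℤ.- + 486) * (y ^ 4 * x ^ 4) + # (+ 1) * x ^ 8)
            + # (ℤ.- + 43046721) * y ^ 8
            ≈⟨ +-congʳ (*-congˡ y²u₆) ⟨
          # (ℤ.- + 7038) * (y ^ 2 * u 6) + # (ℤ.- + 43046721) * y ^ 8
            ≈⟨ solve 2 (λ y u → con (ℤ.- + 7038) :* (y :^ 2 :* u) :+ con (ℤ.- + 43046721) :* y :^ 8
                 := y :* (y :* (con (ℤ.- + 7038) :* u :+ con (ℤ.- + 43046721) :* y :^ 6))) refl y (u 6) ⟩
          y * (y * (# (ℤ.- + 7038) * u 6 + # (ℤ.- + 43046721) * y ^ 6)) ∎)) }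
      where
      Z = U (u 6)
      -- In x² Z the coefficients of x⁸, x⁴y⁴ and y⁸ are -7038, 118098 and -177147, that is C 6 2, D
      -- 6 1 2 and D 6 2 2. The correction removes all but y⁸ = φ (x⁸). For k = 7 the same is done
      -- with x Z.
      Z′ = Z + # (+ 7038) * x ^ 6 + # (ℤ.- + 118098) * (y ^ 4 * x ^ 2)
      UZ′ : U Z′ ≈ U Z + # (+ 7038) * u 6 + # (ℤ.- + 118098) * (x ^ 4 * u 2)
      UZ′ = trans (U-+ _ _) (+-cong (trans (U-+ _ _) (+-congˡ (U-#* _ _)))
        (trans (U-#* _ _) (*-congˡ (U-y^* 4 _))))
      x²Z′ : x ^ 2 * Z′ ≈ φ (# (ℤ.- + 177147) * x ^ 8)
      x²Z′ = begin
        x ^ 2 * Z′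
          ≈⟨ solve 3 (λ x y z → x :^ 2 :* (z :+ con (+ 7038) :* x :^ 6 :+ con (ℤ.- + 118098) :* (y :^ 4 :* x :^ 2))
               := x :^ 2 :* z :+ con (+ 7038) :* x :^ 8 :+ con (ℤ.- + 118098) :* (y :^ 4 :* x :^ 4)) refl x y Z ⟩
        x ^ 2 * Z + # (+ 7038) * x ^ 8 + # (ℤ.- + 118098) * (y ^ 4 * x ^ 4)
          ≈⟨ +-congʳ (+-congʳ (trans (sym (U-y^* 2 (u 6))) (trans (U-cong y²u₆) (U-octic _ _ _)))) ⟩
        # (ℤ.- + 13122) * x ^ 8 + # (ℤ.- + 486) * (x ^ 4 * (# (ℤ.- + 243) * y ^ 4 + # (ℤ.- + 12) * x ^ 4))
          + # (+ 1) * (# (ℤ.- + 177147) * y ^ 8 + # (+ 252) * x ^ 8)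
          + # (+ 7038) * x ^ 8 + # (ℤ.- + 118098) * (y ^ 4 * x ^ 4)
          ≈⟨ solve 2 (λ x y → con (ℤ.- + 13122) :* x :^ 8
               :+ con (ℤ.- + 486) :* (x :^ 4 :* (con (ℤ.- + 243) :* y :^ 4 :+ con (ℤ.- + 12) :* x :^ 4))
               :+ con (+ 1) :* (con (ℤ.- + 177147) :* y :^ 8 :+ con (+ 252) :* x :^ 8)
               :+ con (+ 7038) :* x :^ 8 :+ con (ℤ.- + 118098) :* (y :^ 4 :* x :^ 4)
               := con (ℤ.- + 177147) :* y :^ 8) refl x y ⟩
        # (ℤ.- + 177147) * y ^ 8           ≈⟨ trans (φ-#* _ _) (*-congˡ (φ-^ x 8)) ⟨
        φ (# (ℤ.- + 177147) * x ^ 8)       ∎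
      UZ′≈ : U Z′ ≈ # (ℤ.- + 177147) * (# (+ 6) * (x ^ 4 * y ^ 2) + # (+ 243) * y ^ 6)
      UZ′≈ = x^-cancelˡ 8 (trans (U-quotient² x²Z′)
        (solve 2 (λ X w → con (ℤ.- + 177147) :* X :* w := X :* (con (ℤ.- + 177147) :* w)) refl (x ^ 8) _))

    recurrence₇ : Recurrence 7 (+ 53028) (ℤ.- + 1162261467) (+ 59049) (ℤ.- + 21)
    recurrence₇ = record
      -- This is σ²y - 81σy⁴. The factor -21 comes out because D 7 1 1 = 1701 = 81 · 21.
      { G = ρ ^ 2 * y + # (ℤ.- + 135) * (ρ * y ^ 4) + # (+ 2916) * y ^ 7
      ; initial = trans (U-x^ 7) (prove (ρ ∷ y ∷ []) (coord₀ 7)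
          (con (+ 59049) :* y′ :^ 7 :+ con (ℤ.- + 21) :* (ρ′ :^ 2 :* y′ :+ con (ℤ.- + 135) :* (ρ′ :* y′ :^ 4) :+ con (+ 2916) :* y′ :^ 7)) refl)
      ; step = y-cancelˡ (begin
          y * U Z
            ≈⟨ solve 5 (λ x y z u v → y :* z :=
                 con (+ 33345) :* (y :* u) :+ con (ℤ.- + 413343) :* (x :^ 4 :* (v :* y))
                 :+ (z :+ con (ℤ.- + 33345) :* u :+ con (+ 413343) :* (x :^ 4 :* v)) :* y) refl x y (U Z) (u 7) (u 3) ⟩
          # (+ 33345) * (y * u 7) + # (ℤ.- + 413343) * (x ^ 4 * (u 3 * y))
            + (U Z + # (ℤ.- + 33345) * u 7 + # (+ 413343) * (x ^ 4 * u 3)) * y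
            ≈⟨ +-cong (+-cong (*-congˡ yu₇) (*-congˡ (*-congˡ (trans (*-congʳ u₃) σy)))) (*-congʳ (trans (sym UZ′) UZ′≈)) ⟩
          # (+ 33345) * (# (+ 59049) * y ^ 8 + # (+ 1701) * (y ^ 4 * x ^ 4) + # (ℤ.- + 21) * x ^ 8)
            + # (ℤ.- + 413343) * (x ^ 4 * x ^ 4) + # (+ 33480783) * (x ^ 4 * y ^ 3) * y
            -- As 413343 = 19683 · 21 and 33480783 = 19683 · 1701, the two terms after 33345 v are
            -- 19683 (v - 59049 y⁸). Thus h = 33345 + 19683 and r = -19683 · 59049.
            ≈⟨ solve 2 (λ x y → let v = con (+ 59049) :* y :^ 8 :+ con (+ 1701) :* (y :^ 4 :* x :^ 4) :+ con (ℤ.- + 21) :* x :^ 8 in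
                 con (+ 33345) :* v :+ con (ℤ.- + 413343) :* (x :^ 4 :* x :^ 4) :+ con (+ 33480783) :* (x :^ 4 :* y :^ 3) :* y
                 := con (+ 53028) :* v :+ con (ℤ.- + 1162261467) :* y :^ 8) refl x y ⟩
          # (+ 53028) * (# (+ 59049) * y ^ 8 + # (+ 1701) * (y ^ 4 * x ^ 4) + # (ℤ.- + 21) * x ^ 8)
            + # (ℤ.- + 1162261467) * y ^ 8
            ≈⟨ +-congʳ (*-congˡ yu₇) ⟨
          # (+ 53028) * (y * u 7) + # (ℤ.- + 1162261467) * y ^ 8
            ≈⟨ solve 2 (λ y u → con (+ 53028) :* (y :* u) :+ con (ℤ.- + 1162261467) :* y :^ 8
                 := y :* (con (+ 53028) :* u :+ con (ℤ.- + 1162261467) :* y :^ 7)) refl y (u 7) ⟩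
          y * (# (+ 53028) * u 7 + # (ℤ.- + 1162261467) * y ^ 7) ∎) }
      where
      Z = U (u 7)
      Z′ = Z + # (ℤ.- + 33345) * x ^ 7 + # (+ 413343) * (y ^ 4 * x ^ 3)
      UZ′ : U Z′ ≈ U Z + # (ℤ.- + 33345) * u 7 + # (+ 413343) * (x ^ 4 * u 3)
      UZ′ = trans (U-+ _ _) (+-cong (trans (U-+ _ _) (+-congˡ (U-#* _ _)))
        (trans (U-#* _ _) (*-congˡ (U-y^* 4 _))))
      xZ′ : x * Z′ ≈ φ (# (+ 3720087) * x ^ 8)
      xZ′ = begin
        x * Z′
          ≈⟨ solve 3 (λ x y z → x :* (z :+ con (ℤ.- + 33345) :* x :^ 7 :+ con (+ 413343) :* (y :^ 4 :* x :^ 3))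
               := x :* z :+ con (ℤ.- + 33345) :* x :^ 8 :+ con (+ 413343) :* (y :^ 4 :* x :^ 4)) refl x y Z ⟩
        x * Z + # (ℤ.- + 33345) * x ^ 8 + # (+ 413343) * (y ^ 4 * x ^ 4)
          ≈⟨ +-congʳ (+-congʳ (trans (sym (U-φ* x (u 7))) (trans (U-cong yu₇) (U-octic _ _ _)))) ⟩
        # (+ 59049) * x ^ 8 + # (+ 1701) * (x ^ 4 * (# (ℤ.- + 243) * y ^ 4 + # (ℤ.- + 12) * x ^ 4))
          + # (ℤ.- + 21) * (# (ℤ.- + 177147) * y ^ 8 + # (+ 252) * x ^ 8)
          + # (ℤ.- + 33345) * x ^ 8 + # (+ 413343) * (y ^ 4 * x ^ 4)
          ≈⟨ solve 2 (λ x y → con (+ 59049) :* x :^ 8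
               :+ con (+ 1701) :* (x :^ 4 :* (con (ℤ.- + 243) :* y :^ 4 :+ con (ℤ.- + 12) :* x :^ 4))
               :+ con (ℤ.- + 21) :* (con (ℤ.- + 177147) :* y :^ 8 :+ con (+ 252) :* x :^ 8)
               :+ con (ℤ.- + 33345) :* x :^ 8 :+ con (+ 413343) :* (y :^ 4 :* x :^ 4)
               := con (+ 3720087) :* y :^ 8) refl x y ⟩
        # (+ 3720087) * y ^ 8           ≈⟨ trans (φ-#* _ _) (*-congˡ (φ-^ x 8)) ⟨
        φ (# (+ 3720087) * x ^ 8)       ∎
      UZ′≈ : U Z′ ≈ # (+ 33480783) * (x ^ 4 * y ^ 3)
      UZ′≈ = x^-cancelˡ 4 (trans (U-quotient xZ′)
        (solve 2 (λ x y → con (+ 3720087) :* x :^ 8 :* (con (+ 9) :* y :^ 3)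
          := x :^ 4 :* (con (+ 33480783) :* (x :^ 4 :* y :^ 3))) refl x y))

    recurrence₈ : Recurrence 8 (ℤ.- + 290790) (ℤ.- + 31381059609) (ℤ.- + 177147) (+ 252)
    recurrence₈ = record
      { G = x ^ 8
      ; initial = u₈
      ; step = trans (UU-invariant 8 (ℤ.- + 177147) (+ 252) u₈) (trans
          (solve 2 (λ X Y → let u = con (ℤ.- + 177147) :* Y :+ con (+ 252) :* X in
             con (ℤ.- + 177147) :* u :+ con (+ 252) :* (con (ℤ.- + 177147) :* X :+ con (+ 252) :* u)
             := con (ℤ.- + 290790) :* u :+ con (ℤ.- + 31381059609) :* Y) refl (x ^ 8) (y ^ 8))
          (+-congʳ (*-congˡ (sym u₈)))) }

    #-lin : ∀ h c r d → # (h ℤ.* c ℤ.+ r ℤ.* d) ≈ # h * # c + # r * # d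
    #-lin h c r d = trans (+-homo _ _) (+-cong (*-homo h c) (*-homo r d))

    -- Odd iterates of U

    UU : Carrier → Carrier
    UU a = U (U a)

    UU-lin : ∀ m n a b → UU (# m * a + # n * b) ≈ # m * UU a + # n * UU b
    UU-lin m n a b = trans (U-cong (U-lin m n a b)) (U-lin m n _ _)

    -- The powers U^(2β+1) applied to x^k: the recurrences for C and D relate values two apart.
    iterates : ℕ → ℕ → Carrier
    iterates k zero    = u k
    iterates k (suc β) = UU (iterates k β)

    -- Here c β and d β stand for C and D at 2β+1. The 1 and 0 in `c₁` and `d₁` act as values at -1:
    -- since U²(y^k) = u k, the iterate before u k is y^k = 1 · y^k + 0 · G.
    module _ {k h r} {c d : ℕ → ℤ} (rec : Recurrence k h r (c 0) (d 0))
      (c₁ : c 1 ≡ h ℤ.* c 0 ℤ.+ r ℤ.* + 1) (c-rec : ∀ β → c (2 ℕ.+ β) ≡ h ℤ.* c (1 ℕ.+ β) ℤ.+ r ℤ.* c β)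
      (d₁ : d 1 ≡ h ℤ.* d 0 ℤ.+ r ℤ.* + 0) (d-rec : ∀ β → d (2 ℕ.+ β) ≡ h ℤ.* d (1 ℕ.+ β) ℤ.+ r ℤ.* d β) where

      open Recurrence rec

      iterates-rec : ∀ β → iterates k (2 ℕ.+ β) ≈ # h * iterates k (1 ℕ.+ β) + # r * iterates k β
      iterates-rec zero    = trans (U-cong (U-cong step)) (trans (UU-lin h r _ _) (+-congˡ (*-congˡ (U-cong (U-y^ k)))))
      iterates-rec (suc β) = trans (U-cong (U-cong (iterates-rec β))) (UU-lin h r _ _)

      iterates≈ : ∀ β → iterates k β ≈ # (c β) * y ^ k + # (d β) * G
      iterates≈ zero          = initial
      iterates≈ (suc zero)    = begin
        UU (u k)                                                ≈⟨ step ⟩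
        # h * u k + # r * y ^ k                                 ≈⟨ +-congʳ (*-congˡ initial) ⟩
        # h * (# (c 0) * y ^ k + # (d 0) * G) + # r * y ^ k
          ≈⟨ solve 6 (λ h r c d y g → h :* (c :* y :+ d :* g) :+ r :* y
               := (h :* c :+ r :* con (+ 1)) :* y :+ (h :* d :+ r :* con (+ 0)) :* g) refl (# h) (# r) (# (c 0)) (# (d 0)) (y ^ k) G ⟩
        (# h * # (c 0) + # r * # (+ 1)) * y ^ k + (# h * # (d 0) + # r * # (+ 0)) * G
          ≈⟨ +-cong (*-congʳ (trans (reflexive (≡.cong # c₁)) (#-lin h (c 0) r (+ 1))))
               (*-congʳ (trans (reflexive (≡.cong # d₁)) (#-lin h (d 0) r (+ 0)))) ⟨
        # (c 1) * y ^ k + # (d 1) * G ∎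
      iterates≈ (suc (suc β)) = begin
        iterates k (2 ℕ.+ β)                                    ≈⟨ iterates-rec β ⟩
        # h * iterates k (1 ℕ.+ β) + # r * iterates k β         ≈⟨ +-cong (*-congˡ (iterates≈ (suc β))) (*-congˡ (iterates≈ β)) ⟩
        # h * (# (c (1 ℕ.+ β)) * y ^ k + # (d (1 ℕ.+ β)) * G) + # r * (# (c β) * y ^ k + # (d β) * G)
          ≈⟨ solve 8 (λ h r c d c′ d′ y g → h :* (c′ :* y :+ d′ :* g) :+ r :* (c :* y :+ d :* g)
               := (h :* c′ :+ r :* c) :* y :+ (h :* d′ :+ r :* d) :* g) refl
               (# h) (# r) (# (c β)) (# (d β)) (# (c (1 ℕ.+ β))) (# (d (1 ℕ.+ β))) (y ^ k) G ⟩
        (# h * # (c (1 ℕ.+ β)) + # r * # (c β)) * y ^ k + (# h * # (d (1 ℕ.+ β)) + # r * # (d β)) * G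
          ≈⟨ +-cong (*-congʳ (trans (reflexive (≡.cong # (c-rec β))) (#-lin h _ r _)))
               (*-congʳ (trans (reflexive (≡.cong # (d-rec β))) (#-lin h _ r _))) ⟨
        # (c (2 ℕ.+ β)) * y ^ k + # (d (2 ℕ.+ β)) * G ∎

-- Jacobi's identity

module Jacobi {c ℓ} (R : CommutativeRing c ℓ)
  (ι : ℤ.+-*-rawRing -Raw-AlmostCommutative⟶ fromCommutativeRing R) (q : CommutativeRing.Carrier R) where

  open CommutativeRing R hiding (zero)
  open ℤ-Solver R ι
  open _-Raw-AlmostCommutative⟶_ ι using (1-homo; 0-homo; +-homo; *-homo; -‿homo)
  open SetoidReasoning setoid

  1-q^ : ℕ → Carrier
  1-q^ i = 1# - q ^ i

  poch : ℕ → Carrier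
  poch zero    = 1#
  poch (suc n) = poch n * 1-q^ (suc n)

  ε : ℕ → ℤ
  ε zero    = 1ℤ
  ε (suc i) = ℤ.- ε i

  #suc : ∀ i → # (+ suc i) ≈ # (+ 1) + # (+ i)
  #suc i = +-homo (+ 1) (+ i)

  q^△ : ℕ → Carrier
  q^△ zero    = 1#
  q^△ (suc i) = q^△ i * q ^ suc i

  θ : ℕ → Carrier
  θ i = # (ε i) * (# (+ 2) * # (+ i) + # (+ 1)) * q^△ i

  -- The Gaussian binomial coefficient [2n+1 choose n-j].  The recursion
  -- combines two q-Pascal steps; for j = 0 it uses the symmetry
  -- [2n+1 choose n+1] = [2n+1 choose n].
  gauss : ℕ → ℕ → Carrier
  gauss zero    zero    = 1#
  gauss zero    (suc j) = 0#
  gauss (suc n) zero    = q ^ suc n * gauss n 0 + (# (+ 1) + q ^ suc n * q ^ suc n) * gauss n 0 + q ^ suc n * q ^ 1 * gauss n 1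
  gauss (suc n) (suc j) = q ^ (n ∸ j) * gauss n j + (# (+ 1) + q ^ suc n * q ^ suc n) * gauss n (suc j)
                       + q ^ suc n * q ^ suc (suc j) * gauss n (suc (suc j))

  gauss-zero : ∀ {n j} → n < j → gauss n j ≈ 0#
  gauss-zero {zero}  {suc j} _ = refl
  gauss-zero {suc n} {suc j} (s≤s n<j) = begin
    q ^ (n ∸ j) * gauss n j + (# (+ 1) + q ^ suc n * q ^ suc n) * gauss n (suc j) + q ^ suc n * q ^ suc (suc j) * gauss n (suc (suc j))
      ≈⟨ +-cong (+-cong (*-congˡ (gauss-zero n<j)) (*-congˡ (gauss-zero (ℕₚ.m<n⇒m<1+n n<j))))
           (*-congˡ (gauss-zero (ℕₚ.m<n⇒m<1+n (ℕₚ.m<n⇒m<1+n n<j)))) ⟩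
    q ^ (n ∸ j) * 0# + (# (+ 1) + q ^ suc n * q ^ suc n) * 0# + q ^ suc n * q ^ suc (suc j) * 0#
      ≈⟨ +-cong (+-cong (zeroʳ _) (zeroʳ _)) (zeroʳ _) ⟩
    0# + 0# + 0# ≈⟨ trans (+-identityʳ _) (+-identityʳ _) ⟩
    0# ∎

  ^-+ : ∀ m n → q ^ (m ℕ.+ n) ≈ q ^ m * q ^ n
  ^-+ m n = ^-homo-* q m n

  -- The factor q^(j+1) merges with q^(n ∸ j) into q^(n+1), which removes the subtraction. For j >
  -- n, where it truncates, the term vanishes on both sides with `gauss n j`.
  gauss-suc : ∀ n j → q ^ suc j * gauss (suc n) (suc j) ≈ q ^ suc n * gauss n j
    + q ^ suc j * (# (+ 1) + q ^ suc n * q ^ suc n) * gauss n (suc j)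
    + q ^ suc j * (q ^ suc n * q ^ suc (suc j)) * gauss n (suc (suc j))
  gauss-suc n j = begin
    q ^ suc j * (q ^ (n ∸ j) * gauss n j + B * gauss n (suc j) + D * gauss n (suc (suc j)))
      ≈⟨ solve 7 (λ A B D Q x y z → Q :* (A :* x :+ B :* y :+ D :* z) := Q :* A :* x :+ Q :* B :* y :+ Q :* D :* z)
           refl (q ^ (n ∸ j)) B D (q ^ suc j) (gauss n j) (gauss n (suc j)) (gauss n (suc (suc j))) ⟩
    q ^ suc j * q ^ (n ∸ j) * gauss n j + q ^ suc j * B * gauss n (suc j) + q ^ suc j * D * gauss n (suc (suc j))
      ≈⟨ +-congʳ (+-congʳ lemma) ⟩
    _ ∎
    where
    B = # (+ 1) + q ^ suc n * q ^ suc n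
    D = q ^ suc n * q ^ suc (suc j)
    lemma : q ^ suc j * q ^ (n ∸ j) * gauss n j ≈ q ^ suc n * gauss n j
    lemma with j ℕ.≤? n
    ... | yes j≤n = *-congʳ (trans (sym (^-+ (suc j) (n ∸ j))) (^-congʳ q (≡.cong suc (ℕₚ.m+[n∸m]≡n j≤n))))
    ... | no  j≰n = trans (trans (*-congˡ 0≈) (zeroʳ _)) (sym (trans (*-congˡ 0≈) (zeroʳ _)))
      where 0≈ = gauss-zero (ℕₚ.≰⇒> j≰n)

  ∑θ : ℕ → (ℕ → Carrier) → Carrier
  ∑θ zero    w = 0#
  ∑θ (suc N) w = ∑θ N w + θ N * w N

  ∑θ₁ : ℕ → Carrier
  ∑θ₁ zero    = 0#
  ∑θ₁ (suc N) = ∑θ₁ N + θ N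

  -- The summands θ i (gauss (n+1) i - (1 - q^(n+1))² gauss n i) telescope.
  ∑θ-telescope : ∀ n j → ∑θ (suc j) (gauss (suc n)) ≈
    1-q^ (suc n) ^ 2 * ∑θ (suc j) (gauss n)
    + (θ j * (q ^ suc n * q ^ suc j) * gauss n (suc j)
      + # (ε j) * (# (+ 2) * # (+ j) + # (+ 3)) * q^△ j * q ^ suc n * gauss n j)
  ∑θ-telescope n zero = begin
    0# + # 1ℤ * (# (+ 2) * # (+ 0) + # (+ 1)) * 1# * (Q * x + (# (+ 1) + Q * Q) * x + Q * q ^ 1 * y)
      ≈⟨ +-cong (sym 0-homo) (*-congʳ (*-congˡ (sym 1-homo))) ⟩
    _ ≈⟨ solve 4 (λ q Q x y → con (+ 0) :+ con (+ 1) :* (con (+ 2) :* con (+ 0) :+ con (+ 1)) :* con (+ 1)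
           :* (Q :* x :+ (con (+ 1) :+ Q :* Q) :* x :+ Q :* q :^ 1 :* y)
           := (con (+ 1) :- Q) :^ 2 :* (con (+ 0) :+ con (+ 1) :* (con (+ 2) :* con (+ 0) :+ con (+ 1)) :* con (+ 1) :* x)
           :+ (con (+ 1) :* (con (+ 2) :* con (+ 0) :+ con (+ 1)) :* con (+ 1) :* (Q :* q :^ 1) :* y
             :+ con (+ 1) :* (con (+ 2) :* con (+ 0) :+ con (+ 3)) :* con (+ 1) :* Q :* x)) refl q Q x y ⟩
    _ ≈⟨ +-cong (*-cong (^-congˡ 2 (+-congʳ 1-homo)) (+-cong 0-homo (*-congʳ (*-congˡ 1-homo))))
           (+-cong (*-congʳ (*-congʳ (*-congˡ 1-homo))) (*-congʳ (*-congʳ (*-congˡ 1-homo)))) ⟩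
    _ ∎
    where
    Q = q ^ suc n
    x = gauss n 0
    y = gauss n 1
  ∑θ-telescope n (suc j) = begin
    ∑θ (suc j) (gauss (suc n)) + α′ * (t * qj) * gauss (suc n) (suc j)
      ≈⟨ +-cong (∑θ-telescope n j) (trans (solve 4 (λ e t Q w → e :* (t :* Q) :* w := e :* t :* (Q :* w)) refl α′ t qj _)
           (trans (*-congʳ (*-congʳ α′≈)) (*-congˡ (gauss-suc n j)))) ⟩
    _ ≈⟨ +-congʳ (+-congʳ (*-congʳ (^-congˡ 2 (+-congʳ (sym 1-homo))))) ⟩
    _ ≈⟨ solve 10 (λ s e N t q qj Q x y z →
           (con (+ 1) :- Q) :^ 2 :* s
           :+ (e :* (con (+ 2) :* N :+ con (+ 1)) :* t :* (Q :* qj) :* y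
             :+ e :* (con (+ 2) :* N :+ con (+ 3)) :* t :* Q :* x)
           :+ :- e :* (con (+ 2) :* (con (+ 1) :+ N) :+ con (+ 1)) :* t
              :* (Q :* x :+ qj :* (con (+ 1) :+ Q :* Q) :* y :+ qj :* (Q :* (q :* qj)) :* z)
           := (con (+ 1) :- Q) :^ 2 :* (s :+ :- e :* (con (+ 2) :* (con (+ 1) :+ N) :+ con (+ 1)) :* (t :* qj) :* y)
           :+ (:- e :* (con (+ 2) :* (con (+ 1) :+ N) :+ con (+ 1)) :* (t :* qj) :* (Q :* (q :* qj)) :* z
             :+ :- e :* (con (+ 2) :* (con (+ 1) :+ N) :+ con (+ 3)) :* (t :* qj) :* Q :* y)) refl
           (∑θ (suc j) (gauss n)) (# (ε j)) (# (+ j)) t q qj Q x y z ⟩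
    _ ≈⟨ +-cong (*-cong (^-congˡ 2 (+-congʳ 1-homo)) (+-congˡ (*-congʳ (*-congʳ (sym α′≈)))))
           (+-cong (*-congʳ (*-congʳ (*-congʳ (sym α′≈))))
             (*-congʳ (*-congʳ (*-congʳ (*-cong (sym (-‿homo (ε j))) (+-congʳ (*-congˡ (sym (#suc j))))))))) ⟩
    _ ∎
    where
    Q = q ^ suc n
    x = gauss n j
    y = gauss n (suc j)
    z = gauss n (suc (suc j))
    t = q^△ j
    qj = q ^ suc j
    α′ = # (ε (suc j)) * (# (+ 2) * # (+ suc j) + # (+ 1))
    α′≈ : α′ ≈ - # (ε j) * (# (+ 2) * (# (+ 1) + # (+ j)) + # (+ 1))
    α′≈ = *-cong (-‿homo (ε j)) (+-congʳ (*-congˡ (#suc j)))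

  -- A finite form of Jacobi's identity. Up to sign and a power of q, it is the derivative at z = 1
  -- of the q-binomial expansion of the product of 1 - z q^i over -n ≤ i ≤ n, with symmetric terms
  -- paired. Here it follows from the telescoping sum, whose boundary terms vanish beyond n.
  ∑θ-gauss : ∀ n j → n ≤ j → ∑θ (suc j) (gauss n) ≈ poch n ^ 2
  ∑θ-gauss zero zero z≤n = trans (+-cong (sym 0-homo) (*-cong (*-congˡ (sym 1-homo)) (sym 1-homo)))
    (trans (solve 0 (con (+ 0) :+ con (+ 1) :* (con (+ 2) :* con (+ 0) :+ con (+ 1)) :* con (+ 1) :* con (+ 1) := con (+ 1) :^ 2) refl)
      (^-congˡ 2 1-homo))
  ∑θ-gauss zero (suc j) z≤n = trans (+-cong (∑θ-gauss zero j z≤n) (zeroʳ _)) (+-identityʳ _)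
  ∑θ-gauss (suc n) j n<j = begin
    ∑θ (suc j) (gauss (suc n))
      ≈⟨ ∑θ-telescope n j ⟩
    1-q^ (suc n) ^ 2 * ∑θ (suc j) (gauss n) + (A * gauss n (suc j) + B * gauss n j)
      ≈⟨ +-cong (*-congˡ (∑θ-gauss n j (ℕₚ.<⇒≤ n<j))) (+-cong (vanish (ℕₚ.m<n⇒m<1+n n<j)) (vanish n<j)) ⟩
    1-q^ (suc n) ^ 2 * poch n ^ 2 + (0# + 0#)
      ≈⟨ trans (+-congˡ (+-identityʳ _)) (+-identityʳ _) ⟩
    1-q^ (suc n) ^ 2 * poch n ^ 2
      ≈⟨ solve 2 (λ a b → a :^ 2 :* b :^ 2 := (b :* a) :^ 2) refl _ _ ⟩
    poch (suc n) ^ 2 ∎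
    where
    A = θ j * (q ^ suc n * q ^ suc j)
    B = # (ε j) * (# (+ 2) * # (+ j) + # (+ 3)) * q^△ j * q ^ suc n
    vanish : ∀ {b i} → n < i → b * gauss n i ≈ 0#
    vanish n<i = trans (*-congˡ (gauss-zero n<i)) (zeroʳ _)

  poch-+2 : ∀ n → poch (2 ℕ.+ n) ≈ poch n * ((# (+ 1) - q * q ^ n) * (# (+ 1) - q * (q * q ^ n)))
  poch-+2 n = trans (*-assoc (poch n) _ _) (*-congˡ (*-cong (+-congʳ (sym 1-homo)) (+-congʳ (sym 1-homo))))

  poch-+1 : ∀ n → poch (1 ℕ.+ n) ≈ poch n * (# (+ 1) - q * q ^ n)
  poch-+1 n = *-congˡ (+-congʳ (sym 1-homo))

  -- The quotient formula for the Gaussian binomial with denominators cleared. It is what shows that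
  -- `gauss n j` times the infinite product tends to 1.
  gauss-product : ∀ n i j → i ℕ.+ j ≡ n → gauss n j * poch i * poch (suc (n ℕ.+ j)) ≈ poch (suc (n ℕ.+ n))
  -- The same formula one index higher, where the recursion may reach j = n + 1. The factor 1 - q^i
  -- stands for the quotient of `poch i` by its predecessor, and at i = 0 it vanishes together with
  -- `gauss n j`.
  gauss-product-pred : ∀ n i j → i ℕ.+ j ≡ suc n →
    gauss n j * poch i * poch (suc (n ℕ.+ j)) ≈ (# (+ 1) - q ^ i) * poch (suc (n ℕ.+ n))

  gauss-product-pred n zero j ≡.refl = trans (trans (*-congʳ (trans (*-congʳ (gauss-zero {n} ℕₚ.≤-refl)) (zeroˡ _))) (zeroˡ _))
    (sym (trans (*-congʳ (trans (+-congʳ 1-homo) (-‿inverseʳ 1#))) (zeroˡ _)))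
  gauss-product-pred n (suc i) j eq = begin
    gauss n j * (poch i * (1# - q ^ suc i)) * poch (suc (n ℕ.+ j))
      ≈⟨ solve 4 (λ x p e r → x :* (p :* e) :* r := e :* (x :* p :* r)) refl (gauss n j) (poch i) _ _ ⟩
    (1# - q ^ suc i) * (gauss n j * poch i * poch (suc (n ℕ.+ j)))
      ≈⟨ *-cong (+-congʳ (sym 1-homo)) (gauss-product n i j (ℕₚ.suc-injective eq)) ⟩
    (# (+ 1) - q ^ suc i) * poch (suc (n ℕ.+ n)) ∎

  gauss-product zero zero zero ≡.refl = trans (*-congʳ (*-identityʳ 1#)) (*-identityˡ _)
  gauss-product (suc n) zero (suc .n) ≡.refl = begin
    (q ^ (n ∸ n) * gauss n n + B * gauss n (suc n) + D * gauss n (suc (suc n))) * 1# * poch (suc (suc n ℕ.+ suc n))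
      ≈⟨ *-congʳ (*-congʳ (+-cong (+-cong (*-congʳ (^-congʳ q (ℕₚ.n∸n≡0 n))) (*-congˡ (gauss-zero {n} ℕₚ.≤-refl)))
           (*-congˡ (gauss-zero {n} (ℕₚ.n≤1+n _))))) ⟩
    (1# * gauss n n + B * 0# + D * 0#) * 1# * poch (suc (suc n ℕ.+ suc n))
      ≈⟨ trans (*-congʳ (trans (*-identityʳ _) (trans (+-cong (trans (+-cong (*-identityˡ _) (zeroʳ B)) (+-identityʳ _)) (zeroʳ D)) (+-identityʳ _))))
           (*-congˡ (reflexive (≡.cong poch (≡.cong suc (≡.cong suc (ℕₚ.+-suc n n)))))) ⟩
    gauss n n * poch (3 ℕ.+ (n ℕ.+ n))
      ≈⟨ *-congˡ (poch-+2 (suc (n ℕ.+ n))) ⟩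
    gauss n n * (poch (suc (n ℕ.+ n)) * E)
      ≈⟨ *-assoc (gauss n n) (poch (suc (n ℕ.+ n))) E ⟨
    gauss n n * poch (suc (n ℕ.+ n)) * E
      ≈⟨ *-congʳ (*-congʳ (*-identityʳ _)) ⟨
    gauss n n * 1# * poch (suc (n ℕ.+ n)) * E
      ≈⟨ *-congʳ (gauss-product n zero n ≡.refl) ⟩
    poch (suc (n ℕ.+ n)) * E
      ≈⟨ poch-+2 (suc (n ℕ.+ n)) ⟨
    poch (3 ℕ.+ (n ℕ.+ n))
      ≡⟨ ≡.cong poch (≡.cong suc (≡.cong suc (ℕₚ.+-suc n n))) ⟨
    poch (suc (suc n ℕ.+ suc n)) ∎
    where
    B = # (+ 1) + q ^ suc n * q ^ suc n
    D = q ^ suc n * q ^ suc (suc n)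
    E = (# (+ 1) - q * q ^ suc (n ℕ.+ n)) * (# (+ 1) - q * (q * q ^ suc (n ℕ.+ n)))
  gauss-product (suc n) (suc i) (suc j) eq with ≡.trans (≡.sym (ℕₚ.+-suc i j)) (ℕₚ.suc-injective eq)
  ... | ≡.refl = begin
    (q ^ (suc (i ℕ.+ j) ∸ j) * x + (# (+ 1) + q ^ suc n * q ^ suc n) * y + q ^ suc n * q ^ suc (suc j) * z)
      * poch (suc i) * poch (suc (suc (n ℕ.+ suc j)))
      ≈⟨ *-cong (*-cong (+-cong (+-cong (*-congʳ (^-congʳ q (ℕₚ.m+n∸n≡m (suc i) j)))
             (*-congʳ (+-congˡ (*-cong QN QN)))) (*-congʳ (*-congʳ QN))) (poch-+1 i))
           (trans (reflexive (≡.cong poch (≡.cong suc (≡.cong suc (ℕₚ.+-suc n j)))))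
             (trans (poch-+2 (suc (n ℕ.+ j))) (*-congˡ (*-cong (+-congˡ (-‿cong (*-congˡ QV))) (+-congˡ (-‿cong (*-congˡ (*-congˡ QV)))))))) ⟩
    -- With X = q^i and Y = q^j, M is q^(n+1) and V is q^(n+j+1). Each of the three terms is
    -- regrouped so that the induction hypotheses turn it into a polynomial multiple of Π.
    _ ≈⟨ solve 8 (λ q X Y P b x y z →
           let M = q :* (q :* (X :* Y)) ; V = M :* Y ; e = con (+ 1) :- q :* X ; f₁ = con (+ 1) :- q :* V ; f₂ = con (+ 1) :- q :* (q :* V) in
           (q :* X :* x :+ (con (+ 1) :+ M :* M) :* y :+ M :* (q :* (q :* Y)) :* z) :* (P :* e) :* (b :* (f₁ :* f₂))
           := q :* X :* f₁ :* f₂ :* (x :* (P :* e) :* b) :+ (con (+ 1) :+ M :* M) :* e :* f₂ :* (y :* P :* (b :* f₁))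
              :+ M :* (q :* (q :* Y)) :* e :* (z :* P :* (b :* (f₁ :* f₂)))) refl q X Y P b x y z ⟩
    _ ≈⟨ +-cong (+-cong (*-congˡ (trans (*-congʳ (*-congˡ (sym (poch-+1 i)))) (gauss-product n (suc i) j ≡.refl)))
           (*-congˡ (trans (*-congˡ (trans (*-congˡ (+-congˡ (-‿cong (*-congˡ (sym QV))))) (trans (sym (poch-+1 (suc (n ℕ.+ j))))
               (reflexive (≡.cong poch (≡.cong suc (≡.sym (ℕₚ.+-suc n j)))))))) (gauss-product n i (suc j) (ℕₚ.+-suc i j)))))
           (*-congˡ (trans (*-congˡ (trans (*-congˡ (*-cong (+-congˡ (-‿cong (*-congˡ (sym QV)))) (+-congˡ (-‿cong (*-congˡ (*-congˡ (sym QV)))))))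
               (trans (sym (poch-+2 (suc (n ℕ.+ j)))) (reflexive (≡.cong poch (≡.cong suc
                 (≡.sym (≡.trans (ℕₚ.+-suc n (suc j)) (≡.cong suc (ℕₚ.+-suc n j)))))))))) (gauss-product-pred n i (suc (suc j)) (≡.trans (ℕₚ.+-suc i (suc j)) (≡.cong suc (ℕₚ.+-suc i j)))))) ⟩
    _ ≈⟨ solve 4 (λ q X Y Π →
           let M = q :* (q :* (X :* Y)) ; V = M :* Y ; e = con (+ 1) :- q :* X ; f₁ = con (+ 1) :- q :* V ; f₂ = con (+ 1) :- q :* (q :* V) in
           q :* X :* f₁ :* f₂ :* Π :+ (con (+ 1) :+ M :* M) :* e :* f₂ :* Π :+ M :* (q :* (q :* Y)) :* e :* ((con (+ 1) :- X) :* Π)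
           := Π :* ((con (+ 1) :- M :* M) :* (con (+ 1) :- q :* (M :* M)))) refl q X Y Π ⟩
    _ ≈⟨ *-congˡ (*-cong (+-congˡ (-‿cong QM)) (+-congˡ (-‿cong (*-congˡ QM)))) ⟩
    _ ≈⟨ poch-+2 (suc (n ℕ.+ n)) ⟨
    poch (3 ℕ.+ (n ℕ.+ n))
      ≡⟨ ≡.cong poch (≡.cong suc (≡.cong suc (ℕₚ.+-suc n n))) ⟨
    poch (suc (suc n ℕ.+ suc n)) ∎
    where
    x = gauss n j
    y = gauss n (suc j)
    z = gauss n (suc (suc j))
    P = poch i
    b = poch (suc (n ℕ.+ j))
    Π = poch (suc (n ℕ.+ n))
    X = q ^ i
    Y = q ^ j
    M = q * (q * (X * Y))
    QN : q ^ suc n ≈ M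
    QN = *-congˡ (*-congˡ (^-+ i j))
    QV : q ^ suc (n ℕ.+ j) ≈ M * Y
    QV = trans (^-+ (suc n) j) (*-congʳ QN)
    QM : M * M ≈ q * q ^ suc (n ℕ.+ n)
    QM = trans (*-cong (sym QN) (sym QN)) (trans (sym (^-+ (suc n) (suc n))) (^-congʳ q (≡.cong suc (ℕₚ.+-suc n n))))
  gauss-product (suc n) (suc i) zero eq with ≡.trans (≡.sym (ℕₚ.+-identityʳ i)) (ℕₚ.suc-injective eq)
  ... | ≡.refl = begin
    (q ^ suc n * x + (# (+ 1) + q ^ suc n * q ^ suc n) * x + q ^ suc n * q ^ 1 * z) * poch (suc n) * poch (suc (suc n ℕ.+ 0))
      ≈⟨ *-cong (*-congˡ (poch-+1 n))
           (trans (reflexive (≡.cong poch (≡.cong suc (≡.cong suc (ℕₚ.+-identityʳ n))))) (trans (poch-+1 (suc n)) (*-congʳ (poch-+1 n)))) ⟩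
    _ ≈⟨ solve 5 (λ q X P x z →
           let M = q :* X ; e = con (+ 1) :- q :* X ; f = con (+ 1) :- q :* (q :* X) in
           (M :* x :+ (con (+ 1) :+ M :* M) :* x :+ M :* q :^ 1 :* z) :* (P :* e) :* (P :* e :* f)
           := (M :+ con (+ 1) :+ M :* M) :* e :* f :* (x :* P :* (P :* e)) :+ M :* q :* e :* (z :* P :* (P :* (e :* f)))) refl q X P x z ⟩
    _ ≈⟨ +-cong (*-congˡ (trans (*-congˡ (trans (sym (poch-+1 n)) (reflexive (≡.cong poch (≡.cong suc (≡.sym (ℕₚ.+-identityʳ n)))))))
             (gauss-product n n 0 (ℕₚ.+-identityʳ n))))
           (*-congˡ (trans (*-congˡ (trans (sym (poch-+2 n)) (reflexive (≡.cong poch (≡.cong suc (≡.sym (ℕₚ.+-comm n 1)))))))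
             (gauss-product-pred n n 1 (ℕₚ.+-comm n 1)))) ⟩
    _ ≈⟨ solve 3 (λ q X Π →
           let M = q :* X ; e = con (+ 1) :- q :* X ; f = con (+ 1) :- q :* (q :* X) in
           (M :+ con (+ 1) :+ M :* M) :* e :* f :* Π :+ M :* q :* e :* ((con (+ 1) :- X) :* Π)
           := Π :* ((con (+ 1) :- M :* M) :* (con (+ 1) :- q :* (M :* M)))) refl q X Π ⟩
    _ ≈⟨ *-congˡ (*-cong (+-congˡ (-‿cong QM)) (+-congˡ (-‿cong (*-congˡ QM)))) ⟩
    _ ≈⟨ poch-+2 (suc (n ℕ.+ n)) ⟨
    poch (3 ℕ.+ (n ℕ.+ n))
      ≡⟨ ≡.cong poch (≡.cong suc (≡.cong suc (ℕₚ.+-suc n n))) ⟨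
    poch (suc (suc n ℕ.+ suc n)) ∎
    where
    x = gauss n 0
    z = gauss n 1
    P = poch n
    X = q ^ n
    Π = poch (suc (n ℕ.+ n))
    QM : q ^ suc n * q ^ suc n ≈ q * q ^ suc (n ℕ.+ n)
    QM = trans (sym (^-+ (suc n) (suc n))) (^-congʳ q (≡.cong suc (ℕₚ.+-suc n n)))

-- The norm for q ↦ ωq, ω³ = 1

module NormForm {c ℓ} (R : CommutativeRing c ℓ)
  (ι : ℤ.+-*-rawRing -Raw-AlmostCommutative⟶ fromCommutativeRing R) (q : CommutativeRing.Carrier R)
  (E : Endomorphism R ι) (φ-q : CommutativeRing._≈_ R (Endomorphism.φ E q) (ℤ-Solver._^_ R ι q 3)) where

  open CommutativeRing R hiding (zero)
  open ℤ-Solver R ι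
  open Jacobi R ι q
  open Endomorphism E
  open _-Raw-AlmostCommutative⟶_ ι using (1-homo; 0-homo; +-homo; *-homo)
  open SetoidReasoning setoid

  φ-q^ : ∀ n → φ (q ^ n) ≈ q ^ (n ℕ.* 3)
  φ-q^ n = trans (φ-^ q n) (trans (^-congˡ n φ-q) (trans (^-assocʳ q 3 n) (^-congʳ q (ℕₚ.*-comm 3 n))))

  q^*3 : ∀ n → q ^ (n ℕ.* 3) ≈ (q ^ n) ^ 3
  q^*3 n = sym (^-assocʳ q n 3)

  φ-1-q^ : ∀ n → φ (1-q^ n) ≈ 1-q^ (n ℕ.* 3)
  φ-1-q^ n = trans (φ-+ _ _) (+-cong φ-1 (trans (φ-neg _) (-‿cong (φ-q^ n))))

  -- The product of F over the three substitutions q ↦ ω q, with ω ^ 3 = 1,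
  -- of a series F = A(q³) + q B(q³) + q² C(q³), as a series in q³.
  norm : Carrier → Carrier → Carrier → Carrier
  norm A B C = A ^ 3 + q * B ^ 3 + q ^ 2 * C ^ 3 + # (ℤ.- + 3) * (q * (A * (B * C)))

  record HasNorm (F M : Carrier) : Set (c ⊔ ℓ) where
    constructor has-norm
    field
      {A B C} : Carrier
      split   : F ≈ φ A + q * φ B + q ^ 2 * φ C
      norm≈   : norm A B C ≈ M

  -- The norm of a dissection with B = -3g and C = 0 is P³ - 27qg³. For ∏ (1 - q^n)³, Jacobi's
  -- identity gives such a dissection with g = φ f.
  norm-BC : ∀ P g F → norm P (# (ℤ.- + 3) * g) 0# * g ≈ F * F ^ 3 → P ^ 3 * g ≈ F ^ 4 + # (+ 27) * (q * g ^ 4)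
  norm-BC P g F eq = begin
    P ^ 3 * g
      ≈⟨ solve 3 (λ q P g → P :^ 3 :* g := (P :^ 3 :+ q :* (con (ℤ.- + 3) :* g) :^ 3 :+ q :^ 2 :* con (+ 0) :^ 3
           :+ con (ℤ.- + 3) :* (q :* (P :* ((con (ℤ.- + 3) :* g) :* con (+ 0))))) :* g :+ con (+ 27) :* (q :* g :^ 4)) refl q P g ⟩
    norm P (# (ℤ.- + 3) * g) (# (+ 0)) * g + # (+ 27) * (q * g ^ 4)
      ≈⟨ +-congʳ (trans (*-congʳ (+-cong (+-congˡ (*-congˡ (^-congˡ 3 0-homo))) (*-congˡ (*-congˡ (*-congˡ (*-congˡ 0-homo)))))) eq) ⟩
    F ^ 4 + # (+ 27) * (q * g ^ 4) ∎

  HasNorm-resp : ∀ {F F′ M M′} → F ≈ F′ → M ≈ M′ → HasNorm F M → HasNorm F′ M′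
  HasNorm-resp F≈ M≈ (has-norm s n) = has-norm (trans (sym F≈) s) (trans n M≈)

  -- `norm` is the norm form of A + B t + C t² with t³ = q, hence multiplicative; the new components
  -- are those of the product reduced by t³ = q.
  HasNorm-* : ∀ {F F′ M M′} → HasNorm F M → HasNorm F′ M′ → HasNorm (F * F′) (M * M′)
  HasNorm-* {F} {F′} {M} {M′} (has-norm {A} {B} {C} s n) (has-norm {A′} {B′} {C′} s′ n′) = has-norm
    {A = A * A′ + q * (B * C′ + C * B′)} {B = A * B′ + B * A′ + q * (C * C′)} {C = A * C′ + B * B′ + C * A′}
    (begin
      F * F′ ≈⟨ *-cong s s′ ⟩
      (φ A + q * φ B + q ^ 2 * φ C) * (φ A′ + q * φ B′ + q ^ 2 * φ C′)
        ≈⟨ solve 7 (λ q a b c a′ b′ c′ → (a :+ q :* b :+ q :^ 2 :* c) :* (a′ :+ q :* b′ :+ q :^ 2 :* c′) :=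
             a :* a′ :+ q :^ 3 :* (b :* c′ :+ c :* b′) :+ q :* (a :* b′ :+ b :* a′ :+ q :^ 3 :* (c :* c′))
             :+ q :^ 2 :* (a :* c′ :+ b :* b′ :+ c :* a′)) refl q (φ A) (φ B) (φ C) (φ A′) (φ B′) (φ C′) ⟩
      _ ≈⟨ +-cong (+-cong
             (trans (φ-+ _ _) (+-cong (φ-* _ _) (trans (φ-* _ _) (*-cong φ-q (φ-*+* B C′ C B′)))))
             (*-congˡ (trans (φ-+ _ _) (+-cong (φ-*+* A B′ B A′) (trans (φ-* _ _) (*-cong φ-q (φ-* _ _)))))))
             (*-congˡ (trans (φ-+ _ _) (+-cong (φ-*+* A C′ B B′) (φ-* _ _)))) ⟨
      _ ∎)
    (begin
      _ ≈⟨ solve 7 (λ q a b c a′ b′ c′ → let N = λ a b c → a :^ 3 :+ q :* b :^ 3 :+ q :^ 2 :* c :^ 3 :+ con (ℤ.- + 3) :* (q :* (a :* (b :* c))) in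
             N (a :* a′ :+ q :* (b :* c′ :+ c :* b′)) (a :* b′ :+ b :* a′ :+ q :* (c :* c′)) (a :* c′ :+ b :* b′ :+ c :* a′)
             := N a b c :* N a′ b′ c′) refl q A B C A′ B′ C′ ⟩
      norm A B C * norm A′ B′ C′ ≈⟨ *-cong n n′ ⟩
      M * M′ ∎)
    where
    φ-*+* : ∀ a b c d → φ (a * b + c * d) ≈ φ a * φ b + φ c * φ d
    φ-*+* a b c d = trans (φ-+ _ _) (+-cong (φ-* a b) (φ-* c d))

  HasNorm-1 : HasNorm 1# 1#
  HasNorm-1 = has-norm {A = # (+ 1)} {# (+ 0)} {# (+ 0)}
    (begin
      1#      ≈⟨ 1-homo ⟨
      # (+ 1) ≈⟨ solve 1 (λ q → con (+ 1) := con (+ 1) :+ q :* con (+ 0) :+ q :^ 2 :* con (+ 0)) refl q ⟩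
      _       ≈⟨ +-cong (+-cong (φ-# _) (*-congˡ (φ-# _))) (*-congˡ (φ-# _)) ⟨
      _ ∎)
    (trans (solve 1 (λ q → con (+ 1) :^ 3 :+ q :* con (+ 0) :^ 3 :+ q :^ 2 :* con (+ 0) :^ 3
      :+ con (ℤ.- + 3) :* (q :* (con (+ 1) :* (con (+ 0) :* con (+ 0)))) := con (+ 1)) refl q) 1-homo)

  HasNorm-φ : ∀ A → HasNorm (φ A) (A ^ 3)
  HasNorm-φ A = has-norm {A = A} {# (+ 0)} {# (+ 0)}
    (trans (solve 2 (λ q a → a := a :+ q :* con (+ 0) :+ q :^ 2 :* con (+ 0)) refl q (φ A))
      (sym (+-cong (+-congˡ (*-congˡ (φ-# _))) (*-congˡ (φ-# _)))))
    (solve 2 (λ q A → A :^ 3 :+ q :* con (+ 0) :^ 3 :+ q :^ 2 :* con (+ 0) :^ 3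
      :+ con (ℤ.- + 3) :* (q :* (A :* (con (+ 0) :* con (+ 0)))) := A :^ 3) refl q A)

  -- For n prime to 3, the conjugates of 1 - q^n multiply to 1 - q^(3n), which as a series in q³ is
  -- again 1 - q^n. The residue of n only decides whether q^n falls under B or C.
  HasNorm-1mod3 : ∀ m → HasNorm (1-q^ (1 ℕ.+ m ℕ.* 3)) (1-q^ (1 ℕ.+ m ℕ.* 3))
  HasNorm-1mod3 m = has-norm {A = # (+ 1)} {# (ℤ.- + 1) * q ^ m} {# (+ 0)}
    (begin
      1# - q * q ^ (m ℕ.* 3) ≈⟨ +-cong (sym 1-homo) (-‿cong (*-congˡ (sym (φ-q^ m)))) ⟩
      # (+ 1) - q * φ (q ^ m)
        ≈⟨ solve 2 (λ q m → con (+ 1) :- q :* m := con (+ 1) :+ q :* (con (ℤ.- + 1) :* m) :+ q :^ 2 :* con (+ 0)) refl q (φ (q ^ m)) ⟩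
      _ ≈⟨ +-cong (+-cong (φ-# _) (*-congˡ (trans (φ-* _ _) (*-congʳ (φ-# _))))) (*-congˡ (φ-# _)) ⟨
      _ ∎)
    (trans (solve 2 (λ q m → con (+ 1) :^ 3 :+ q :* (con (ℤ.- + 1) :* m) :^ 3 :+ q :^ 2 :* con (+ 0) :^ 3
        :+ con (ℤ.- + 3) :* (q :* (con (+ 1) :* ((con (ℤ.- + 1) :* m) :* con (+ 0)))) := con (+ 1) :- q :* m :^ 3) refl q (q ^ m))
      (+-cong 1-homo (-‿cong (*-congˡ (sym (q^*3 m))))))

  HasNorm-2mod3 : ∀ m → HasNorm (1-q^ (2 ℕ.+ m ℕ.* 3)) (1-q^ (2 ℕ.+ m ℕ.* 3))
  HasNorm-2mod3 m = has-norm {A = # (+ 1)} {# (+ 0)} {# (ℤ.- + 1) * q ^ m}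
    (begin
      1# - q * (q * q ^ (m ℕ.* 3)) ≈⟨ +-cong (sym 1-homo) (-‿cong (*-congˡ (*-congˡ (sym (φ-q^ m))))) ⟩
      # (+ 1) - q * (q * φ (q ^ m))
        ≈⟨ solve 2 (λ q m → con (+ 1) :- q :* (q :* m) := con (+ 1) :+ q :* con (+ 0) :+ q :^ 2 :* (con (ℤ.- + 1) :* m)) refl q (φ (q ^ m)) ⟩
      _ ≈⟨ +-cong (+-cong (φ-# _) (*-congˡ (φ-# _))) (*-congˡ (trans (φ-* _ _) (*-congʳ (φ-# _)))) ⟨
      _ ∎)
    (trans (solve 2 (λ q m → con (+ 1) :^ 3 :+ q :* con (+ 0) :^ 3 :+ q :^ 2 :* (con (ℤ.- + 1) :* m) :^ 3
        :+ con (ℤ.- + 3) :* (q :* (con (+ 1) :* (con (+ 0) :* (con (ℤ.- + 1) :* m)))) := con (+ 1) :- q :* (q :* m :^ 3)) refl q (q ^ m))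
      (+-cong 1-homo (-‿cong (*-congˡ (*-congˡ (sym (q^*3 m)))))))

  -- Factors with 3 ∤ n contribute 1 - q^n to the norm, and n = 3l contributes (1 - q^l)³.
  -- Multiplying by `φ (poch m)` restores the missing factors 1 - q^(3l). Stopping at 3m makes the
  -- identity exact for partial products.
  HasNorm-poch : ∀ m → ∃ λ M → HasNorm (poch (m ℕ.* 3)) M × M * φ (poch m) ≈ poch (m ℕ.* 3) * poch m ^ 3
  HasNorm-poch zero = 1# , HasNorm-1 , *-congˡ (trans φ-1 (trans (sym (*-identityʳ 1#))
    (*-congˡ (trans (sym (*-identityʳ 1#)) (*-congˡ (sym (*-identityʳ 1#)))))))
  HasNorm-poch (suc m) with HasNorm-poch m
  ... | M , N , M≈ = M * u * v * 1-q^ (suc m) ^ 3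
    , HasNorm-* (HasNorm-* (HasNorm-* N (HasNorm-1mod3 m)) (HasNorm-2mod3 m))
        (HasNorm-resp (φ-1-q^ (suc m)) refl (HasNorm-φ (1-q^ (suc m))))
    , (begin
      M * u * v * 1-q^ (suc m) ^ 3 * φ (poch m * 1-q^ (suc m))
        ≈⟨ *-congˡ (trans (φ-* _ _) (*-congˡ (φ-1-q^ (suc m)))) ⟩
      M * u * v * 1-q^ (suc m) ^ 3 * (φ (poch m) * w)
        ≈⟨ solve 6 (λ M u v e p w → M :* u :* v :* e :^ 3 :* (p :* w) := M :* p :* (u :* v :* w :* e :^ 3)) refl M u v _ _ w ⟩
      M * φ (poch m) * (u * v * w * 1-q^ (suc m) ^ 3)
        ≈⟨ *-congʳ M≈ ⟩
      poch (m ℕ.* 3) * poch m ^ 3 * (u * v * w * 1-q^ (suc m) ^ 3)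
        ≈⟨ solve 6 (λ P p u v w e → P :* p :^ 3 :* (u :* v :* w :* e :^ 3) := P :* u :* v :* w :* (p :* e) :^ 3) refl (poch (m ℕ.* 3)) (poch m) u v w _ ⟩
      poch (suc m ℕ.* 3) * poch (suc m) ^ 3 ∎)
    where
    u = 1-q^ (1 ℕ.+ m ℕ.* 3)
    v = 1-q^ (2 ℕ.+ m ℕ.* 3)
    w = 1-q^ (3 ℕ.+ m ℕ.* 3)

  HasNorm-poch³ : ∀ m → ∃ λ M → HasNorm (poch (m ℕ.* 3) ^ 3) M
    × M * φ (poch m ^ 3) ≈ poch (m ℕ.* 3) ^ 3 * (poch m ^ 3) ^ 3
  HasNorm-poch³ m with HasNorm-poch m
  ... | M , N , M≈ = M * (M * (M * 1#)) , HasNorm-* N (HasNorm-* N (HasNorm-* N HasNorm-1)) , (begin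
    M ^ 3 * φ (poch m ^ 3)   ≈⟨ *-congˡ (φ-^ (poch m) 3) ⟩
    M ^ 3 * φ (poch m) ^ 3   ≈⟨ solve 2 (λ M p → M :^ 3 :* p :^ 3 := (M :* p) :^ 3) refl M _ ⟩
    (M * φ (poch m)) ^ 3     ≈⟨ ^-congˡ 3 M≈ ⟩
    (poch (m ℕ.* 3) * poch m ^ 3) ^ 3
      ≈⟨ solve 2 (λ P p → (P :* p :^ 3) :^ 3 := P :^ 3 :* (p :^ 3) :^ 3) refl (poch (m ℕ.* 3)) (poch m) ⟩
    poch (m ℕ.* 3) ^ 3 * (poch m ^ 3) ^ 3 ∎)

  α : ℕ → ℤ
  α i = ε i ℤ.* (+ 2 ℤ.* + i ℤ.+ + 1)

  θ-α : ∀ i → θ i ≈ # (α i) * q^△ i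
  θ-α i = *-congʳ (sym (trans (*-homo _ _) (*-congˡ (trans (+-homo _ _) (+-congʳ (*-homo _ _))))))

  -- 2(3l+1) + 1 = 3(2l+1), while 3l+1 and l have opposite parity.
  α-1mod3 : ∀ l → α (1 ℕ.+ l ℕ.* 3) ≡ ℤ.- + 3 ℤ.* α l
  α-1mod3 l = ≡.trans (≡.cong₂ (λ e n → ℤ.- e ℤ.* (+ 2 ℤ.* (+ 1 ℤ.+ n) ℤ.+ + 1)) (ε-*3 l) (ℤₚ.pos-* l 3)) (lemma (ε l) (+ l))
    where
    ε-*3 : ∀ l → ε (l ℕ.* 3) ≡ ε l
    ε-*3 zero    = ≡.refl
    ε-*3 (suc l) = ≡.cong ℤ.-_ (≡.trans (ℤₚ.neg-involutive _) (ε-*3 l))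
    lemma : ∀ e n → ℤ.- e ℤ.* (+ 2 ℤ.* (+ 1 ℤ.+ n ℤ.* + 3) ℤ.+ + 1) ≡ ℤ.- + 3 ℤ.* (e ℤ.* (+ 2 ℤ.* n ℤ.+ + 1))
    lemma = ℤ-Tactic.solve-∀

  private
    -- Not the series x of the overview but the monomial q^(l(3l+1)/2), whose exponent is a third of
    -- the triangular number of 3l.
    x : ℕ → Carrier
    x zero    = 1#
    x (suc l) = x l * (q * q ^ l * q ^ l) * q ^ suc l

  x-q^ : ∀ l → x l * q ^ l ≈ φ (q^△ l)
  x-q^ zero    = trans (*-identityʳ 1#) (sym φ-1)
  x-q^ (suc l) = begin
    x l * (q * q ^ l * q ^ l) * (q * q ^ l) * (q * q ^ l)
      ≈⟨ solve 3 (λ q x L → x :* (q :* L :* L) :* (q :* L) :* (q :* L) := x :* L :* (q :* (q :* (q :* L :^ 3)))) refl q (x l) (q ^ l) ⟩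
    x l * q ^ l * (q * (q * (q * (q ^ l) ^ 3)))
      ≈⟨ *-cong (x-q^ l) (*-congˡ (*-congˡ (*-congˡ (sym (q^*3 l))))) ⟩
    φ (q^△ l) * q ^ (suc l ℕ.* 3) ≈⟨ *-congˡ (φ-q^ (suc l)) ⟨
    φ (q^△ l) * φ (q ^ suc l)     ≈⟨ φ-* _ _ ⟨
    φ (q^△ (suc l)) ∎

  -- The triangular numbers of 3l and 3l+2 are multiples of 3, and that of 3l+1 is 1 plus 9 times
  -- that of l.
  q^△-0mod3 : ∀ l → q^△ (l ℕ.* 3) ≈ φ (x l)
  q^△-1mod3 : ∀ l → q^△ (1 ℕ.+ l ℕ.* 3) ≈ q * φ (φ (q^△ l))
  q^△-2mod3 : ∀ l → q^△ (2 ℕ.+ l ℕ.* 3) ≈ φ (x l * (q * q ^ l * q ^ l))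

  q^△-0mod3 zero    = sym φ-1
  q^△-0mod3 (suc l) = trans (*-cong (q^△-2mod3 l) (sym (φ-q^ (suc l)))) (sym (φ-* _ _))

  q^△-1mod3 l = begin
    q^△ (l ℕ.* 3) * (q * q ^ (l ℕ.* 3)) ≈⟨ *-cong (q^△-0mod3 l) (*-congˡ (sym (φ-q^ l))) ⟩
    φ (x l) * (q * φ (q ^ l))           ≈⟨ solve 3 (λ x q l → x :* (q :* l) := q :* (x :* l)) refl _ q _ ⟩
    q * (φ (x l) * φ (q ^ l))           ≈⟨ *-congˡ (φ-* _ _) ⟨
    q * φ (x l * q ^ l)                 ≈⟨ *-congˡ (φ-cong (x-q^ l)) ⟩
    q * φ (φ (q^△ l)) ∎

  q^△-2mod3 l = begin
    q^△ (l ℕ.* 3) * (q * q ^ (l ℕ.* 3)) * (q * (q * q ^ (l ℕ.* 3)))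
      ≈⟨ *-cong (*-cong (q^△-0mod3 l) (*-congˡ (sym (φ-q^ l)))) (*-congˡ (*-congˡ (sym (φ-q^ l)))) ⟩
    φ (x l) * (q * φ (q ^ l)) * (q * (q * φ (q ^ l)))
      ≈⟨ solve 3 (λ x q l → x :* (q :* l) :* (q :* (q :* l)) := x :* (q :^ 3 :* l :* l)) refl _ q _ ⟩
    φ (x l) * (q ^ 3 * φ (q ^ l) * φ (q ^ l))
      ≈⟨ trans (φ-* _ _) (*-congˡ (trans (φ-* _ _) (*-congʳ (trans (φ-* _ _) (*-congʳ φ-q))))) ⟨
    φ (x l * (q * q ^ l * q ^ l)) ∎

  -- Terms are taken in blocks of three. The middle ones reproduce -3 times the first m terms with q
  -- replaced by q⁹; Y collects the others.
  ∑θ₁-*3 : ∀ m → ∃ λ Y → ∑θ₁ (m ℕ.* 3) ≈ φ Y + q * φ (# (ℤ.- + 3) * φ (∑θ₁ m))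
  ∑θ₁-*3 zero = 0# , (begin
    0#                                        ≈⟨ zeroʳ q ⟨
    q * 0#                                    ≈⟨ *-congˡ (zeroʳ _) ⟨
    q * (# (ℤ.- + 3) * 0#)                    ≈⟨ *-congˡ (*-cong (φ-# _) (trans (φ-cong φ-0) φ-0)) ⟨
    q * (φ (# (ℤ.- + 3)) * φ (φ 0#))          ≈⟨ *-congˡ (φ-* _ _) ⟨
    q * φ (# (ℤ.- + 3) * φ 0#)                ≈⟨ +-identityˡ _ ⟨
    0# + q * φ (# (ℤ.- + 3) * φ 0#)           ≈⟨ +-congʳ φ-0 ⟨
    φ 0# + q * φ (# (ℤ.- + 3) * φ 0#)         ∎)
  ∑θ₁-*3 (suc m) with ∑θ₁-*3 m
  ... | Y , Y≈ = Y + # (α (m ℕ.* 3)) * x m + # (α (2 ℕ.+ m ℕ.* 3)) * (x m * (q * q ^ m * q ^ m)) , (begin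
    ∑θ₁ (m ℕ.* 3) + θ (m ℕ.* 3) + θ (1 ℕ.+ m ℕ.* 3) + θ (2 ℕ.+ m ℕ.* 3)
      ≈⟨ +-cong (+-cong (+-cong Y≈ (trans (θ-α (m ℕ.* 3)) (trans (*-congˡ (q^△-0mod3 m)) (sym (φ-#* _ _))))) a₁≈)
           (trans (θ-α (2 ℕ.+ m ℕ.* 3)) (trans (*-congˡ (q^△-2mod3 m)) (sym (φ-#* _ _)))) ⟩
    φ Y + q * φ (# (ℤ.- + 3) * φ (∑θ₁ m)) + φ y₀ + q * φ (# (ℤ.- + 3) * φ (θ m)) + φ y₂
      ≈⟨ solve 6 (λ q a b c d e → a :+ q :* b :+ c :+ q :* d :+ e := a :+ c :+ e :+ q :* (b :+ d)) refl q _ _ _ _ _ ⟩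
    φ Y + φ y₀ + φ y₂ + q * (φ (# (ℤ.- + 3) * φ (∑θ₁ m)) + φ (# (ℤ.- + 3) * φ (θ m)))
      ≈⟨ +-cong (trans (φ-+ _ _) (+-congʳ (φ-+ _ _)))
           (*-congˡ (trans (φ-cong (trans (*-congˡ (φ-+ _ _)) (distribˡ _ _ _))) (φ-+ _ _))) ⟨
    φ (Y + y₀ + y₂) + q * φ (# (ℤ.- + 3) * φ (∑θ₁ m + θ m)) ∎)
    where
    y₀ = # (α (m ℕ.* 3)) * x m
    y₂ = # (α (2 ℕ.+ m ℕ.* 3)) * (x m * (q * q ^ m * q ^ m))
    a₁≈ : θ (1 ℕ.+ m ℕ.* 3) ≈ q * φ (# (ℤ.- + 3) * φ (θ m))
    a₁≈ = begin
      θ (1 ℕ.+ m ℕ.* 3)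
        ≈⟨ trans (θ-α (1 ℕ.+ m ℕ.* 3)) (*-cong (trans (reflexive (≡.cong # (α-1mod3 m))) (*-homo _ _)) (q^△-1mod3 m)) ⟩
      # (ℤ.- + 3) * # (α m) * (q * φ (φ (q^△ m)))
        ≈⟨ solve 4 (λ a b q x → a :* b :* (q :* x) := q :* (a :* (b :* x))) refl _ _ q _ ⟩
      q * (# (ℤ.- + 3) * (# (α m) * φ (φ (q^△ m))))
        ≈⟨ *-congˡ (*-congˡ (trans (sym (φ-#* _ _)) (φ-cong (sym (φ-#* _ _))))) ⟩
      q * (# (ℤ.- + 3) * φ (φ (# (α m) * q^△ m)))
        ≈⟨ *-congˡ (trans (sym (φ-#* _ _)) (φ-cong (*-congˡ (φ-cong (sym (θ-α m)))))) ⟩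
      q * φ (# (ℤ.- + 3) * φ (θ m)) ∎

-- From ∏ (1 - q^n)³ to x = q ∏ (1 - q^(8n))³

module Rescaling {c ℓ} (R : CommutativeRing c ℓ)
  (ι : ℤ.+-*-rawRing -Raw-AlmostCommutative⟶ fromCommutativeRing R) (q : CommutativeRing.Carrier R)
  (Φ Ψ : Endomorphism R ι) where

  open CommutativeRing R hiding (zero)
  open ℤ-Solver R ι
  open Algebra.Properties.CommutativeSemiring.Exp commutativeSemiring using (^-distrib-*)
  open Endomorphism Φ
  open Endomorphism Ψ renaming
    (φ to ψ; φ-cong to ψ-cong; φ-+ to ψ-+; φ-* to ψ-*; φ-# to ψ-#; φ-0 to ψ-0; φ-1 to ψ-1; φ-^ to ψ-^; φ-#* to ψ-#*; φ-neg to ψ-neg)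
  open SetoidReasoning setoid

  -- Replacing q by q⁸ and multiplying by q turns the exponent j(j+1)/2 into (2j+1)². The term
  -- carrying φ f then starts with q · q⁸ = q⁹, exactly the leading factor of `φ (φ η)`.
  module FromDissection (φ-q : φ q ≈ q ^ 3) (ψ-q : ψ q ≈ q ^ 8) (ψφ : ∀ a → ψ (φ a) ≈ φ (ψ a)) (f P : Carrier)
    (split : f ≈ φ P + q * φ (# (ℤ.- + 3) * φ f))
    (quartic : P ^ 3 * φ f ≈ f ^ 4 + # (+ 27) * (q * φ f ^ 4)) where

    η π ρ : Carrier
    η = q * ψ f
    π = q * φ (ψ P)
    ρ = q * ψ P ^ 3

    φη : φ η ≈ q ^ 3 * φ (ψ f)
    φη = trans (φ-* _ _) (*-congʳ φ-q)

    φφη : φ (φ η) ≈ (q ^ 3) ^ 3 * φ (φ (ψ f))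
    φφη = trans (φ-cong φη) (trans (φ-* _ _) (*-congʳ (trans (φ-^ q 3) (^-congˡ 3 φ-q))))

    η-split : η ≈ π + # (ℤ.- + 3) * φ (φ η)
    η-split = begin
      q * ψ f
        ≈⟨ *-congˡ (trans (ψ-cong split) (trans (ψ-+ _ _) (+-cong (ψφ P) (trans (ψ-* _ _) (*-cong ψ-q
             (trans (ψφ _) (trans (φ-cong (trans (ψ-#* _ _) (*-congˡ (ψφ f)))) (φ-#* _ _)))))))) ⟩
      q * (φ (ψ P) + q ^ 8 * (# (ℤ.- + 3) * φ (φ (ψ f))))
        ≈⟨ solve 3 (λ q a b → q :* (a :+ q :^ 8 :* (con (ℤ.- + 3) :* b)) := q :* a :+ con (ℤ.- + 3) :* ((q :^ 3) :^ 3 :* b)) refl q _ _ ⟩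
      q * φ (ψ P) + # (ℤ.- + 3) * ((q ^ 3) ^ 3 * φ (φ (ψ f)))
        ≈⟨ +-congˡ (*-congˡ φφη) ⟨
      π + # (ℤ.- + 3) * φ (φ η) ∎

    π³≈ : π ^ 3 ≈ φ ρ
    π³≈ = begin
      (q * φ (ψ P)) ^ 3       ≈⟨ solve 2 (λ q a → (q :* a) :^ 3 := q :^ 3 :* a :^ 3) refl q _ ⟩
      q ^ 3 * φ (ψ P) ^ 3     ≈⟨ *-cong φ-q (φ-^ (ψ P) 3) ⟨
      φ q * φ (ψ P ^ 3)       ≈⟨ φ-* _ _ ⟨
      φ ρ                     ∎

    π≈ : π ≈ q ^ 1 * φ (ψ P)
    π≈ = *-congʳ (sym (*-identityʳ q))

    π²≈ : π ^ 2 ≈ q ^ 2 * φ (ψ P ^ 2)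
    π²≈ = trans (solve 2 (λ q a → (q :* a) :^ 2 := q :^ 2 :* a :^ 2) refl q (φ (ψ P))) (*-congˡ (sym (φ-^ (ψ P) 2)))

    η^ : ∀ k → η ^ k ≈ q ^ k * ψ (f ^ k)
    η^ k = trans (^-distrib-* q (ψ f) k) (*-congˡ (sym (ψ-^ f k)))

    ρφη : ρ * φ η ≈ η ^ 4 + # (+ 27) * φ η ^ 4
    ρφη = begin
      q * ψ P ^ 3 * φ η
        ≈⟨ *-congˡ φη ⟩
      q * ψ P ^ 3 * (q ^ 3 * φ (ψ f))
        ≈⟨ solve 3 (λ q a b → q :* a :* (q :^ 3 :* b) := q :^ 4 :* (a :* b)) refl q _ _ ⟩
      q ^ 4 * (ψ P ^ 3 * φ (ψ f))
        ≈⟨ *-congˡ (trans (*-cong (sym (ψ-^ P 3)) (sym (ψφ f))) (trans (sym (ψ-* _ _)) (ψ-cong quartic))) ⟩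
      q ^ 4 * ψ (f ^ 4 + # (+ 27) * (q * φ f ^ 4))
        ≈⟨ *-congˡ (trans (ψ-+ _ _) (+-cong (ψ-^ f 4) (trans (ψ-#* _ _) (*-congˡ (trans (ψ-* _ _)
             (*-cong ψ-q (trans (ψ-^ _ 4) (^-congˡ 4 (ψφ f))))))))) ⟩
      q ^ 4 * (ψ f ^ 4 + # (+ 27) * (q ^ 8 * φ (ψ f) ^ 4))
        ≈⟨ solve 3 (λ q a b → q :^ 4 :* (a :^ 4 :+ con (+ 27) :* (q :^ 8 :* b :^ 4))
             := (q :* a) :^ 4 :+ con (+ 27) :* (q :^ 3 :* b) :^ 4) refl q _ _ ⟩
      (q * ψ f) ^ 4 + # (+ 27) * (q ^ 3 * φ (ψ f)) ^ 4
        ≈⟨ +-congˡ (*-congˡ (^-congˡ 4 φη)) ⟨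
      η ^ 4 + # (+ 27) * φ η ^ 4 ∎

-- Formal power series

open import Data.Nat using (_/_; _%_)
open import Data.Nat.Divisibility using (n∣m*n)
open import Data.Nat.DivMod
open import Defs
open import Relation.Binary.PropositionalEquality hiding (setoid)
open Algebra.Properties.AbelianGroup ℤₚ.+-0-abelianGroup using () renaming (∙-cancelʳ to ℤ-cancelʳ)

infix 4 _≈_
infixl 6 _+ₛ_
infix 8 -ₛ_

_≈_ : Series → Series → Set
F ≈ G = ∀ n → F n ≡ G n

_+ₛ_ : Series → Series → Series
(F +ₛ G) n = F n ℤ.+ G n

-ₛ_ : Series → Series
(-ₛ F) n = ℤ.- F n

0ₛ : Series
0ₛ _ = 0ℤ

const : ℤ → Series
const c zero    = c
const c (suc _) = 0ℤ

infixl 7 _·_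

_·_ : ℤ → Series → Series
(c · F) n = c ℤ.* F n

tail : Series → Series
tail F n = F (suc n)

*-zero : ∀ F G → (F *ₛ G) 0 ≡ F 0 ℤ.* G 0
*-zero F G = ℤₚ.+-identityʳ _

*-suc : ∀ F G n → (F *ₛ G) (suc n) ≡ F 0 ℤ.* G (suc n) ℤ.+ (tail F *ₛ G) n
*-suc F G n = refl

*-cong-≤ : ∀ {F F′ G G′} n → (∀ i → i ≤ n → F i ≡ F′ i) → (∀ i → i ≤ n → G i ≡ G′ i) →
  (F *ₛ G) n ≡ (F′ *ₛ G′) n
*-cong-≤ zero p q = cong (ℤ._+ 0ℤ) (cong₂ ℤ._*_ (p 0 z≤n) (q 0 z≤n))
*-cong-≤ {F} {F′} {G} {G′} (suc n) p q = cong₂ ℤ._+_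
  (cong₂ ℤ._*_ (p 0 z≤n) (q (suc n) (s≤s (ℕₚ.≤-refl))))
  (*-cong-≤ n (λ i i≤n → p (suc i) (s≤s i≤n)) (λ i i≤n → q i (ℕₚ.m≤n⇒m≤1+n i≤n)))

*-congₛ : ∀ {F F′ G G′} → F ≈ F′ → G ≈ G′ → F *ₛ G ≈ F′ *ₛ G′
*-congₛ p q n = *-cong-≤ n (λ i _ → p i) (λ i _ → q i)

*-distribʳₛ : ∀ H F G → (F +ₛ G) *ₛ H ≈ F *ₛ H +ₛ G *ₛ H
*-distribʳₛ H F G zero    = lemma (F 0) (G 0) (H 0)
  where
  lemma : ∀ f g h → (f ℤ.+ g) ℤ.* h ℤ.+ 0ℤ ≡ f ℤ.* h ℤ.+ 0ℤ ℤ.+ (g ℤ.* h ℤ.+ 0ℤ)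
  lemma = ℤ-Tactic.solve-∀
*-distribʳₛ H F G (suc n) = begin
  (F 0 ℤ.+ G 0) ℤ.* H (suc n) ℤ.+ ((tail F +ₛ tail G) *ₛ H) n
    ≡⟨ cong (ℤ._+_ ((F 0 ℤ.+ G 0) ℤ.* H (suc n))) (*-distribʳₛ H (tail F) (tail G) n) ⟩
  (F 0 ℤ.+ G 0) ℤ.* H (suc n) ℤ.+ ((tail F *ₛ H) n ℤ.+ (tail G *ₛ H) n)
    ≡⟨ lemma (F 0) (G 0) (H (suc n)) ((tail F *ₛ H) n) ((tail G *ₛ H) n) ⟩
  (F 0 ℤ.* H (suc n) ℤ.+ (tail F *ₛ H) n) ℤ.+ (G 0 ℤ.* H (suc n) ℤ.+ (tail G *ₛ H) n) ∎
  where
  open ≡-Reasoning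
  lemma : ∀ f g h a b → (f ℤ.+ g) ℤ.* h ℤ.+ (a ℤ.+ b) ≡ (f ℤ.* h ℤ.+ a) ℤ.+ (g ℤ.* h ℤ.+ b)
  lemma = ℤ-Tactic.solve-∀

·-*-assoc : ∀ c F G → (c · F) *ₛ G ≈ c · (F *ₛ G)
·-*-assoc c F G zero    = lemma c (F 0) (G 0)
  where
  lemma : ∀ c f g → c ℤ.* f ℤ.* g ℤ.+ 0ℤ ≡ c ℤ.* (f ℤ.* g ℤ.+ 0ℤ)
  lemma = ℤ-Tactic.solve-∀
·-*-assoc c F G (suc n) = trans
  (cong (ℤ._+_ (c ℤ.* F 0 ℤ.* G (suc n))) (·-*-assoc c (tail F) G n))
  (lemma c (F 0) (G (suc n)) ((tail F *ₛ G) n))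
  where
  lemma : ∀ c f g a → c ℤ.* f ℤ.* g ℤ.+ c ℤ.* a ≡ c ℤ.* (f ℤ.* g ℤ.+ a)
  lemma = ℤ-Tactic.solve-∀

*-assocₛ : ∀ F G H → (F *ₛ G) *ₛ H ≈ F *ₛ (G *ₛ H)
*-assocₛ F G H zero    = lemma (F 0) (G 0) (H 0)
  where
  lemma : ∀ f g h → (f ℤ.* g ℤ.+ 0ℤ) ℤ.* h ℤ.+ 0ℤ ≡ f ℤ.* (g ℤ.* h ℤ.+ 0ℤ) ℤ.+ 0ℤ
  lemma = ℤ-Tactic.solve-∀
*-assocₛ F G H (suc n) = begin
  (F 0 ℤ.* G 0 ℤ.+ 0ℤ) ℤ.* H (suc n) ℤ.+ (tail (F *ₛ G) *ₛ H) n
    ≡⟨ cong (ℤ._+_ ((F 0 ℤ.* G 0 ℤ.+ 0ℤ) ℤ.* H (suc n))) (*-distribʳₛ H (F 0 · tail G) (tail F *ₛ G) n) ⟩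
  (F 0 ℤ.* G 0 ℤ.+ 0ℤ) ℤ.* H (suc n) ℤ.+ (((F 0 · tail G) *ₛ H) n ℤ.+ ((tail F *ₛ G) *ₛ H) n)
    ≡⟨ cong (ℤ._+_ ((F 0 ℤ.* G 0 ℤ.+ 0ℤ) ℤ.* H (suc n))) (cong₂ ℤ._+_ (·-*-assoc (F 0) (tail G) H n) (*-assocₛ (tail F) G H n)) ⟩
  (F 0 ℤ.* G 0 ℤ.+ 0ℤ) ℤ.* H (suc n) ℤ.+ (F 0 ℤ.* (tail G *ₛ H) n ℤ.+ (tail F *ₛ (G *ₛ H)) n)
    ≡⟨ lemma (F 0) (G 0) (H (suc n)) ((tail G *ₛ H) n) ((tail F *ₛ (G *ₛ H)) n) ⟩
  F 0 ℤ.* (G 0 ℤ.* H (suc n) ℤ.+ (tail G *ₛ H) n) ℤ.+ (tail F *ₛ (G *ₛ H)) n ∎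
  where
  open ≡-Reasoning
  lemma : ∀ f g h a b → (f ℤ.* g ℤ.+ 0ℤ) ℤ.* h ℤ.+ (f ℤ.* a ℤ.+ b) ≡ f ℤ.* (g ℤ.* h ℤ.+ a) ℤ.+ b
  lemma = ℤ-Tactic.solve-∀

*-sucʳ : ∀ F G n → (F *ₛ G) (suc n) ≡ (F *ₛ tail G) n ℤ.+ F (suc n) ℤ.* G 0
*-sucʳ F G zero    = lemma (F 0) (F 1) (G 0) (G 1)
  where
  lemma : ∀ f f′ g g′ → f ℤ.* g′ ℤ.+ (f′ ℤ.* g ℤ.+ 0ℤ) ≡ f ℤ.* g′ ℤ.+ 0ℤ ℤ.+ f′ ℤ.* g
  lemma = ℤ-Tactic.solve-∀
*-sucʳ F G (suc n) = trans (cong (ℤ._+_ (F 0 ℤ.* G (suc (suc n)))) (*-sucʳ (tail F) G n)) (sym (ℤₚ.+-assoc (F 0 ℤ.* G (suc (suc n))) _ _))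

*-commₛ : ∀ F G → F *ₛ G ≈ G *ₛ F
*-commₛ F G zero    = cong (ℤ._+ 0ℤ) (ℤₚ.*-comm (F 0) (G 0))
*-commₛ F G (suc n) = begin
  F 0 ℤ.* G (suc n) ℤ.+ (tail F *ₛ G) n ≡⟨ cong₂ ℤ._+_ (ℤₚ.*-comm (F 0) _) (*-commₛ (tail F) G n) ⟩
  G (suc n) ℤ.* F 0 ℤ.+ (G *ₛ tail F) n ≡⟨ ℤₚ.+-comm (G (suc n) ℤ.* F 0) _ ⟩
  (G *ₛ tail F) n ℤ.+ G (suc n) ℤ.* F 0 ≡⟨ *-sucʳ G F n ⟨
  (G *ₛ F) (suc n) ∎
  where open ≡-Reasoning

*-zeroˡₛ : ∀ F → 0ₛ *ₛ F ≈ 0ₛ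
*-zeroˡₛ F zero    = refl
*-zeroˡₛ F (suc n) = trans (ℤₚ.+-identityˡ _) (*-zeroˡₛ F n)

const-* : ∀ c F → const c *ₛ F ≈ c · F
const-* c F zero    = ℤₚ.+-identityʳ _
const-* c F (suc n) = trans (cong (ℤ._+_ (c ℤ.* F (suc n))) (*-zeroˡₛ F n)) (ℤₚ.+-identityʳ _)

const1≈1ₛ : const 1ℤ ≈ 1ₛ
const1≈1ₛ zero    = refl
const1≈1ₛ (suc n) = refl

*-identityˡₛ : ∀ F → 1ₛ *ₛ F ≈ F
*-identityˡₛ F n = trans (*-congₛ {1ₛ} {const 1ℤ} {F} (λ i → sym (const1≈1ₛ i)) (λ _ → refl) n)
  (trans (const-* 1ℤ F n) (ℤₚ.*-identityˡ _))

seriesRing : CommutativeRing 0ℓ 0ℓ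
seriesRing = record
  { Carrier = Series ; _≈_ = _≈_ ; _+_ = _+ₛ_ ; _*_ = _*ₛ_ ; -_ = -ₛ_ ; 0# = 0ₛ ; 1# = 1ₛ
  ; isCommutativeRing = record
    { isRing = record
      { +-isAbelianGroup = record
        { isGroup = record
          { isMonoid = record
            { isSemigroup = record
              { isMagma = record
                { isEquivalence = record
                  { refl = λ _ → refl ; sym = λ p n → sym (p n) ; trans = λ p q n → trans (p n) (q n) }
                ; ∙-cong = λ p q n → cong₂ ℤ._+_ (p n) (q n) }
              ; assoc = λ F G H n → ℤₚ.+-assoc (F n) (G n) (H n) }
            ; identity = (λ F n → ℤₚ.+-identityˡ (F n)) , (λ F n → ℤₚ.+-identityʳ (F n)) }
          ; inverse = (λ F n → ℤₚ.+-inverseˡ (F n)) , (λ F n → ℤₚ.+-inverseʳ (F n))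
          ; ⁻¹-cong = λ p n → cong ℤ.-_ (p n) }
        ; comm = λ F G n → ℤₚ.+-comm (F n) (G n) }
      ; *-cong = *-congₛ
      ; *-assoc = *-assocₛ
      ; *-identity = *-identityˡₛ , λ F n → trans (*-commₛ F 1ₛ n) (*-identityˡₛ F n)
      ; distrib = (λ H F G n → trans (*-commₛ H (F +ₛ G) n) (trans (*-distribʳₛ H F G n)
                     (cong₂ ℤ._+_ (*-commₛ F H n) (*-commₛ G H n)))) , *-distribʳₛ }
    ; *-comm = *-commₛ } }

const-ring : ℤ.+-*-rawRing -Raw-AlmostCommutative⟶ fromCommutativeRing seriesRing
const-ring = record
  { ⟦_⟧    = const
  ; +-homo = λ { c d zero → refl ; c d (suc n) → refl }
  ; *-homo = λ { c d zero → sym (ℤₚ.+-identityʳ _)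
               ; c d (suc n) → sym (trans (const-* c (const d) (suc n)) (ℤₚ.*-zeroʳ c)) }
  ; -‿homo = λ { c zero → refl ; c (suc n) → refl }
  ; 0-homo = λ { zero → refl ; (suc n) → refl }
  ; 1-homo = const1≈1ₛ
  }

module 𝕊 where
  open CommutativeRing seriesRing public hiding (zero; _≈_)

-- Dilations q ↦ q^d and sections along residue classes mod d

drop : ℕ → Series → Series
drop d F n = F (d ℕ.+ n)

*-zero-prefix : ∀ F G n → (∀ i → i ≤ n → F i ≡ 0ℤ) → (F *ₛ G) n ≡ 0ℤ
*-zero-prefix F G n F≡0 = trans (*-cong-≤ {G = G} n F≡0 (λ _ _ → refl)) (*-zeroˡₛ G n)

*-head : ∀ F G n → (∀ i → i < n → F (suc i) ≡ 0ℤ) → (F *ₛ G) n ≡ F 0 ℤ.* G n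
*-head F G zero    _   = *-zero F G
*-head F G (suc n) F≡0 = trans (cong (ℤ._+_ (F 0 ℤ.* G (suc n)))
  (*-zero-prefix (tail F) G n (λ i i≤n → F≡0 i (s≤s i≤n)))) (ℤₚ.+-identityʳ _)

*-drop-prefix : ∀ e F G n → (∀ i → i < e → F i ≡ 0ℤ) → (F *ₛ G) (e ℕ.+ n) ≡ (drop e F *ₛ G) n
*-drop-prefix zero    F G n _   = refl
*-drop-prefix (suc e) F G n F≡0 = begin
  F 0 ℤ.* G (suc (e ℕ.+ n)) ℤ.+ (tail F *ₛ G) (e ℕ.+ n)
    ≡⟨ cong₂ ℤ._+_ (cong (ℤ._* G (suc (e ℕ.+ n))) (F≡0 0 (s≤s z≤n)))
         (*-drop-prefix e (tail F) G n (λ i i<e → F≡0 (suc i) (s≤s i<e))) ⟩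
  0ℤ ℤ.* G (suc (e ℕ.+ n)) ℤ.+ (drop (suc e) F *ₛ G) n ≡⟨ ℤₚ.+-identityˡ _ ⟩
  (drop (suc e) F *ₛ G) n ∎
  where open ≡-Reasoning

-- The parameter is d - 1, so that division by d is always defined.
module Dilation (e : ℕ) where

  d = suc e

  pick : ℕ → ℤ → ℤ
  pick zero    z = z
  pick (suc _) z = 0ℤ

  dil : Series → Series
  dil F n = pick (n % d) (F (n / d))

  sec : ℕ → Series → Series
  sec j F n = F (j ℕ.+ n ℕ.* d)

  -- Lets a coefficientwise claim be checked at j + k d with j < d, where quotient and remainder are
  -- known.
  residues : ∀ {p} (P : ℕ → Set p) → (∀ j k → j < d → P (j ℕ.+ k ℕ.* d)) → ∀ n → P n
  residues P f n = subst P (sym (m≡m%n+[m/n]*n n d)) (f (n % d) (n / d) (m%n<n n d))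

  sec-ext : ∀ {F G} → (∀ j → j < d → sec j F ≈ sec j G) → F ≈ G
  sec-ext {F} {G} eq = residues (λ n → F n ≡ G n) (λ j k j<d → eq j j<d k)

  dil-residue : ∀ F j n → j < d → dil F (j ℕ.+ n ℕ.* d) ≡ pick j (F n)
  dil-residue F j n j<d = cong₂ (λ r s → pick r (F s))
    (trans ([m+kn]%n≡m%n j n d) (m<n⇒m%n≡m j<d))
    (trans (+-distrib-/-∣ʳ j (n∣m*n n)) (cong₂ ℕ._+_ (m<n⇒m/n≡0 j<d) (m*n/n≡m n d)))

  sec-dil : ∀ F → sec 0 (dil F) ≈ F
  sec-dil F n = dil-residue F 0 n (s≤s z≤n)

  dil-drop : ∀ F → drop d (dil F) ≈ dil (tail F)
  dil-drop F = residues (λ n → dil F (d ℕ.+ n) ≡ dil (tail F) n) λ j k j<d → begin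
    dil F (d ℕ.+ (j ℕ.+ k ℕ.* d))   ≡⟨ cong (dil F) (lemma j k) ⟩
    dil F (j ℕ.+ suc k ℕ.* d)       ≡⟨ dil-residue F j (suc k) j<d ⟩
    pick j (F (suc k))              ≡⟨ dil-residue (tail F) j k j<d ⟨
    dil (tail F) (j ℕ.+ k ℕ.* d)    ∎
    where
    open ≡-Reasoning
    lemma : ∀ j k → d ℕ.+ (j ℕ.+ k ℕ.* d) ≡ j ℕ.+ suc k ℕ.* d
    lemma j k = trans (sym (ℕₚ.+-assoc d j _)) (trans (cong (ℕ._+ k ℕ.* d) (ℕₚ.+-comm d j)) (ℕₚ.+-assoc j d _))

  dil-zero : ∀ F i → i < e → dil F (suc i) ≡ 0ℤ
  dil-zero F i i<e = trans (cong (dil F) (sym (ℕₚ.+-identityʳ (suc i)))) (dil-residue F (suc i) 0 (s≤s i<e))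

  -- Only every d-th coefficient of `dil F` is nonzero, so the convolution is unwound one block of d
  -- coefficients at a time. For d = 3 and j = 0 this is the rule U (φ F · G) = F · U G.
  sec-dil-* : ∀ j → j < d → ∀ F G → sec j (dil F *ₛ G) ≈ F *ₛ sec j G
  sec-dil-* j j<d F G zero = begin
    (dil F *ₛ G) (j ℕ.+ 0)
      ≡⟨ *-head (dil F) G (j ℕ.+ 0) (λ i i<j → dil-zero F i
           (ℕₚ.<-≤-trans (subst (i <_) (ℕₚ.+-identityʳ j) i<j) (ℕₚ.≤-pred j<d))) ⟩
    dil F 0 ℤ.* G (j ℕ.+ 0)    ≡⟨ cong (ℤ._* G (j ℕ.+ 0)) (dil-residue F 0 0 (s≤s z≤n)) ⟩
    F 0 ℤ.* sec j G 0          ≡⟨ *-zero F (sec j G) ⟨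
    (F *ₛ sec j G) 0           ∎
    where open ≡-Reasoning
  sec-dil-* j j<d F G (suc n) = begin
    (dil F *ₛ G) (j ℕ.+ suc n ℕ.* d)
      ≡⟨ cong (dil F *ₛ G) index ⟩
    dil F 0 ℤ.* G (suc (e ℕ.+ m)) ℤ.+ (tail (dil F) *ₛ G) (e ℕ.+ m)
      ≡⟨ cong₂ ℤ._+_ (cong₂ ℤ._*_ (dil-residue F 0 0 (s≤s z≤n)) (cong G (sym index)))
           (*-drop-prefix e (tail (dil F)) G m (λ i i<e → dil-zero F i i<e)) ⟩
    F 0 ℤ.* sec j G (suc n) ℤ.+ (drop d (dil F) *ₛ G) m
      ≡⟨ cong (ℤ._+_ (F 0 ℤ.* sec j G (suc n))) (*-congₛ {G = G} (dil-drop F) (λ _ → refl) m) ⟩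
    F 0 ℤ.* sec j G (suc n) ℤ.+ (dil (tail F) *ₛ G) m
      ≡⟨ cong (ℤ._+_ (F 0 ℤ.* sec j G (suc n))) (sec-dil-* j j<d (tail F) G n) ⟩
    (F *ₛ sec j G) (suc n) ∎
    where
    open ≡-Reasoning
    m = j ℕ.+ n ℕ.* d
    index : j ℕ.+ suc n ℕ.* d ≡ d ℕ.+ m
    index = trans (sym (ℕₚ.+-assoc j d _)) (trans (cong (ℕ._+ n ℕ.* d) (ℕₚ.+-comm j d)) (ℕₚ.+-assoc d j _))

  dil-cong : ∀ {F G} → F ≈ G → dil F ≈ dil G
  dil-cong eq n = cong (pick (n % d)) (eq (n / d))

  pick-+ : ∀ j x y → pick j (x ℤ.+ y) ≡ pick j x ℤ.+ pick j y
  pick-+ zero    x y = refl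
  pick-+ (suc j) x y = refl

  dil-+ : ∀ F G → dil (F +ₛ G) ≈ dil F +ₛ dil G
  dil-+ F G n = pick-+ (n % d) (F (n / d)) (G (n / d))

  dil-* : ∀ F G → dil (F *ₛ G) ≈ dil F *ₛ dil G
  dil-* F G = sec-ext λ j j<d n → trans (lemma j j<d n) (sym (sec-dil-* j j<d F (dil G) n))
    where
    lemma : ∀ j → j < d → sec j (dil (F *ₛ G)) ≈ F *ₛ sec j (dil G)
    lemma zero    j<d n = trans (dil-residue (F *ₛ G) 0 n j<d) (*-congₛ {F} (λ _ → refl) (λ m → sym (sec-dil G m)) n)
    lemma (suc j) j<d n = trans (dil-residue (F *ₛ G) (suc j) n j<d)
      (sym (trans (*-congₛ {F} {F} (λ _ → refl) (λ m → dil-residue G (suc j) m j<d) n) (𝕊.zeroʳ F n)))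

  dil-const : ∀ c → dil (const c) ≈ const c
  dil-const c = residues (λ n → dil (const c) n ≡ const c n) λ
    { zero    zero    j<d → refl
    ; zero    (suc k) j<d → dil-residue (const c) 0 (suc k) j<d
    ; (suc j) k       j<d → trans (dil-residue (const c) (suc j) k j<d) refl }

  dil-1 : dil 1ₛ ≈ 1ₛ
  dil-1 n = trans (dil-cong (λ i → sym (const1≈1ₛ i)) n) (trans (dil-const 1ℤ n) (const1≈1ₛ n))

q¹ : Series
q¹ = q^ 1

q¹-* : ∀ F n → (q¹ *ₛ F) (suc n) ≡ F n
q¹-* F n = trans (ℤₚ.+-identityˡ _) (*-identityˡₛ F n)

open ℤ-Solver seriesRing const-ring using (^-congˡ; ^-congʳ; ^-assocʳ; #) renaming (_^_ to _^ᵣ_)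

^≈^ₛ : ∀ F n → F ^ᵣ n ≈ F ^ₛ n
^≈^ₛ F zero    n = refl
^≈^ₛ F (suc k) n = *-congₛ {F} (λ _ → refl) (^≈^ₛ F k) n

q^≈^ᵣ : ∀ i → q^ i ≈ q¹ ^ᵣ i
q^≈^ᵣ zero    n       = refl
q^≈^ᵣ (suc i) zero    = refl
q^≈^ᵣ (suc i) (suc n) = trans (q^≈^ᵣ i n) (sym (q¹-* (q¹ ^ᵣ i) n))

q^-* : ∀ i F n → ((q¹ ^ᵣ i) *ₛ F) (i ℕ.+ n) ≡ F n
q^-* zero    F n = *-identityˡₛ F n
q^-* (suc i) F n = trans (*-assocₛ q¹ (q¹ ^ᵣ i) F (suc (i ℕ.+ n))) (trans (q¹-* ((q¹ ^ᵣ i) *ₛ F) (i ℕ.+ n)) (q^-* i F n))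

q^-*-< : ∀ i F n → n < i → ((q¹ ^ᵣ i) *ₛ F) n ≡ 0ℤ
q^-*-< (suc i) F zero    _         = trans (*-assocₛ q¹ (q¹ ^ᵣ i) F 0) refl
q^-*-< (suc i) F (suc n) (s≤s n<i) = trans (*-assocₛ q¹ (q¹ ^ᵣ i) F (suc n)) (trans (q¹-* ((q¹ ^ᵣ i) *ₛ F) n) (q^-*-< i F n n<i))

dil-q : ∀ e → Dilation.dil e q¹ ≈ q¹ ^ᵣ suc e
dil-q e n with ℕₚ.<-≤-connex n (suc e)
... | inj₁ n<d = trans (below n n<d) (sym (trans (sym (𝕊.*-identityʳ (q¹ ^ᵣ suc e) n)) (q^-*-< (suc e) 1ₛ n n<d)))
  where
  open Dilation e
  below : ∀ n → n < suc e → dil q¹ n ≡ 0ℤ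
  below zero    _         = dil-residue q¹ 0 0 (s≤s z≤n)
  below (suc i) (s≤s i<e) = dil-zero q¹ i i<e
... | inj₂ d≤n = subst (λ n → dil q¹ n ≡ (q¹ ^ᵣ suc e) n) (ℕₚ.m+[n∸m]≡n d≤n)
  (trans (dil-drop q¹ m) (trans (dil-1 m)
    (sym (trans (sym (𝕊.*-identityʳ (q¹ ^ᵣ suc e) (suc e ℕ.+ m))) (q^-* (suc e) 1ₛ m)))))
  where
  open Dilation e
  m = n ∸ suc e

-- The index is chosen so that its successor is (e′ + 1)(e + 1). It serves to show that φ and ψ
-- commute, both composites being q ↦ q²⁴.
dil-dil : ∀ e e′ F → Dilation.dil e (Dilation.dil e′ F) ≈ Dilation.dil (e ℕ.+ e′ ℕ.* suc e) F
dil-dil e e′ F = E.residues (λ n → E.dil (E′.dil F) n ≡ E″.dil F n) λ j k j<d →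
  E′.residues (λ k → E.dil (E′.dil F) (j ℕ.+ k ℕ.* suc e) ≡ E″.dil F (j ℕ.+ k ℕ.* suc e)) (λ i l i<d′ → begin
    E.dil (E′.dil F) (j ℕ.+ (i ℕ.+ l ℕ.* suc e′) ℕ.* suc e)   ≡⟨ E.dil-residue (E′.dil F) j (i ℕ.+ l ℕ.* suc e′) j<d ⟩
    E.pick j (E′.dil F (i ℕ.+ l ℕ.* suc e′))                  ≡⟨ cong (E.pick j) (E′.dil-residue F i l i<d′) ⟩
    E.pick j (E′.pick i (F l))                                ≡⟨ pick-pick j i (F l) ⟩
    E″.pick (j ℕ.+ i ℕ.* suc e) (F l)                         ≡⟨ E″.dil-residue F (j ℕ.+ i ℕ.* suc e) l (bound j<d i<d′) ⟨
    E″.dil F (j ℕ.+ i ℕ.* suc e ℕ.+ l ℕ.* (suc e′ ℕ.* suc e)) ≡⟨ cong (E″.dil F) (index j i l) ⟨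
    E″.dil F (j ℕ.+ (i ℕ.+ l ℕ.* suc e′) ℕ.* suc e)           ∎) k
  where
  open ≡-Reasoning
  module E = Dilation e
  module E′ = Dilation e′
  module E″ = Dilation (e ℕ.+ e′ ℕ.* suc e)
  pick-pick : ∀ j i z → E.pick j (E′.pick i z) ≡ E″.pick (j ℕ.+ i ℕ.* suc e) z
  pick-pick zero    zero    z = refl
  pick-pick zero    (suc i) z = refl
  pick-pick (suc j) i       z = refl
  index : ∀ j i l → j ℕ.+ (i ℕ.+ l ℕ.* suc e′) ℕ.* suc e ≡ j ℕ.+ i ℕ.* suc e ℕ.+ l ℕ.* (suc e′ ℕ.* suc e)
  index j i l = trans (cong (j ℕ.+_) (trans (ℕₚ.*-distribʳ-+ (suc e) i (l ℕ.* suc e′)) (cong (i ℕ.* suc e ℕ.+_) (ℕₚ.*-assoc l (suc e′) (suc e)))))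
    (sym (ℕₚ.+-assoc j (i ℕ.* suc e) _))
  bound : ∀ {j i} → j < suc e → i < suc e′ → j ℕ.+ i ℕ.* suc e < suc e′ ℕ.* suc e
  bound {j} {i} j<d i<d′ = ℕₚ.<-≤-trans (ℕₚ.+-monoˡ-< (i ℕ.* suc e) j<d) (ℕₚ.*-monoˡ-≤ (suc e) i<d′)

-- Congruences of series modulo q^K

infix 4 _≈[_]_

_≈[_]_ : Series → ℕ → Series → Set
F ≈[ K ] G = ∀ n → n < K → F n ≡ G n

module _ {K : ℕ} where

  ≈[]-trans : ∀ {F G H} → F ≈[ K ] G → G ≈[ K ] H → F ≈[ K ] H
  ≈[]-trans p q n n<K = trans (p n n<K) (q n n<K)

  ≈[]-sym : ∀ {F G} → F ≈[ K ] G → G ≈[ K ] F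
  ≈[]-sym p n n<K = sym (p n n<K)

  ≈⇒≈[] : ∀ {F G} → F ≈ G → F ≈[ K ] G
  ≈⇒≈[] p n _ = p n

  ≈[]-+ : ∀ {F F′ G G′} → F ≈[ K ] F′ → G ≈[ K ] G′ → F +ₛ G ≈[ K ] F′ +ₛ G′
  ≈[]-+ p q n n<K = cong₂ ℤ._+_ (p n n<K) (q n n<K)

  ≈[]-* : ∀ {F F′ G G′} → F ≈[ K ] F′ → G ≈[ K ] G′ → F *ₛ G ≈[ K ] F′ *ₛ G′
  ≈[]-* p q n n<K = *-cong-≤ n (λ i i≤n → p i (ℕₚ.≤-<-trans i≤n n<K)) (λ i i≤n → q i (ℕₚ.≤-<-trans i≤n n<K))

  ≈[]-^ᵣ : ∀ {F F′} k → F ≈[ K ] F′ → F ^ᵣ k ≈[ K ] F′ ^ᵣ k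
  ≈[]-^ᵣ zero    p n n<K = refl
  ≈[]-^ᵣ {F} {F′} (suc k) p = ≈[]-* {F} {F′} p (≈[]-^ᵣ k p)

  ≈[]-refl : ∀ {F} → F ≈[ K ] F
  ≈[]-refl n _ = refl

≈[]-≤ : ∀ {F G K L} → L ≤ K → F ≈[ K ] G → F ≈[ L ] G
≈[]-≤ L≤K p n n<L = p n (ℕₚ.<-≤-trans n<L L≤K)

-- When P 0 = 1, P F is F plus q times the product of `tail P` and F. Hence each coefficient of F is
-- determined by that of P F and by the earlier coefficients of F.
unit-cancelˡ : ∀ P {F G} K → P 0 ≡ 1ℤ → P *ₛ F ≈[ K ] P *ₛ G → F ≈[ K ] G
unit-cancelˡ P {F} {G} K P0 PF≈PG = go
  where
  open ≡-Reasoning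
  split : ∀ F n → (P *ₛ F) n ≡ F n ℤ.+ (q¹ *ₛ (tail P *ₛ F)) n
  split F zero    = trans (*-zero P F) (trans (cong (ℤ._* F 0) P0) (trans (ℤₚ.*-identityˡ (F 0)) (sym (ℤₚ.+-identityʳ (F 0)))))
  split F (suc n) = cong₂ ℤ._+_ (trans (cong (ℤ._* F (suc n)) P0) (ℤₚ.*-identityˡ (F (suc n)))) (sym (q¹-* (tail P *ₛ F) n))
  below : ∀ n → (∀ i → i < n → F i ≡ G i) → (q¹ *ₛ (tail P *ₛ F)) n ≡ (q¹ *ₛ (tail P *ₛ G)) n
  below zero    _  = refl
  below (suc n) eq = trans (q¹-* (tail P *ₛ F) n) (trans (*-cong-≤ {tail P} {tail P} {F} {G} n (λ _ _ → refl) (λ i i≤n → eq i (s≤s i≤n))) (sym (q¹-* (tail P *ₛ G) n)))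
  step : ∀ n → n < K → (∀ i → i < n → F i ≡ G i) → F n ≡ G n
  step n n<K eq = ℤ-cancelʳ _ _ _ (begin
    F n ℤ.+ (q¹ *ₛ (tail P *ₛ F)) n   ≡⟨ split F n ⟨
    (P *ₛ F) n                        ≡⟨ PF≈PG n n<K ⟩
    (P *ₛ G) n                        ≡⟨ split G n ⟩
    G n ℤ.+ (q¹ *ₛ (tail P *ₛ G)) n   ≡⟨ cong (ℤ._+_ (G n)) (below n eq) ⟨
    G n ℤ.+ (q¹ *ₛ (tail P *ₛ F)) n   ∎)
  upto : ∀ N → N ≤ K → ∀ i → i < N → F i ≡ G i
  upto (suc N) N<K i (s≤s i≤N) with ℕₚ.m≤n⇒m<n∨m≡n i≤N
  ... | inj₁ i<N = upto N (ℕₚ.<⇒≤ N<K) i i<N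
  ... | inj₂ refl = step N N<K (upto N (ℕₚ.<⇒≤ N<K))
  go : F ≈[ K ] G
  go = upto K ℕₚ.≤-refl

-- Jacobi's identity in the limit

open Jacobi seriesRing const-ring q¹

q^-< : ∀ i n → n < i → (q^ i) n ≡ 0ℤ
q^-< (suc i) zero    _         = refl
q^-< (suc i) (suc n) (s≤s n<i) = q^-< i n n<i

1-q^-≈[] : ∀ i → 1-q^ i ≈[ i ] 1ₛ
1-q^-≈[] i n n<i = trans (cong (λ z → 1ₛ n ℤ.+ ℤ.- z) (trans (sym (q^≈^ᵣ i n)) (q^-< i n n<i))) (ℤₚ.+-identityʳ (1ₛ n))

poch-stable : ∀ m l → poch (l ℕ.+ m) ≈[ suc m ] poch m
poch-stable m zero    n _   = refl
poch-stable m (suc l) n n<m = trans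
  (≈[]-* {suc m} {poch (l ℕ.+ m)} {poch m} {1-q^ (suc l ℕ.+ m)} {1ₛ} (poch-stable m l)
    (≈[]-≤ (s≤s (ℕₚ.m≤n+m m l)) (1-q^-≈[] (suc l ℕ.+ m))) n n<m)
  (𝕊.*-identityʳ (poch m) n)

poch-≈[] : ∀ {m n} → m ≤ n → poch n ≈[ suc m ] poch m
poch-≈[] {m} {n} m≤n = subst (λ k → poch k ≈[ suc m ] poch m) (ℕₚ.m∸n+n≡m m≤n) (poch-stable m (n ∸ m))

poch-0 : ∀ n → poch n 0 ≡ 1ℤ
poch-0 n = poch-≈[] {0} {n} z≤n 0 (s≤s z≤n)

-- ∏ (1 - q^i)³, read off from its partial products.
f : Series
f n = (poch n ^ᵣ 3) n

f-poch : ∀ m → f ≈[ suc m ] poch m ^ᵣ 3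
f-poch m n (s≤s n≤m) = sym (≈[]-^ᵣ 3 (poch-≈[] n≤m) n (ℕₚ.n<1+n n))

q^-*-cong : ∀ i {K F G} → F ≈[ K ] G → (q¹ ^ᵣ i) *ₛ F ≈[ i ℕ.+ K ] (q¹ ^ᵣ i) *ₛ G
q^-*-cong i {K} {F} {G} F≈G n n<iK with ℕₚ.<-≤-connex n i
... | inj₁ n<i = trans (q^-*-< i F n n<i) (sym (q^-*-< i G n n<i))
... | inj₂ i≤n = subst (λ n → (q¹ ^ᵣ i *ₛ F) n ≡ (q¹ ^ᵣ i *ₛ G) n) (ℕₚ.m+[n∸m]≡n i≤n)
  (trans (q^-* i F (n ∸ i)) (trans (F≈G (n ∸ i) (ℕₚ.+-cancelˡ-< i _ _ (subst (ℕ._< i ℕ.+ K) (sym (ℕₚ.m+[n∸m]≡n i≤n)) n<iK)))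
    (sym (q^-* i G (n ∸ i)))))

-- Out of q^(i(i+1)/2) just q^i is extracted, which matches the loss of precision in `θ-gauss`.
θ-shift : ∀ i → ∃ λ Y → θ i ≈ (q¹ ^ᵣ i) *ₛ Y
θ-shift zero    = θ 0 , λ n → sym (*-identityˡₛ (θ 0) n)
θ-shift (suc i) = b *ₛ q^△ i , λ n → trans (sym (𝕊.*-assoc b (q^△ i) (q¹ ^ᵣ suc i) n)) (𝕊.*-comm (b *ₛ q^△ i) (q¹ ^ᵣ suc i) n)
  where b = # (ε (suc i)) *ₛ (# (+ 2) *ₛ # (+ suc i) +ₛ # (+ 1))

-- `gauss-product` with truncated factors shows that the multiplier W is 1 modulo q^(m-i+1). The
-- factor q^i contained in θ i raises this precision to q^(m+1).
θ-gauss : ∀ m i → i ≤ m → θ i *ₛ (gauss m i *ₛ poch (suc (m ℕ.+ m))) ≈[ suc m ] θ i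
θ-gauss m i i≤m = ≈[]-trans {F = θ i *ₛ W} {(q¹ ^ᵣ i) *ₛ Y *ₛ W} {θ i} (≈⇒≈[] (*-congₛ {θ i} {_} {W} (proj₂ (θ-shift i)) (λ _ → refl)))
  (≈[]-trans {F = (q¹ ^ᵣ i) *ₛ Y *ₛ W} {(q¹ ^ᵣ i) *ₛ (Y *ₛ W)} {θ i} (≈⇒≈[] (𝕊.*-assoc (q¹ ^ᵣ i) Y W))
  (≈[]-trans {F = (q¹ ^ᵣ i) *ₛ (Y *ₛ W)} {(q¹ ^ᵣ i) *ₛ (Y *ₛ 1ₛ)} {θ i}
    (subst (λ K → (q¹ ^ᵣ i) *ₛ (Y *ₛ W) ≈[ K ] (q¹ ^ᵣ i) *ₛ (Y *ₛ 1ₛ)) K≡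
      (q^-*-cong i {F = Y *ₛ W} {Y *ₛ 1ₛ} (≈[]-* {F = Y} {Y} {W} {1ₛ} ≈[]-refl W≈1)))
  (≈⇒≈[] (λ n → trans (*-congₛ {q¹ ^ᵣ i} {_} {Y *ₛ 1ₛ} (λ _ → refl) (𝕊.*-identityʳ Y) n) (sym (proj₂ (θ-shift i) n))))))
  where
  Y = proj₁ (θ-shift i)
  P = poch (suc (m ℕ.+ m))
  W = gauss m i *ₛ P
  s = m ∸ i
  K≡ : i ℕ.+ suc s ≡ suc m
  K≡ = trans (ℕₚ.+-suc i s) (cong suc (ℕₚ.m+[n∸m]≡n i≤m))
  W≈1 : W ≈[ suc s ] 1ₛ
  W≈1 = unit-cancelˡ P {W} {1ₛ} (suc s) (poch-0 (suc (m ℕ.+ m)))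
    (≈[]-trans {F = P *ₛ W} {gauss m i *ₛ P *ₛ P} {P *ₛ 1ₛ} (≈⇒≈[] (𝕊.*-comm P W))
    (≈[]-trans {F = gauss m i *ₛ P *ₛ P} {gauss m i *ₛ poch s *ₛ poch (suc (m ℕ.+ i))} {P *ₛ 1ₛ}
      (≈[]-* {F = gauss m i *ₛ P} {gauss m i *ₛ poch s} {P} {poch (suc (m ℕ.+ i))}
        (≈[]-* {F = gauss m i} {gauss m i} {P} {poch s} ≈[]-refl (poch-≈[] (ℕₚ.≤-trans (ℕₚ.m∸n≤m m i) (ℕₚ.m≤n⇒m≤1+n (ℕₚ.m≤m+n m m)))))
        (≈[]-≤ (s≤s (ℕₚ.≤-trans (ℕₚ.m∸n≤m m i) (ℕₚ.m≤n⇒m≤1+n (ℕₚ.m≤m+n m i)))) (poch-≈[] (s≤s (ℕₚ.+-monoʳ-≤ m i≤m)))))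
    (≈⇒≈[] (λ n → trans (gauss-product m s i (ℕₚ.m∸n+n≡m i≤m) n) (sym (𝕊.*-identityʳ P n))))))

∑θ-gauss-≈[] : ∀ m N → N ≤ suc m → ∑θ N (gauss m) *ₛ poch (suc (m ℕ.+ m)) ≈[ suc m ] ∑θ₁ N
∑θ-gauss-≈[] m zero    _         = ≈⇒≈[] (*-zeroˡₛ (poch (suc (m ℕ.+ m))))
∑θ-gauss-≈[] m (suc N) (s≤s N≤m) = ≈[]-trans
  {F = (∑θ N (gauss m) +ₛ θ N *ₛ gauss m N) *ₛ P} {∑θ N (gauss m) *ₛ P +ₛ θ N *ₛ (gauss m N *ₛ P)} {∑θ₁ N +ₛ θ N}
  (≈⇒≈[] (λ n → trans (𝕊.distribʳ P (∑θ N (gauss m)) (θ N *ₛ gauss m N) n)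
    (cong (ℤ._+_ ((∑θ N (gauss m) *ₛ P) n)) (𝕊.*-assoc (θ N) (gauss m N) P n))))
  (≈[]-+ {F = ∑θ N (gauss m) *ₛ P} {∑θ₁ N} {θ N *ₛ (gauss m N *ₛ P)} {θ N} (∑θ-gauss-≈[] m N (ℕₚ.m≤n⇒m≤1+n N≤m)) (θ-gauss m N N≤m))
  where P = poch (suc (m ℕ.+ m))

-- Modulo q^(m+1), f is `poch m ^ᵣ 2` times `poch (suc (m + m))`. The square is the finite sum of
-- `∑θ-gauss`, and the remaining factor turns every Gaussian binomial in it into 1.
jacobi : ∀ m → f ≈[ suc m ] ∑θ₁ (suc m)
jacobi m = ≈[]-trans {F = f} {poch m ^ᵣ 3} {∑θ₁ (suc m)} (f-poch m)
  (≈[]-trans {F = poch m ^ᵣ 3} {∑θ (suc m) (gauss m) *ₛ P} {∑θ₁ (suc m)}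
    (≈[]-sym {F = ∑θ (suc m) (gauss m) *ₛ P} {poch m ^ᵣ 3}
      (≈[]-trans {F = ∑θ (suc m) (gauss m) *ₛ P} {poch m ^ᵣ 2 *ₛ poch m} {poch m ^ᵣ 3}
        (≈[]-* {F = ∑θ (suc m) (gauss m)} {poch m ^ᵣ 2} {P} {poch m} (≈⇒≈[] (∑θ-gauss m m ℕₚ.≤-refl))
          (poch-≈[] (ℕₚ.m≤n⇒m≤1+n (ℕₚ.m≤m+n m m))))
        (≈⇒≈[] (𝕊.*-comm (poch m ^ᵣ 2) (poch m)))))
    (∑θ-gauss-≈[] m (suc m) ℕₚ.≤-refl))
  where P = poch (suc (m ℕ.+ m))

-- Dissection and norm of ∏ (1 - q^n)³

module D₃ = Dilation 2
module D₈ = Dilation 7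

open D₃ using (sec; sec-dil-*; dil-residue) renaming (dil to φ)
open D₈ using () renaming (dil to ψ)

dilation : ℕ → Endomorphism seriesRing const-ring
dilation e = record { φ = dil ; φ-cong = dil-cong ; φ-+ = dil-+ ; φ-* = dil-* ; φ-# = dil-const }
  where open Dilation e

open Endomorphism (dilation 2) using (φ-0)

φ-q : φ q¹ ≈ q¹ ^ᵣ 3
φ-q = dil-q 2

ψ-q : ψ q¹ ≈ q¹ ^ᵣ 8
ψ-q = dil-q 7

ψφ : ∀ F → ψ (φ F) ≈ φ (ψ F)
ψφ F n = trans (dil-dil 7 2 F n) (sym (dil-dil 2 7 F n))

sec-cong : ∀ j {F G} → F ≈ G → sec j F ≈ sec j G
sec-cong j F≈G n = F≈G (j ℕ.+ n ℕ.* 3)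

-- G is the section of the monomial, which in the uses below is 1 for i = j and 0 otherwise.
sec-q^ : ∀ j i B {G} → j < 3 → sec j (q^ i) ≈ G → sec j (q¹ ^ᵣ i *ₛ φ B) ≈ B *ₛ G
sec-q^ j i B {G} j<3 eq n = begin
  (q¹ ^ᵣ i *ₛ φ B) (j ℕ.+ n ℕ.* 3)   ≡⟨ 𝕊.*-comm (q¹ ^ᵣ i) (φ B) (j ℕ.+ n ℕ.* 3) ⟩
  sec j (φ B *ₛ q¹ ^ᵣ i) n           ≡⟨ sec-dil-* j j<3 B (q¹ ^ᵣ i) n ⟩
  (B *ₛ sec j (q¹ ^ᵣ i)) n           ≡⟨ *-congₛ {B} {B} {sec j (q¹ ^ᵣ i)} {G} (λ _ → refl) (λ m → trans (sym (q^≈^ᵣ i (j ℕ.+ m ℕ.* 3))) (eq m)) n ⟩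
  (B *ₛ G) n                        ∎
  where open ≡-Reasoning

-- A dissection determines its components, so that dissections obtained in different ways can be
-- compared.
module _ {F A B C : Series} (F≈ : F ≈ φ A +ₛ q¹ *ₛ φ B +ₛ q¹ ^ᵣ 2 *ₛ φ C) where

  private
    split : ∀ j n {x y z} → φ A (j ℕ.+ n ℕ.* 3) ≡ x → sec j (q¹ ^ᵣ 1 *ₛ φ B) n ≡ y → sec j (q¹ ^ᵣ 2 *ₛ φ C) n ≡ z →
      sec j F n ≡ x ℤ.+ y ℤ.+ z
    split j n refl refl refl = trans (F≈ (j ℕ.+ n ℕ.* 3)) (cong (λ w → φ A (j ℕ.+ n ℕ.* 3) ℤ.+ w ℤ.+ (q¹ ^ᵣ 2 *ₛ φ C) (j ℕ.+ n ℕ.* 3))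
      (*-congₛ {q¹} {q¹ ^ᵣ 1} {φ B} (λ i → sym (𝕊.*-identityʳ q¹ i)) (λ _ → refl) (j ℕ.+ n ℕ.* 3)))

  sec₀ : sec 0 F ≈ A
  sec₀ n = trans (split 0 n (dil-residue A 0 n (s≤s z≤n))
    (trans (sec-q^ 0 1 B {0ₛ} (s≤s z≤n) (λ { zero → refl ; (suc _) → refl }) n) (𝕊.zeroʳ B n))
    (trans (sec-q^ 0 2 C {0ₛ} (s≤s z≤n) (λ { zero → refl ; (suc _) → refl }) n) (𝕊.zeroʳ C n)))
    (trans (ℤₚ.+-identityʳ (A n ℤ.+ 0ℤ)) (ℤₚ.+-identityʳ (A n)))

  sec₁ : sec 1 F ≈ B
  sec₁ n = trans (split 1 n (dil-residue A 1 n (s≤s (s≤s z≤n)))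
    (trans (sec-q^ 1 1 B {1ₛ} (s≤s (s≤s z≤n)) (λ { zero → refl ; (suc _) → refl }) n) (𝕊.*-identityʳ B n))
    (trans (sec-q^ 1 2 C {0ₛ} (s≤s (s≤s z≤n)) (λ { zero → refl ; (suc _) → refl }) n) (𝕊.zeroʳ C n)))
    (trans (ℤₚ.+-identityʳ (0ℤ ℤ.+ B n)) (ℤₚ.+-identityˡ (B n)))

  sec₂ : sec 2 F ≈ C
  sec₂ n = trans (split 2 n (dil-residue A 2 n (s≤s (s≤s (s≤s z≤n))))
    (trans (sec-q^ 2 1 B {0ₛ} (s≤s (s≤s (s≤s z≤n))) (λ { zero → refl ; (suc _) → refl }) n) (𝕊.zeroʳ B n))
    (trans (sec-q^ 2 2 C {1ₛ} (s≤s (s≤s (s≤s z≤n))) (λ { zero → refl ; (suc _) → refl }) n) (𝕊.*-identityʳ C n)))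
    (ℤₚ.+-identityˡ (C n))

φ-≈[] : ∀ {K F G} → F ≈[ K ] G → φ F ≈[ K ] φ G
φ-≈[] F≈G n n<K = cong (D₃.pick (n % 3)) (F≈G (n / 3) (ℕₚ.≤-<-trans (m/n≤m n 3) n<K))

sec-≈[] : ∀ j {K F G} → j < 3 → F ≈[ K ℕ.* 3 ] G → sec j F ≈[ K ] sec j G
sec-≈[] j {K} j<3 F≈G n n<K = F≈G (j ℕ.+ n ℕ.* 3) (ℕₚ.<-≤-trans (ℕₚ.+-monoˡ-< (n ℕ.* 3) j<3) (ℕₚ.*-monoˡ-≤ 3 n<K))

open NormForm seriesRing const-ring q¹ (dilation 2) φ-q

f-jacobi : ∀ N → f ≈[ N ] ∑θ₁ N
f-jacobi zero    n ()
f-jacobi (suc N) = jacobi N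

∑θ₁-split : ∀ m → let Y = proj₁ (∑θ₁-*3 m) in
  ∑θ₁ (m ℕ.* 3) ≈ φ Y +ₛ q¹ *ₛ φ (# (ℤ.- + 3) *ₛ φ (∑θ₁ m)) +ₛ q¹ ^ᵣ 2 *ₛ φ 0ₛ
∑θ₁-split m n = trans (proj₂ (∑θ₁-*3 m) n) (sym (trans (cong (ℤ._+_ (G n))
  (trans (*-congₛ {q¹ ^ᵣ 2} {q¹ ^ᵣ 2} {φ 0ₛ} {0ₛ} (λ _ → refl) φ-0 n) (𝕊.zeroʳ (q¹ ^ᵣ 2) n))) (ℤₚ.+-identityʳ (G n))))
  where
  G = φ (proj₁ (∑θ₁-*3 m)) +ₛ q¹ *ₛ φ (# (ℤ.- + 3) *ₛ φ (∑θ₁ m))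

-- Coefficient n of a section mod 3 is already determined modulo q^(3(n+1)), so N = n + 1 suffices.
sec-limit : ∀ j → j < 3 → (F : Series) (G H : ℕ → Series) {L : Series} →
  (∀ N → F ≈[ N ℕ.* 3 ] G (N ℕ.* 3)) → (∀ N → sec j (G (N ℕ.* 3)) ≈ H N) → (∀ N → L ≈[ N ] H N) → sec j F ≈ L
sec-limit j j<3 F G H {L} F≈G G≈H L≈H n =
  trans (sec-≈[] j {suc n} {F} {G (suc n ℕ.* 3)} j<3 (F≈G (suc n)) n (ℕₚ.n<1+n n))
    (trans (G≈H (suc n) n) (sym (L≈H (suc n) n (ℕₚ.n<1+n n))))

sec₁-f : sec 1 f ≈ # (ℤ.- + 3) *ₛ φ f
sec₁-f = sec-limit 1 (s≤s (s≤s z≤n)) f ∑θ₁ (λ N → # (ℤ.- + 3) *ₛ φ (∑θ₁ N)) (λ N → f-jacobi (N ℕ.* 3))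
  (λ N → sec₁ {∑θ₁ (N ℕ.* 3)} {proj₁ (∑θ₁-*3 N)} {# (ℤ.- + 3) *ₛ φ (∑θ₁ N)} {0ₛ} (∑θ₁-split N))
  (λ N → ≈[]-* {F = # (ℤ.- + 3)} {# (ℤ.- + 3)} {φ f} {φ (∑θ₁ N)} ≈[]-refl (φ-≈[] {N} {f} {∑θ₁ N} (f-jacobi N)))

sec₂-f : sec 2 f ≈ 0ₛ
sec₂-f = sec-limit 2 (s≤s (s≤s (s≤s z≤n))) f ∑θ₁ (λ N → 0ₛ) (λ N → f-jacobi (N ℕ.* 3))
  (λ N → sec₂ {∑θ₁ (N ℕ.* 3)} {proj₁ (∑θ₁-*3 N)} {# (ℤ.- + 3) *ₛ φ (∑θ₁ N)} {0ₛ} (∑θ₁-split N))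
  (λ N → ≈[]-refl)

P : Series
P = sec 0 f

f-split : f ≈ φ P +ₛ q¹ *ₛ φ (# (ℤ.- + 3) *ₛ φ f)
f-split = D₃.sec-ext λ
  { 0 _ n → sym (trans (split₀ n) refl) ; 1 _ n → trans (sec₁-f n) (sym (split₁ n)) ; 2 _ n → trans (sec₂-f n) (sym (split₂ n))
  ; (suc (suc (suc j))) (s≤s (s≤s (s≤s ()))) _ }
  where
  B = # (ℤ.- + 3) *ₛ φ f
  G = φ P +ₛ q¹ *ₛ φ B
  G≈ : G ≈ φ P +ₛ q¹ *ₛ φ B +ₛ q¹ ^ᵣ 2 *ₛ φ 0ₛ
  G≈ n = sym (trans (cong (ℤ._+_ (G n))
    (trans (*-congₛ {q¹ ^ᵣ 2} {q¹ ^ᵣ 2} {φ 0ₛ} {0ₛ} (λ _ → refl) φ-0 n) (𝕊.zeroʳ (q¹ ^ᵣ 2) n))) (ℤₚ.+-identityʳ (G n)))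
  split₀ = sec₀ {G} {P} {B} {0ₛ} G≈
  split₁ = sec₁ {G} {P} {B} {0ₛ} G≈
  split₂ = sec₂ {G} {P} {B} {0ₛ} G≈

norm-≈[] : ∀ {K A A′ B B′ C C′} → A ≈[ K ] A′ → B ≈[ K ] B′ → C ≈[ K ] C′ → norm A B C ≈[ K ] norm A′ B′ C′
norm-≈[] {K} {A} {A′} {B} {B′} {C} {C′} a b c =
  ≈[]-+ {F = A ^ᵣ 3 +ₛ q¹ *ₛ B ^ᵣ 3 +ₛ q¹ ^ᵣ 2 *ₛ C ^ᵣ 3} {A′ ^ᵣ 3 +ₛ q¹ *ₛ B′ ^ᵣ 3 +ₛ q¹ ^ᵣ 2 *ₛ C′ ^ᵣ 3}
    (≈[]-+ {F = A ^ᵣ 3 +ₛ q¹ *ₛ B ^ᵣ 3} {A′ ^ᵣ 3 +ₛ q¹ *ₛ B′ ^ᵣ 3}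
      (≈[]-+ {F = A ^ᵣ 3} {A′ ^ᵣ 3} (≈[]-^ᵣ {F = A} {A′} 3 a) (≈[]-* {F = q¹} {q¹} {B ^ᵣ 3} {B′ ^ᵣ 3} ≈[]-refl (≈[]-^ᵣ {F = B} {B′} 3 b)))
      (≈[]-* {F = q¹ ^ᵣ 2} {q¹ ^ᵣ 2} {C ^ᵣ 3} {C′ ^ᵣ 3} ≈[]-refl (≈[]-^ᵣ {F = C} {C′} 3 c)))
    (≈[]-* {F = # (ℤ.- + 3)} {# (ℤ.- + 3)} {q¹ *ₛ (A *ₛ (B *ₛ C))} {q¹ *ₛ (A′ *ₛ (B′ *ₛ C′))} ≈[]-refl
      (≈[]-* {F = q¹} {q¹} {A *ₛ (B *ₛ C)} {A′ *ₛ (B′ *ₛ C′)} ≈[]-refl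
        (≈[]-* {F = A} {A′} {B *ₛ C} {B′ *ₛ C′} a (≈[]-* {F = B} {B′} {C} {C′} b c))))

-- f agrees with `poch (m * 3) ^ᵣ 3` modulo q^(3m), so their three sections agree modulo q^m. These
-- sections are the components entering the norm, and the value known for the partial product
-- carries over.
norm-f-≈[] : ∀ m → (∃ λ M → HasNorm (poch (m ℕ.* 3) ^ᵣ 3) M × M *ₛ φ (poch m ^ᵣ 3) ≈ poch (m ℕ.* 3) ^ᵣ 3 *ₛ (poch m ^ᵣ 3) ^ᵣ 3) →
  norm P (# (ℤ.- + 3) *ₛ φ f) 0ₛ *ₛ φ f ≈[ m ] f *ₛ f ^ᵣ 3
norm-f-≈[] m (M , has-norm {A} {B} {C} s N≈M , M≈) =
  ≈[]-trans {F = N *ₛ φ f} {M *ₛ φ (poch m ^ᵣ 3)} {f *ₛ f ^ᵣ 3}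
    (≈[]-* {F = N} {M} {φ f} {φ (poch m ^ᵣ 3)}
      (≈[]-trans {F = N} {norm A B C} {M}
        (norm-≈[] {A = P} {A} {# (ℤ.- + 3) *ₛ φ f} {B} {0ₛ} {C}
          (≈[]-trans {F = P} {sec 0 F} {A} (f≈ 0 (s≤s z≤n)) (≈⇒≈[] (sec₀ {F} {A} {B} {C} s)))
          (≈[]-trans {F = # (ℤ.- + 3) *ₛ φ f} {sec 1 f} {B} (≈[]-sym {F = sec 1 f} {# (ℤ.- + 3) *ₛ φ f} (≈⇒≈[] sec₁-f))
            (≈[]-trans {F = sec 1 f} {sec 1 F} {B} (f≈ 1 (s≤s (s≤s z≤n))) (≈⇒≈[] (sec₁ {F} {A} {B} {C} s))))
          (≈[]-trans {F = 0ₛ} {sec 2 f} {C} (≈[]-sym {F = sec 2 f} {0ₛ} (≈⇒≈[] sec₂-f))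
            (≈[]-trans {F = sec 2 f} {sec 2 F} {C} (f≈ 2 (s≤s (s≤s (s≤s z≤n)))) (≈⇒≈[] (sec₂ {F} {A} {B} {C} s)))))
        (≈⇒≈[] N≈M))
      (φ-≈[] {m} {f} {poch m ^ᵣ 3} fm))
    (≈[]-trans {F = M *ₛ φ (poch m ^ᵣ 3)} {F *ₛ (poch m ^ᵣ 3) ^ᵣ 3} {f *ₛ f ^ᵣ 3} (≈⇒≈[] M≈)
      (≈[]-sym {F = f *ₛ f ^ᵣ 3} {F *ₛ (poch m ^ᵣ 3) ^ᵣ 3}
        (≈[]-* {F = f} {F} {f ^ᵣ 3} {(poch m ^ᵣ 3) ^ᵣ 3} f3m (≈[]-^ᵣ {F = f} {poch m ^ᵣ 3} 3 fm))))
  where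
  N = norm P (# (ℤ.- + 3) *ₛ φ f) 0ₛ
  F = poch (m ℕ.* 3) ^ᵣ 3
  fm : f ≈[ m ] poch m ^ᵣ 3
  fm = ≈[]-≤ {f} {poch m ^ᵣ 3} (ℕₚ.n≤1+n m) (f-poch m)
  f≈3m : f ≈[ m ℕ.* 3 ] F
  f≈3m = ≈[]-≤ {f} {F} (ℕₚ.n≤1+n (m ℕ.* 3)) (f-poch (m ℕ.* 3))
  f3m : f ≈[ m ] F
  f3m = ≈[]-≤ {f} {F} (ℕₚ.m≤m*n m 3) f≈3m
  f≈ : ∀ j → j < 3 → sec j f ≈[ m ] sec j F
  f≈ j j<3 = sec-≈[] j {m} {f} {F} j<3 f≈3m

≈[]⇒≈ : ∀ {F G} → (∀ m → F ≈[ m ] G) → F ≈ G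
≈[]⇒≈ F≈G n = F≈G (suc n) n (ℕₚ.n<1+n n)

norm-f : norm P (# (ℤ.- + 3) *ₛ φ f) 0ₛ *ₛ φ f ≈ f *ₛ f ^ᵣ 3
norm-f = ≈[]⇒≈ {norm P (# (ℤ.- + 3) *ₛ φ f) 0ₛ *ₛ φ f} {f *ₛ f ^ᵣ 3} (λ m → norm-f-≈[] m (HasNorm-poch³ m))

f-quartic : P ^ᵣ 3 *ₛ φ f ≈ f ^ᵣ 4 +ₛ # (+ 27) *ₛ (q¹ *ₛ φ f ^ᵣ 4)
f-quartic = norm-BC P (φ f) f norm-f

-- The series x = q ∏ (1 - q^(8n))³, and the data for each k

module Rescaled = Rescaling seriesRing const-ring q¹ (dilation 2) (dilation 7)
open Rescaled.FromDissection φ-q ψ-q ψφ f P f-split f-quartic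

ψf-0 : ψ f 0 ≡ 1ℤ
ψf-0 = refl

η-cancelˡ : ∀ {F G} → η *ₛ F ≈ η *ₛ G → F ≈ G
η-cancelˡ {F} {G} eq = ≈[]⇒≈ {F} {G} λ m → unit-cancelˡ (ψ f) {F} {G} m ψf-0 λ n _ → begin
  (ψ f *ₛ F) n                  ≡⟨ q¹-* (ψ f *ₛ F) n ⟨
  (q¹ *ₛ (ψ f *ₛ F)) (suc n)    ≡⟨ *-assocₛ q¹ (ψ f) F (suc n) ⟨
  (η *ₛ F) (suc n)              ≡⟨ eq (suc n) ⟩
  (η *ₛ G) (suc n)              ≡⟨ *-assocₛ q¹ (ψ f) G (suc n) ⟩
  (q¹ *ₛ (ψ f *ₛ G)) (suc n)    ≡⟨ q¹-* (ψ f *ₛ G) n ⟩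
  (ψ f *ₛ G) n                  ∎
  where open ≡-Reasoning

sec-π : sec 0 π ≈ 0ₛ
sec-π n = trans (π≈ (n ℕ.* 3))
  (trans (sec-q^ 0 1 (ψ P) {0ₛ} (s≤s z≤n) (λ { zero → refl ; (suc _) → refl }) n) (𝕊.zeroʳ (ψ P) n))

sec-π² : sec 0 (π ^ᵣ 2) ≈ 0ₛ
sec-π² n = trans (π²≈ (n ℕ.* 3))
  (trans (sec-q^ 0 2 (ψ P ^ᵣ 2) {0ₛ} (s≤s z≤n) (λ { zero → refl ; (suc _) → refl }) n) (𝕊.zeroʳ (ψ P ^ᵣ 2) n))

setting : Trisection.Setting seriesRing const-ring
setting = record
  { endo      = dilation 2
  ; U         = sec 0
  ; U-cong    = sec-cong 0
  ; U-+       = λ _ _ _ → refl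
  ; U-φ*      = sec-dil-* 0 (s≤s z≤n)
  ; U-1       = λ { zero → refl ; (suc _) → refl }
  ; x         = η
  ; π         = π
  ; ρ         = ρ
  ; x-split   = η-split
  ; π³        = π³≈
  ; U-π       = sec-π
  ; U-π²      = sec-π²
  ; ρy        = ρφη
  ; x-cancelˡ = λ {F} {G} → η-cancelˡ {F} {G}
  }

module Hecke₃ = Trisection.HeckeOperator seriesRing const-ring setting

-- Only i = ⌊k/3⌋ is needed: at odd arguments the other D k i are multiples of
-- it.  For k ≤ 2 it is the junk value D k 0 = 0.
record Eigen (k : ℕ) : Set where
  field
    recurrence : Hecke₃.Recurrence k (h k) (r k) (C k 1) (D k (k ℕ./ 3) 1)
    C-3        : C k 3 ≡ h k ℤ.* C k 1 ℤ.+ r k ℤ.* + 1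
    C-rec      : ∀ β → C k (4 ℕ.+ β) ≡ h k ℤ.* C k (2 ℕ.+ β) ℤ.+ r k ℤ.* C k β
    D-3        : D k (k ℕ./ 3) 3 ≡ h k ℤ.* D k (k ℕ./ 3) 1 ℤ.+ r k ℤ.* + 0
    D-rec      : ∀ β → D k (k ℕ./ 3) (4 ℕ.+ β) ≡ h k ℤ.* D k (k ℕ./ 3) (2 ℕ.+ β) ℤ.+ r k ℤ.* D k (k ℕ./ 3) β
    D-trivial  : 1 ≤ k ℕ./ 3 ⊎ (∀ β → D k (k ℕ./ 3) β ≡ 0ℤ)

eigen : ∀ k → 1 ≤ k → k ≤ 8 → Eigen k
eigen 1 _ _ = record { recurrence = Hecke₃.recurrence₁ ; C-3 = refl ; C-rec = λ _ → refl ; D-3 = refl ; D-rec = λ _ → refl ; D-trivial = inj₂ λ _ → refl }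
eigen 2 _ _ = record { recurrence = Hecke₃.recurrence₂ ; C-3 = refl ; C-rec = λ _ → refl ; D-3 = refl ; D-rec = λ _ → refl ; D-trivial = inj₂ λ _ → refl }
eigen 3 _ _ = record { recurrence = Hecke₃.recurrence₃ ; C-3 = refl ; C-rec = λ _ → refl ; D-3 = refl ; D-rec = λ _ → refl ; D-trivial = inj₁ (s≤s z≤n) }
eigen 4 _ _ = record { recurrence = Hecke₃.recurrence₄ ; C-3 = refl ; C-rec = λ _ → refl ; D-3 = refl ; D-rec = λ _ → refl ; D-trivial = inj₁ (s≤s z≤n) }
eigen 5 _ _ = record { recurrence = Hecke₃.recurrence₅ ; C-3 = refl ; C-rec = λ _ → refl ; D-3 = refl ; D-rec = λ _ → refl ; D-trivial = inj₁ (s≤s z≤n) }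
eigen 6 _ _ = record { recurrence = Hecke₃.recurrence₆ ; C-3 = refl ; C-rec = λ _ → refl ; D-3 = refl ; D-rec = λ _ → refl ; D-trivial = inj₁ (s≤s z≤n) }
eigen 7 _ _ = record { recurrence = Hecke₃.recurrence₇ ; C-3 = refl ; C-rec = λ _ → refl ; D-3 = refl ; D-rec = λ _ → refl ; D-trivial = inj₁ (s≤s z≤n) }
eigen 8 _ _ = record { recurrence = Hecke₃.recurrence₈ ; C-3 = refl ; C-rec = λ _ → refl ; D-3 = refl ; D-rec = λ _ → refl ; D-trivial = inj₁ (s≤s z≤n) }
eigen (suc (suc (suc (suc (suc (suc (suc (suc (suc k))))))))) _ (s≤s (s≤s (s≤s (s≤s (s≤s (s≤s (s≤s (s≤s ()))))))))

odd : ℕ → ℕ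
odd zero    = 1
odd (suc β) = 2 ℕ.+ odd β

odd≡ : ∀ β → odd β ≡ 2 ℕ.* suc β ∸ 1
odd≡ zero    = refl
odd≡ (suc β) = trans (cong (2 ℕ.+_) (odd≡ β)) (lemma β)
  where
  lemma : ∀ β → 2 ℕ.+ (β ℕ.+ suc (β ℕ.+ 0)) ≡ suc β ℕ.+ suc (suc β ℕ.+ 0)
  lemma = ℕ-Tactic.solve-∀

iterates-index : ∀ k β n → Hecke₃.iterates k β n ≡ (η ^ᵣ k) (3 ℕ.^ odd β ℕ.* n)
iterates-index k zero    n = cong (η ^ᵣ k) (ℕₚ.*-comm n 3)
iterates-index k (suc β) n = trans (iterates-index k β (n ℕ.* 3 ℕ.* 3)) (cong (η ^ᵣ k) (lemma (3 ℕ.^ odd β) n))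
  where
  lemma : ∀ t n → t ℕ.* (n ℕ.* 3 ℕ.* 3) ≡ 3 ℕ.* (3 ℕ.* t) ℕ.* n
  lemma = ℕ-Tactic.solve-∀

η^-residue : ∀ k n → (η ^ᵣ k) (k ℕ.+ n ℕ.* 8) ≡ (f ^ᵣ k) n
η^-residue k n = trans (η^ k (k ℕ.+ n ℕ.* 8))
  (trans (q^-* k (ψ (f ^ᵣ k)) (n ℕ.* 8)) (D₈.dil-residue (f ^ᵣ k) 0 n (s≤s z≤n)))

open import Algebra.Properties.CommutativeSemiring.Exp 𝕊.commutativeSemiring using (^-distrib-*)

∏≈poch^ : ∀ N j → ∏ₛ N (λ i → (1ₛ -ₛ (q^ i)) ^ₛ j) ≈ poch N ^ᵣ j
∏≈poch^ zero    j n = sym (1^ j n)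
  where
  1^ : ∀ j → 1ₛ ^ᵣ j ≈ 1ₛ
  1^ zero    n = refl
  1^ (suc j) n = trans (*-identityˡₛ (1ₛ ^ᵣ j) n) (1^ j n)
∏≈poch^ (suc N) j n = trans (*-congₛ {∏ₛ N (λ i → (1ₛ -ₛ (q^ i)) ^ₛ j)} {poch N ^ᵣ j} {(1ₛ -ₛ (q^ suc N)) ^ₛ j} {1-q^ (suc N) ^ᵣ j}
    (∏≈poch^ N j) (λ i → trans (sym (^≈^ₛ (1ₛ -ₛ (q^ suc N)) j i)) (^-congˡ j {1ₛ -ₛ (q^ suc N)} {1-q^ (suc N)}
      (λ l → cong (λ z → 1ₛ l ℤ.- z) (q^≈^ᵣ (suc N) l)) i)) n)
  (sym (^-distrib-* (poch N) (1-q^ (suc N)) j n))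

p≡f^ : ∀ k n → p (3 ℕ.* k) n ≡ (f ^ᵣ k) n
p≡f^ k n = begin
  p (3 ℕ.* k) n                ≡⟨ ∏≈poch^ n (3 ℕ.* k) n ⟩
  (poch n ^ᵣ (3 ℕ.* k)) n       ≡⟨ ^-assocʳ (poch n) 3 k n ⟨
  ((poch n ^ᵣ 3) ^ᵣ k) n         ≡⟨ ≈[]-^ᵣ {suc n} {f} {poch n ^ᵣ 3} k (f-poch n) n (ℕₚ.n<1+n n) ⟨
  (f ^ᵣ k) n                    ∎
  where open ≡-Reasoning

p≡η^ : ∀ k n → p (3 ℕ.* k) n ≡ (η ^ᵣ k) (k ℕ.+ n ℕ.* 8)
p≡η^ k n = trans (p≡f^ k n) (sym (η^-residue k n))

-- Congruences

open import Data.Nat using (_*_; _^_)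

nine : ∀ s → ∃ λ t → 3 ^ (2 * s) ≡ 1 ℕ.+ t * 8
nine zero    = 0 , refl
nine (suc s) with nine s
... | t , eq = 1 ℕ.+ 9 * t , trans (cong (3 ^_) (ℕₚ.*-suc 2 s)) (trans (cong (λ z → 3 * (3 * z)) eq) (lemma t))
  where
  lemma : ∀ t → 3 * (3 * (1 ℕ.+ t * 8)) ≡ 1 ℕ.+ (1 ℕ.+ 9 * t) * 8
  lemma = ℕ-Tactic.solve-∀

record Congruent (m : ℕ) (x y : ℤ) : Set where
  constructor congruence
  field divides : + m ℤ∣.∣ (x ℤ.- y)

from-mod : ∀ {m} x y → x ≡ y [mod m ] → Congruent m x y
from-mod x y eq = congruence (ℤ∣.∣ᵤ⇒∣ eq)

to-mod : ∀ {m x y} → Congruent m x y → x ≡ y [mod m ]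
to-mod (congruence eq) = ℤ∣.∣⇒∣ᵤ eq

modSetoid : ℕ → Setoid 0ℓ 0ℓ
modSetoid m = record
  { Carrier = ℤ
  ; _≈_ = Congruent m
  ; isEquivalence = record
    { refl  = λ {x} → congruence (ℤ∣.divides 0ℤ (ℤₚ.+-inverseʳ x))
    ; sym   = λ {x} {y} (congruence p) → congruence (subst (+ m ℤ∣.∣_) (sym-lemma x y) (ℤ∣.∣m⇒∣-m p))
    ; trans = λ {x} {y} {z} (congruence p) (congruence q) →
        congruence (subst (+ m ℤ∣.∣_) (trans-lemma x y z) (ℤ∣.∣m∣n⇒∣m+n p q))
    } }
  where
  sym-lemma : ∀ x y → ℤ.- (x ℤ.- y) ≡ y ℤ.- x
  sym-lemma = ℤ-Tactic.solve-∀
  trans-lemma : ∀ x y z → (x ℤ.- y) ℤ.+ (y ℤ.- z) ≡ x ℤ.- z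
  trans-lemma = ℤ-Tactic.solve-∀

mod-+ : ∀ {m x y x′ y′} → Congruent m x y → Congruent m x′ y′ → Congruent m (x ℤ.+ x′) (y ℤ.+ y′)
mod-+ {m} {x} {y} {x′} {y′} (congruence p) (congruence q) =
  congruence (subst (+ m ℤ∣.∣_) (lemma x y x′ y′) (ℤ∣.∣m∣n⇒∣m+n p q))
  where
  lemma : ∀ x y x′ y′ → (x ℤ.- y) ℤ.+ (x′ ℤ.- y′) ≡ (x ℤ.+ x′) ℤ.- (y ℤ.+ y′)
  lemma = ℤ-Tactic.solve-∀

mod-*ˡ : ∀ {m x y} z → Congruent m x y → Congruent m (z ℤ.* x) (z ℤ.* y)
mod-*ˡ {m} {x} {y} z (congruence p) = congruence (subst (+ m ℤ∣.∣_) (lemma x y z) (ℤ∣.∣n⇒∣m*n z p))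
  where
  lemma : ∀ x y z → z ℤ.* (x ℤ.- y) ≡ z ℤ.* x ℤ.- z ℤ.* y
  lemma = ℤ-Tactic.solve-∀

mod-*ʳ : ∀ {m x y} z → Congruent m x y → Congruent m (x ℤ.* z) (y ℤ.* z)
mod-*ʳ {m} {x} {y} z p = subst₂ (Congruent m) (ℤₚ.*-comm z x) (ℤₚ.*-comm z y) (mod-*ˡ z p)

D-vanishes : ∀ {m k b} → Eigen k → DVanish m k (suc b) → Congruent m (D k (k ℕ./ 3) (odd b)) 0ℤ
D-vanishes {m} {k} {b} E v with Eigen.D-trivial E
... | inj₁ 1≤i = subst (λ o → Congruent m (D k (k ℕ./ 3) o) 0ℤ) (sym (odd≡ b)) (from-mod _ 0ℤ (v (k ℕ./ 3) 1≤i ℕₚ.≤-refl))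
... | inj₂ D≡0 = Setoid.reflexive (modSetoid m) (D≡0 (odd b))

module _ {m k b c₂} (E : Eigen k) (v : DVanish m k (suc b)) (c₂≡ : Congruent m (+ c₂) (C k (odd b))) where

  open Eigen E
  open Hecke₃.Recurrence recurrence using (G)
  open SetoidReasoning (modSetoid m)

  private
    a = η ^ᵣ k

  η^-step : ∀ n → Congruent m (a (3 ^ odd b * n)) (+ c₂ ℤ.* φ a n)
  η^-step n = begin
    a (3 ^ odd b * n)
      ≡⟨ iterates-index k b n ⟨
    Hecke₃.iterates k b n
      ≡⟨ Hecke₃.iterates≈ {k} {h k} {r k} {λ β → C k (odd β)} {λ β → D k (k ℕ./ 3) (odd β)} recurrence
           C-3 (λ β → C-rec (odd β)) D-3 (λ β → D-rec (odd β)) b n ⟩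
    (# c *ₛ φ η ^ᵣ k) n ℤ.+ (# d *ₛ G) n
      ≡⟨ cong₂ ℤ._+_ (const-* c (φ η ^ᵣ k) n) (const-* d G n) ⟩
    c ℤ.* (φ η ^ᵣ k) n ℤ.+ d ℤ.* G n
      ≡⟨ cong (λ y → c ℤ.* y ℤ.+ d ℤ.* G n) (Endomorphism.φ-^ (dilation 2) η k n) ⟨
    c ℤ.* φ a n ℤ.+ d ℤ.* G n
      ≈⟨ mod-+ (mod-*ʳ (φ a n) (Setoid.sym (modSetoid m) c₂≡)) (mod-*ʳ (G n) (D-vanishes E v)) ⟩
    + c₂ ℤ.* φ a n ℤ.+ 0ℤ
      ≡⟨ ℤₚ.+-identityʳ (+ c₂ ℤ.* φ a n) ⟩
    + c₂ ℤ.* φ a n ∎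
    where
    c = C k (odd b)
    d = D k (k ℕ./ 3) (odd b)

  -- At multiples of 3 the dilation disappears, which leaves a relation for a alone that can be
  -- iterated.
  η^-period : ∀ n → Congruent m (a (3 ^ suc (odd b) * n)) (+ c₂ ℤ.* a n)
  η^-period n = begin
    a (3 * 3 ^ odd b * n)      ≡⟨ cong a (lemma (3 ^ odd b) n) ⟩
    a (3 ^ odd b * (n * 3))    ≈⟨ η^-step (n * 3) ⟩
    + c₂ ℤ.* φ a (n * 3)       ≡⟨ cong (+ c₂ ℤ.*_) (dil-residue a 0 n (s≤s z≤n)) ⟩
    + c₂ ℤ.* a n               ∎
    where
    lemma : ∀ t n → 3 * t * n ≡ t * (n * 3)
    lemma = ℕ-Tactic.solve-∀

  η^-iterate : ∀ β n → Congruent m (a (3 ^ (β * suc (odd b)) * n)) (+ (c₂ ^ β) ℤ.* a n)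
  η^-iterate zero    n = begin
    a (1 * n)        ≡⟨ cong a (ℕₚ.*-identityˡ n) ⟩
    a n              ≡⟨ ℤₚ.*-identityˡ (a n) ⟨
    + 1 ℤ.* a n      ∎
  η^-iterate (suc β) n = begin
    a (3 ^ (suc (odd b) ℕ.+ s) * n)
      ≡⟨ cong a (trans (cong (_* n) (ℕₚ.^-distribˡ-+-* 3 (suc (odd b)) s)) (ℕₚ.*-assoc (3 ^ suc (odd b)) (3 ^ s) n)) ⟩
    a (3 ^ suc (odd b) * (3 ^ s * n))    ≈⟨ η^-period (3 ^ s * n) ⟩
    + c₂ ℤ.* a (3 ^ s * n)               ≈⟨ mod-*ˡ (+ c₂) (η^-iterate β n) ⟩
    + c₂ ℤ.* (+ (c₂ ^ β) ℤ.* a n)        ≡⟨ ℤₚ.*-assoc (+ c₂) (+ (c₂ ^ β)) (a n) ⟨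
    + c₂ ℤ.* + (c₂ ^ β) ℤ.* a n          ≡⟨ cong (ℤ._* a n) (ℤₚ.pos-* c₂ (c₂ ^ β)) ⟨
    + (c₂ ^ suc β) ℤ.* a n               ∎
    where s = β * suc (odd b)

  -- For β + 1 periods the exponent 2ν(β+1) - 1 is split as 2νβ + (2ν - 1): β full periods, then one
  -- stopped a step short, which keeps φ in the result.
  η^-odd : ∀ β n → Congruent m (a (3 ^ (2 * suc b * suc β ∸ 1) * n)) (+ (c₂ ^ suc β) ℤ.* φ a n)
  η^-odd β n = begin
    a (3 ^ (2 * suc b * suc β ∸ 1) * n)  ≡⟨ cong (λ o → a (3 ^ o * n)) exponent ⟩
    a (3 ^ (s ℕ.+ odd b) * n)
      ≡⟨ cong a (trans (cong (_* n) (ℕₚ.^-distribˡ-+-* 3 s (odd b))) (ℕₚ.*-assoc (3 ^ s) (3 ^ odd b) n)) ⟩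
    a (3 ^ s * (3 ^ odd b * n))          ≈⟨ η^-iterate β (3 ^ odd b * n) ⟩
    + (c₂ ^ β) ℤ.* a (3 ^ odd b * n)     ≈⟨ mod-*ˡ (+ (c₂ ^ β)) (η^-step n) ⟩
    + (c₂ ^ β) ℤ.* (+ c₂ ℤ.* φ a n)      ≡⟨ ℤₚ.*-assoc (+ (c₂ ^ β)) (+ c₂) (φ a n) ⟨
    + (c₂ ^ β) ℤ.* + c₂ ℤ.* φ a n        ≡⟨ cong (ℤ._* φ a n) (ℤₚ.pos-* (c₂ ^ β) c₂) ⟨
    + (c₂ ^ β * c₂) ℤ.* φ a n            ≡⟨ cong (λ c → + c ℤ.* φ a n) (ℕₚ.*-comm (c₂ ^ β) c₂) ⟩
    + (c₂ ^ suc β) ℤ.* φ a n             ∎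
    where
    s = β * suc (odd b)
    lemma : ∀ o β → suc o * suc β ≡ suc (β * suc o ℕ.+ o)
    lemma = ℕ-Tactic.solve-∀
    exponent : 2 * suc b * suc β ∸ 1 ≡ s ℕ.+ odd b
    exponent = cong (_∸ 1) (trans (cong (_* suc β) (sym (cong suc (odd≡ b)))) (lemma (odd b) β))

-- The arguments of p as exponents of x^k

module _ (k b β n : ℕ) where

  private
    e = 2 * suc b * suc β
    t = proj₁ (nine (suc b * suc β))

    3^e : 3 ^ e ≡ 1 ℕ.+ t * 8
    3^e = trans (cong (3 ^_) (ℕₚ.*-assoc 2 (suc b) (suc β))) (proj₂ (nine (suc b * suc β)))

    -- `e` reduces to a successor, so that 3 * 3 ^ (e ∸ 1) and 3 ^ e are definitionally equal.
    3*3^ : 3 * 3 ^ (e ∸ 1) ≡ 1 ℕ.+ t * 8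
    3*3^ = 3^e

  -- In x^k the value p (3k) N sits at exponent k + 8N (`p≡η^`). Writing that exponent as a multiple
  -- of 3^(e ∸ 1) makes `η^-odd` applicable.
  index₂-formula : k ℕ.+ index₂ k (suc b) (suc β) n * 8 ≡ 3 ^ (e ∸ 1) * (8 * n ℕ.+ 3 * k)
  index₂-formula = begin
    k ℕ.+ (s * n ℕ.+ (k * (3 ^ e ∸ 1)) ℕ./ 8) * 8
      ≡⟨ cong (λ w → k ℕ.+ (s * n ℕ.+ w) * 8) (trans (cong (λ w → (k * (w ∸ 1)) ℕ./ 8) 3^e)
           (trans (/-congˡ (sym (ℕₚ.*-assoc k t 8))) (m*n/n≡m (k * t) 8))) ⟩
    k ℕ.+ (s * n ℕ.+ k * t) * 8       ≡⟨ lemma₁ k s n t ⟩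
    k * (1 ℕ.+ t * 8) ℕ.+ s * (8 * n) ≡⟨ cong (λ w → k * w ℕ.+ s * (8 * n)) 3*3^ ⟨
    k * (3 * s) ℕ.+ s * (8 * n)       ≡⟨ lemma₂ k s n ⟩
    s * (8 * n ℕ.+ 3 * k)             ∎
    where
    open ≡-Reasoning
    s = 3 ^ (e ∸ 1)
    lemma₁ : ∀ k s n t → k ℕ.+ (s * n ℕ.+ k * t) * 8 ≡ k * (1 ℕ.+ t * 8) ℕ.+ s * (8 * n)
    lemma₁ = ℕ-Tactic.solve-∀
    lemma₂ : ∀ k s n → k * (3 * s) ℕ.+ s * (8 * n) ≡ s * (8 * n ℕ.+ 3 * k)
    lemma₂ = ℕ-Tactic.solve-∀

  index₁-formula : ∀ i → k ℕ.+ index₁ k (suc b) (suc β) i n * 8 ≡ 3 ^ (e ∸ 1) * (24 * n ℕ.+ 3 * k ℕ.+ 8 * i)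
  index₁-formula i = begin
    k ℕ.+ (3 ^ e * n ℕ.+ ((3 * k ℕ.+ 8 * i) * s ∸ k) ℕ./ 8) * 8
      ≡⟨ cong (λ w → k ℕ.+ (3 ^ e * n ℕ.+ w) * 8) (trans (/-congˡ numerator) (m*n/n≡m (k * t ℕ.+ i * s) 8)) ⟩
    k ℕ.+ (3 * s * n ℕ.+ (k * t ℕ.+ i * s)) * 8   ≡⟨ lemma₂ k s n t i ⟩
    k * (1 ℕ.+ t * 8) ℕ.+ s * (24 * n ℕ.+ 8 * i)   ≡⟨ cong (λ w → k * w ℕ.+ s * (24 * n ℕ.+ 8 * i)) 3*3^ ⟨
    k * (3 * s) ℕ.+ s * (24 * n ℕ.+ 8 * i)         ≡⟨ lemma₃ k s n i ⟩
    s * (24 * n ℕ.+ 3 * k ℕ.+ 8 * i)               ∎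
    where
    open ≡-Reasoning
    s = 3 ^ (e ∸ 1)
    lemma₀ : ∀ k s i → (3 * k ℕ.+ 8 * i) * s ≡ k * (3 * s) ℕ.+ 8 * i * s
    lemma₀ = ℕ-Tactic.solve-∀
    lemma₁ : ∀ k s t i → k * (1 ℕ.+ t * 8) ℕ.+ 8 * i * s ≡ k ℕ.+ (k * t ℕ.+ i * s) * 8
    lemma₁ = ℕ-Tactic.solve-∀
    lemma₂ : ∀ k s n t i → k ℕ.+ (3 * s * n ℕ.+ (k * t ℕ.+ i * s)) * 8 ≡ k * (1 ℕ.+ t * 8) ℕ.+ s * (24 * n ℕ.+ 8 * i)
    lemma₂ = ℕ-Tactic.solve-∀
    lemma₃ : ∀ k s n i → k * (3 * s) ℕ.+ s * (24 * n ℕ.+ 8 * i) ≡ s * (24 * n ℕ.+ 3 * k ℕ.+ 8 * i)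
    lemma₃ = ℕ-Tactic.solve-∀
    numerator : (3 * k ℕ.+ 8 * i) * s ∸ k ≡ (k * t ℕ.+ i * s) * 8
    numerator = trans (cong (_∸ k) (trans (lemma₀ k s i) (trans (cong (λ w → k * w ℕ.+ 8 * i * s) 3*3^) (lemma₁ k s t i))))
      (ℕₚ.m+n∸m≡n k _)

φ-1mod3 : ∀ F l → φ F (1 ℕ.+ l * 3) ≡ 0ℤ
φ-1mod3 F l = dil-residue F 1 l (s≤s (s≤s z≤n))

φ-2mod3 : ∀ F l → φ F (2 ℕ.+ l * 3) ≡ 0ℤ
φ-2mod3 F l = dil-residue F 2 l (s≤s (s≤s (s≤s z≤n)))

-- Modulo 3 the argument is 8i, that is 2 or 1, whereas φ F is supported on multiples of 3.
φ-nonmultiple : ∀ F k n i → i ≡ 1 ⊎ i ≡ 2 → φ F (24 * n ℕ.+ 3 * k ℕ.+ 8 * i) ≡ 0ℤ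
φ-nonmultiple F k n _ (inj₁ refl) = trans (cong (φ F) (lemma k n)) (φ-2mod3 F (8 * n ℕ.+ k ℕ.+ 2))
  where
  lemma : ∀ k n → 24 * n ℕ.+ 3 * k ℕ.+ 8 ≡ 2 ℕ.+ (8 * n ℕ.+ k ℕ.+ 2) * 3
  lemma = ℕ-Tactic.solve-∀
φ-nonmultiple F k n _ (inj₂ refl) = trans (cong (φ F) (lemma k n)) (φ-1mod3 F (8 * n ℕ.+ k ℕ.+ 5))
  where
  lemma : ∀ k n → 24 * n ℕ.+ 3 * k ℕ.+ 16 ≡ 1 ℕ.+ (8 * n ℕ.+ k ℕ.+ 5) * 3
  lemma = ℕ-Tactic.solve-∀

theorem1p4 : (m k : ℕ) → 2 ≤ m → 1 ≤ k → k ≤ 8 →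
    (ν c₂ : ℕ) → IsNu m k ν → IsC₂ m k ν c₂ →
    ((∀ β → 1 ≤ β → ¬ (+ (c₂ ^ β) ≡ 0ℤ [mod m ])) →
    ∀ β n i → 1 ≤ β → (i ≡ 1 ⊎ i ≡ 2) →
    p (3 * k) (index₁ k ν β i n) ≡ 0ℤ [mod m ])
    ×
    (∀ β → 1 ≤ β → + (c₂ ^ β) ≡ 0ℤ [mod m ] →
    ∀ n → p (3 * k) (index₂ k ν β n) ≡ 0ℤ [mod m ])
theorem1p4 m k 2≤m 1≤k k≤8 zero c₂ isNu isC₂ with () ← IsNu.positive isNu
theorem1p4 m k 2≤m 1≤k k≤8 (suc b) c₂ isNu isC₂ =
  (λ _ β n i 1≤β i≡ → to-mod (part₁ β n i 1≤β i≡)) ,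
  (λ β 1≤β c₂^β≡0 n → to-mod (part₂ β 1≤β (from-mod (+ (c₂ ^ β)) 0ℤ c₂^β≡0) n))
  where
  open SetoidReasoning (modSetoid m)

  -- Shared by both parts: in the first the factor with φ is 0, in the second the power of c₂ is 0
  -- modulo m.
  p≡ : ∀ β N M → k ℕ.+ N * 8 ≡ 3 ^ (2 * suc b * suc β ∸ 1) * M →
    Congruent m (p (3 * k) N) (+ (c₂ ^ suc β) ℤ.* φ (η ^ᵣ k) M)
  p≡ β N M eq = begin
    p (3 * k) N                                      ≡⟨ p≡η^ k N ⟩
    (η ^ᵣ k) (k ℕ.+ N * 8)                           ≡⟨ cong (η ^ᵣ k) eq ⟩
    (η ^ᵣ k) (3 ^ (2 * suc b * suc β ∸ 1) * M)       ≈⟨ η^-odd {b = b} (eigen k 1≤k k≤8) (IsNu.vanishes isNu)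
                                                          (from-mod (+ c₂) (C k (odd b)) (subst (λ o → + c₂ ≡ C k o [mod m ]) (sym (odd≡ b)) (IsC₂.congruent isC₂))) β M ⟩
    + (c₂ ^ suc β) ℤ.* φ (η ^ᵣ k) M                  ∎

  part₁ : ∀ β n i → 1 ≤ β → i ≡ 1 ⊎ i ≡ 2 → Congruent m (p (3 * k) (index₁ k (suc b) β i n)) 0ℤ
  part₁ (suc β) n i _ i≡ = begin
    p (3 * k) (index₁ k (suc b) (suc β) i n)   ≈⟨ p≡ β (index₁ k (suc b) (suc β) i n) (24 * n ℕ.+ 3 * k ℕ.+ 8 * i) (index₁-formula k b β n i) ⟩
    + (c₂ ^ suc β) ℤ.* φ (η ^ᵣ k) (24 * n ℕ.+ 3 * k ℕ.+ 8 * i)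
                                               ≡⟨ cong (+ (c₂ ^ suc β) ℤ.*_) (φ-nonmultiple (η ^ᵣ k) k n i i≡) ⟩
    + (c₂ ^ suc β) ℤ.* 0ℤ                      ≡⟨ ℤₚ.*-zeroʳ (+ (c₂ ^ suc β)) ⟩
    0ℤ                                         ∎

  part₂ : ∀ β → 1 ≤ β → Congruent m (+ (c₂ ^ β)) 0ℤ → ∀ n → Congruent m (p (3 * k) (index₂ k (suc b) β n)) 0ℤ
  part₂ (suc β) _ c₂^β≡0 n = begin
    p (3 * k) (index₂ k (suc b) (suc β) n)              ≈⟨ p≡ β (index₂ k (suc b) (suc β) n) (8 * n ℕ.+ 3 * k) (index₂-formula k b β n) ⟩
    + (c₂ ^ suc β) ℤ.* φ (η ^ᵣ k) (8 * n ℕ.+ 3 * k)     ≈⟨ mod-*ʳ (φ (η ^ᵣ k) (8 * n ℕ.+ 3 * k)) c₂^β≡0 ⟩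
    0ℤ                                                  ∎
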